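{- Fix an integer $k\ge 0$ and a real number $\epsilon>0$, and let $p=p(n)\in[0,1]$ satisfy $p\le n^{ -1/(k+1)-\epsilon}$. If $X$ is a random simplicial complex distributed as $X(n,p)$, then with high probability $X$ is $(k+1)$-collapsible; that is, $P(X \text{ is } (k+1)\text{ -collapsible})\to 1$ as $n\to\infty$.
   Context: A simplicial complex is a clique complex (flag complex) if it is the maximal simplicial complex supported on its edge set, i.e. every complete subgraph of its 1-skeleton is filled in with a simplex. $X(n,p)$ is the probability space of clique complexes on $n$ vertices in which each edge appears independently with probability $p$; equivalently, one samples a graph from the Erdős–Rényi model $G(n,p)$ and takes its clique complex. A property holds with high probability if its probability tends to $1$ as $n\to\infty$. Let $\Delta$ be a simplicial complex with (nonempty) faces $\sigma\subsetneq\tau$ such that $\tau$ is a maximal face of $\Delta$ and $\sigma$ is contained in no other maximal face of $\Delta$. Then $\sigma$ is called a free face of $\tau$, and the simplicial collapse of the interval $[\sigma,\tau]$ is the removal from $\Delta$ of all faces $\eta$ with $\sigma\subseteq\eta\subseteq\tau$. A complex is $m$-collapsible if all its faces of dimension at least $m$ can be collapsed, i.e. there is a finite (possibly empty) sequence of simplicial collapses reducing it to a complex of dimension at most $m-1$. -}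

module Defs where

open import Data.Bool.Base using (Bool; true; false; T)
import Data.Bool.Properties as Bool
open import Data.Fin.Base using (Fin; zero; suc)
import Data.Fin.Properties as Fin
open import Data.Fin.Subset
  using (Subset; inside; outside; _∈_; _⊆_; _⊂_; _⊃_; Nonempty; ∣_∣)
open import Data.Fin.Subset.Induction using (⊃-wellFounded)
open import Data.Fin.Subset.Properties
  using (_∈?_; _⊆?_; _⊂?_; nonempty?; anySubset?; ⊆-refl; ⊆-trans; ⊆-antisym)
open import Data.Integer.Base as ℤ using (ℤ; +_; -[1+_])
import Data.Integer.Properties as ℤ
open import Data.List.Base as List using (List; []; _∷_; [_]; _++_; length; filter; foldr)
open import Data.List.Membership.Propositional using () renaming (_∈_ to _∈ˡ_)
open import Data.List.Membership.Propositional.Properties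
  using (∈-++⁺ˡ; ∈-++⁺ʳ; ∈-map⁺)
open import Data.List.Relation.Unary.Any using (here; there)
open import Data.Nat.Base as ℕ using (ℕ; zero; suc; NonZero; _⊔_; z≤n; s≤s)
import Data.Nat.Properties as ℕ
open import Data.Nat.Induction using (<-wellFounded)
import Data.Nat.Tactic.RingSolver as ℕ-Solver
open import Data.Product.Base using (∃-syntax; Σ-syntax; _×_; _,_; proj₁; proj₂)
open import Data.Rational.Base as ℚ using (ℚ; 0ℚ; 1ℚ; ½; mkℚ; ↥_; ↧ₙ_)
import Data.Rational.Properties as ℚ
import Data.Integer.Tactic.RingSolver as ℤ-Solver
import Data.Rational.Unnormalised.Base as ℚᵘ
import Data.Rational.Unnormalised.Properties as ℚᵘ
open import Data.Sum.Base using (inj₁; inj₂)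
open import Data.Vec.Base using ([]; _∷_; lookup)
import Data.Vec.Properties as Vec
open import Function.Bundles using (_⇔_; mk⇔; Equivalence)
open import Induction.WellFounded using (Acc; acc)
open import Level using (0ℓ)
open import Relation.Binary.Construct.Closure.ReflexiveTransitive using (Star; ε; _◅_)
open import Relation.Binary.PropositionalEquality
  using (_≡_; _≢_; refl; sym; trans; cong; cong₂; subst; subst₂)
open import Relation.Nullary using (¬_; Dec; yes; no; contradiction)
open import Relation.Nullary.Decidable
  using (map′; dec⇒maybe; ¬?; _×-dec_; _→-dec_; decidable-stable)
open import Relation.Unary using (Pred; Decidable)
open import Tactic.RingSolver using (solve-∀)
open import Tactic.RingSolver.Core.AlmostCommutativeRing
  using (AlmostCommutativeRing; fromCommutativeRing)

------------------------------------------------------------------------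
-- Cauchy real numbers

TailWithin : (ℕ → ℚ) → ℚ → Set
TailWithin s δ = ∃[ N ] (∀ i j → N ℕ.≤ i → N ℕ.≤ j → ℚ.∣ s i ℚ.- s j ∣ ℚ.≤ δ)

-- A real is a Cauchy sequence of rationals together with a modulus.

record ℝ : Set where
  constructor mkℝ
  field
    seq    : ℕ → ℚ
    cauchy : ∀ δ → 0ℚ ℚ.< δ → TailWithin seq δ

open ℝ public

infix 4 _≤ʳ_ _<ʳ_

_≤ʳ_ : ℝ → ℝ → Set
x ≤ʳ y = ∀ δ → 0ℚ ℚ.< δ → ∃[ N ] (∀ i → N ℕ.≤ i → seq x i ℚ.≤ seq y i ℚ.+ δ)

_<ʳ_ : ℝ → ℝ → Set
x <ʳ y = ∃[ δ ] (0ℚ ℚ.< δ × ∃[ N ] (∀ i → N ℕ.≤ i → seq x i ℚ.+ δ ℚ.≤ seq y i))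

ℚ-ring : AlmostCommutativeRing 0ℓ 0ℓ
ℚ-ring = fromCommutativeRing ℚ.+-*-commutativeRing (λ q → dec⇒maybe (0ℚ ℚ.≟ q))

half>0 : ∀ {δ} → 0ℚ ℚ.< δ → 0ℚ ℚ.< ½ ℚ.* δ
half>0 {δ} 0<δ = subst (ℚ._< ½ ℚ.* δ) (ℚ.*-zeroʳ ½) (ℚ.*-monoʳ-<-pos ½ 0<δ)

half+half : ∀ δ → ½ ℚ.* δ ℚ.+ ½ ℚ.* δ ≡ δ
half+half δ = trans (sym (ℚ.*-distribʳ-+ δ ½ ½)) (ℚ.*-identityˡ δ)

bound : ∀ (x : ℝ) →
        ∃[ B ] (0ℚ ℚ.< B × ∃[ N ] (∀ i → N ℕ.≤ i → ℚ.∣ seq x i ∣ ℚ.≤ B))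
bound x with cauchy x 1ℚ (ℚ.positive⁻¹ 1ℚ)
... | N , h = B , 0<B , N , λ i N≤i → begin
    ℚ.∣ seq x i ∣                                    ≡⟨ cong ℚ.∣_∣ (eq (seq x i) (seq x N)) ⟩
    ℚ.∣ (seq x i ℚ.- seq x N) ℚ.+ seq x N ∣          ≤⟨ ℚ.∣p+q∣≤∣p∣+∣q∣ (seq x i ℚ.- seq x N) (seq x N) ⟩
    ℚ.∣ seq x i ℚ.- seq x N ∣ ℚ.+ ℚ.∣ seq x N ∣      ≤⟨ ℚ.+-monoˡ-≤ ℚ.∣ seq x N ∣ (h i N N≤i ℕ.≤-refl) ⟩
    B ∎
  where
  open ℚ.≤-Reasoning
  B : ℚ
  B = 1ℚ ℚ.+ ℚ.∣ seq x N ∣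
  0<B : 0ℚ ℚ.< B
  0<B = ℚ.+-mono-<-≤ (ℚ.positive⁻¹ 1ℚ) (ℚ.0≤∣p∣ (seq x N))
  eq : ∀ a b → a ≡ (a ℚ.- b) ℚ.+ b
  eq = solve-∀ ℚ-ring

scaled : ∀ B → 0ℚ ℚ.< B → ∀ δ → 0ℚ ℚ.< δ → ∃[ γ ] (0ℚ ℚ.< γ × B ℚ.* γ ≡ δ)
scaled B 0<B δ 0<δ = γ , 0<γ , eq
  where
  instance
    B-pos : ℚ.Positive B
    B-pos = ℚ.positive 0<B
    B-nz : ℚ.NonZero B
    B-nz = ℚ.pos⇒nonZero B
    δ-pos : ℚ.Positive δ
    δ-pos = ℚ.positive 0<δ
    B⁻¹-pos : ℚ.Positive (ℚ.1/ B)
    B⁻¹-pos = ℚ.1/pos⇒pos B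
  γ : ℚ
  γ = ℚ.1/ B ℚ.* δ
  0<γ : 0ℚ ℚ.< γ
  0<γ = ℚ.positive⁻¹ γ {{ℚ.pos*pos⇒pos (ℚ.1/ B) δ}}
  eq : B ℚ.* γ ≡ δ
  eq = trans (sym (ℚ.*-assoc B (ℚ.1/ B) δ))
         (trans (cong (ℚ._* δ) (ℚ.*-inverseʳ B)) (ℚ.*-identityˡ δ))

*-mono-≤-nonNeg : ∀ {a b c d} → 0ℚ ℚ.≤ c → 0ℚ ℚ.≤ b →
                  a ℚ.≤ b → c ℚ.≤ d → a ℚ.* c ℚ.≤ b ℚ.* d
*-mono-≤-nonNeg {a} {b} {c} {d} 0≤c 0≤b a≤b c≤d = ℚ.≤-trans
  (ℚ.*-monoʳ-≤-nonNeg c {{ℚ.nonNegative 0≤c}} a≤b)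
  (ℚ.*-monoˡ-≤-nonNeg b {{ℚ.nonNegative 0≤b}} c≤d)

one-sided : ∀ {a b δ} → a ℚ.≤ b ℚ.+ δ → b ℚ.≤ a ℚ.+ δ → ℚ.∣ a ℚ.- b ∣ ℚ.≤ δ
one-sided {a} {b} {δ} h₁ h₂ with ℚ.∣p∣≡p∨∣p∣≡-p (a ℚ.- b)
... | inj₁ e = subst (ℚ._≤ δ) (sym e)
                 (subst (a ℚ.- b ℚ.≤_) (eq b δ) (ℚ.+-monoˡ-≤ (ℚ.- b) h₁))
  where
  eq : ∀ b δ → (b ℚ.+ δ) ℚ.- b ≡ δ
  eq = solve-∀ ℚ-ring
... | inj₂ e = subst (ℚ._≤ δ) (sym e)
                 (subst₂ ℚ._≤_ (eq₁ a b) (eq₂ a δ) (ℚ.+-monoˡ-≤ (ℚ.- a) h₂))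
  where
  eq₁ : ∀ a b → b ℚ.- a ≡ ℚ.- (a ℚ.- b)
  eq₁ = solve-∀ ℚ-ring
  eq₂ : ∀ a δ → (a ℚ.+ δ) ℚ.- a ≡ δ
  eq₂ = solve-∀ ℚ-ring

fromℚ : ℚ → ℝ
fromℚ q = mkℝ (λ _ → q) λ δ 0<δ → 0 , λ _ _ _ _ →
  subst (λ z → ℚ.∣ z ∣ ℚ.≤ δ) (sym (ℚ.+-inverseʳ q)) (ℚ.<⇒≤ 0<δ)

0ʳ 1ʳ : ℝ
0ʳ = fromℚ 0ℚ
1ʳ = fromℚ 1ℚ

infixl 6 _+ʳ_ _-ʳ_
infixl 7 _*ʳ_
infix  8 -ʳ_

_+ʳ_ : ℝ → ℝ → ℝ
x +ʳ y = mkℝ (λ i → seq x i ℚ.+ seq y i) cauchy-+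
  where
  open ℚ.≤-Reasoning
  eq : ∀ a b c d → (a ℚ.+ b) ℚ.- (c ℚ.+ d) ≡ (a ℚ.- c) ℚ.+ (b ℚ.- d)
  eq = solve-∀ ℚ-ring
  cauchy-+ : ∀ δ → 0ℚ ℚ.< δ → TailWithin (λ i → seq x i ℚ.+ seq y i) δ
  cauchy-+ δ 0<δ with cauchy x (½ ℚ.* δ) (half>0 0<δ) | cauchy y (½ ℚ.* δ) (half>0 0<δ)
  ... | M , hx | N , hy = M ⊔ N , λ i j i≥ j≥ → begin
    ℚ.∣ (seq x i ℚ.+ seq y i) ℚ.- (seq x j ℚ.+ seq y j) ∣
      ≡⟨ cong ℚ.∣_∣ (eq (seq x i) (seq y i) (seq x j) (seq y j)) ⟩
    ℚ.∣ (seq x i ℚ.- seq x j) ℚ.+ (seq y i ℚ.- seq y j) ∣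
      ≤⟨ ℚ.∣p+q∣≤∣p∣+∣q∣ (seq x i ℚ.- seq x j) (seq y i ℚ.- seq y j) ⟩
    ℚ.∣ seq x i ℚ.- seq x j ∣ ℚ.+ ℚ.∣ seq y i ℚ.- seq y j ∣
      ≤⟨ ℚ.+-mono-≤ (hx i j (ℕ.m⊔n≤o⇒m≤o M N i≥) (ℕ.m⊔n≤o⇒m≤o M N j≥))
                    (hy i j (ℕ.m⊔n≤o⇒n≤o M N i≥) (ℕ.m⊔n≤o⇒n≤o M N j≥)) ⟩
    ½ ℚ.* δ ℚ.+ ½ ℚ.* δ ≡⟨ half+half δ ⟩
    δ ∎

-ʳ_ : ℝ → ℝ
-ʳ x = mkℝ (λ i → ℚ.- seq x i) λ δ 0<δ →
  let N , h = cauchy x δ 0<δ in N , λ i j i≥ j≥ →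
    subst (ℚ._≤ δ) (trans (sym (ℚ.∣-p∣≡∣p∣ (seq x i ℚ.- seq x j)))
                          (cong ℚ.∣_∣ (eq (seq x i) (seq x j))))
          (h i j i≥ j≥)
  where
  eq : ∀ a b → ℚ.- (a ℚ.- b) ≡ (ℚ.- a) ℚ.- (ℚ.- b)
  eq = solve-∀ ℚ-ring

_-ʳ_ : ℝ → ℝ → ℝ
x -ʳ y = x +ʳ (-ʳ y)

*-close : ∀ a b c d A B α β → ℚ.∣ a ∣ ℚ.≤ A → ℚ.∣ d ∣ ℚ.≤ B →
          ℚ.∣ b ℚ.- d ∣ ℚ.≤ α → ℚ.∣ a ℚ.- c ∣ ℚ.≤ β →
          ℚ.∣ (a ℚ.* b) ℚ.- (c ℚ.* d) ∣ ℚ.≤ A ℚ.* α ℚ.+ B ℚ.* β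
*-close a b c d A B α β a≤A d≤B bd≤α ac≤β = begin
  ℚ.∣ (a ℚ.* b) ℚ.- (c ℚ.* d) ∣
    ≡⟨ cong ℚ.∣_∣ (eq a b c d) ⟩
  ℚ.∣ a ℚ.* (b ℚ.- d) ℚ.+ d ℚ.* (a ℚ.- c) ∣
    ≤⟨ ℚ.∣p+q∣≤∣p∣+∣q∣ (a ℚ.* (b ℚ.- d)) (d ℚ.* (a ℚ.- c)) ⟩
  ℚ.∣ a ℚ.* (b ℚ.- d) ∣ ℚ.+ ℚ.∣ d ℚ.* (a ℚ.- c) ∣
    ≡⟨ cong₂ ℚ._+_ (ℚ.∣p*q∣≡∣p∣*∣q∣ a (b ℚ.- d)) (ℚ.∣p*q∣≡∣p∣*∣q∣ d (a ℚ.- c)) ⟩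
  ℚ.∣ a ∣ ℚ.* ℚ.∣ b ℚ.- d ∣ ℚ.+ ℚ.∣ d ∣ ℚ.* ℚ.∣ a ℚ.- c ∣
    ≤⟨ ℚ.+-mono-≤
         (*-mono-≤-nonNeg (ℚ.0≤∣p∣ (b ℚ.- d)) (ℚ.≤-trans (ℚ.0≤∣p∣ a) a≤A) a≤A bd≤α)
         (*-mono-≤-nonNeg (ℚ.0≤∣p∣ (a ℚ.- c)) (ℚ.≤-trans (ℚ.0≤∣p∣ d) d≤B) d≤B ac≤β) ⟩
  A ℚ.* α ℚ.+ B ℚ.* β ∎
  where
  open ℚ.≤-Reasoning
  eq : ∀ a b c d → (a ℚ.* b) ℚ.- (c ℚ.* d) ≡ a ℚ.* (b ℚ.- d) ℚ.+ d ℚ.* (a ℚ.- c)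
  eq = solve-∀ ℚ-ring

_*ʳ_ : ℝ → ℝ → ℝ
x *ʳ y = mkℝ (λ i → seq x i ℚ.* seq y i)
             (λ δ 0<δ → split δ 0<δ (bound x) (bound y))
  where
  Bounded : ℝ → Set
  Bounded z = ∃[ B ] (0ℚ ℚ.< B × ∃[ N ] (∀ i → N ℕ.≤ i → ℚ.∣ seq z i ∣ ℚ.≤ B))

  combine : ∀ δ A B α β → A ℚ.* α ≡ ½ ℚ.* δ → B ℚ.* β ≡ ½ ℚ.* δ →
            ∃[ K ] (∀ i → K ℕ.≤ i → ℚ.∣ seq x i ∣ ℚ.≤ A) →
            ∃[ L ] (∀ i → L ℕ.≤ i → ℚ.∣ seq y i ∣ ℚ.≤ B) →
            TailWithin (seq y) α → TailWithin (seq x) β →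
            TailWithin (λ i → seq x i ℚ.* seq y i) δ
  combine δ A B α β Aα Bβ (K , hA) (L , hB) (M , hy) (N , hx) =
    (K ⊔ L) ⊔ (M ⊔ N) , λ i j i≥ j≥ →
    subst (ℚ.∣ (seq x i ℚ.* seq y i) ℚ.- (seq x j ℚ.* seq y j) ∣ ℚ.≤_)
      (trans (cong₂ ℚ._+_ Aα Bβ) (half+half δ))
      (*-close (seq x i) (seq y i) (seq x j) (seq y j) A B α β
        (hA i (ℕ.m⊔n≤o⇒m≤o K L (≥KL i≥)))
        (hB j (ℕ.m⊔n≤o⇒n≤o K L (≥KL j≥)))
        (hy i j (ℕ.m⊔n≤o⇒m≤o M N (≥MN i≥)) (ℕ.m⊔n≤o⇒m≤o M N (≥MN j≥)))
        (hx i j (ℕ.m⊔n≤o⇒n≤o M N (≥MN i≥)) (ℕ.m⊔n≤o⇒n≤o M N (≥MN j≥))))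
    where
    ≥KL : ∀ {i} → (K ⊔ L) ⊔ (M ⊔ N) ℕ.≤ i → K ⊔ L ℕ.≤ i
    ≥KL = ℕ.m⊔n≤o⇒m≤o (K ⊔ L) (M ⊔ N)
    ≥MN : ∀ {i} → (K ⊔ L) ⊔ (M ⊔ N) ℕ.≤ i → M ⊔ N ℕ.≤ i
    ≥MN = ℕ.m⊔n≤o⇒n≤o (K ⊔ L) (M ⊔ N)

  choose : ∀ δ A B → ∃[ K ] (∀ i → K ℕ.≤ i → ℚ.∣ seq x i ∣ ℚ.≤ A) →
           ∃[ L ] (∀ i → L ℕ.≤ i → ℚ.∣ seq y i ∣ ℚ.≤ B) →
           ∃[ α ] (0ℚ ℚ.< α × A ℚ.* α ≡ ½ ℚ.* δ) →
           ∃[ β ] (0ℚ ℚ.< β × B ℚ.* β ≡ ½ ℚ.* δ) →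
           TailWithin (λ i → seq x i ℚ.* seq y i) δ
  choose δ A B hA hB (α , 0<α , Aα) (β , 0<β , Bβ) =
    combine δ A B α β Aα Bβ hA hB (cauchy y α 0<α) (cauchy x β 0<β)

  split : ∀ δ → 0ℚ ℚ.< δ → Bounded x → Bounded y →
          TailWithin (λ i → seq x i ℚ.* seq y i) δ
  split δ 0<δ (A , 0<A , hA) (B , 0<B , hB) =
    choose δ A B hA hB (scaled A 0<A (½ ℚ.* δ) (half>0 0<δ))
                       (scaled B 0<B (½ ℚ.* δ) (half>0 0<δ))

------------------------------------------------------------------------
-- Limits

infix 4 _⟶_

_⟶_ : (ℕ → ℝ) → ℝ → Set
x ⟶ L = ∀ δ → 0ʳ <ʳ δ →
  ∃[ N ] (∀ n → N ℕ.≤ n → (L -ʳ δ <ʳ x n) × (x n <ʳ L +ʳ δ))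

------------------------------------------------------------------------
-- Real powers of positive natural numbers

posPart negPart : ℤ → ℕ
posPart (+ n)    = n
posPart -[1+ n ] = 0
negPart (+ n)    = 0
negPart -[1+ n ] = suc n

-- RootBelow n q M m says m / M ≤ n ^ q: with q = a / b in lowest terms,
-- (m / M) ^ b ≤ n ^ a, where denominators and a negative a are cleared.

RootBelow : ℕ → ℚ → ℕ → ℕ → Set
RootBelow n q M m =
  m ℕ.^ ↧ₙ q ℕ.* n ℕ.^ negPart (↥ q) ℕ.≤ n ℕ.^ posPart (↥ q) ℕ.* M ℕ.^ ↧ₙ q

rootBelow? : ∀ n q M → Decidable (RootBelow n q M)
rootBelow? n q M m = _ ℕ.≤? _

greatest≤ : ∀ {P : Pred ℕ 0ℓ} → Decidable P → ℕ → ℕ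
greatest≤ P? zero    = zero
greatest≤ P? (suc m) with P? (suc m)
... | yes _ = suc m
... | no  _ = greatest≤ P? m

-- The search bound loses nothing: m / M ≤ n ^ q forces m ≤ n ^ posPart a * M.

rootNumerator : ℕ → ℚ → ℕ → ℕ
rootNumerator n q M = greatest≤ (rootBelow? n q M) (n ℕ.^ posPart (↥ q) ℕ.* M)

-- The largest multiple of 1 / (i + 1) that is at most n ^ q.

approxPow : ℕ → ℚ → ℕ → ℚ
approxPow n q i = + rootNumerator n q (suc i) ℚ./ suc i

greatest≤-holds : ∀ {P : Pred ℕ 0ℓ} (P? : Decidable P) → P 0 → ∀ m → P (greatest≤ P? m)
greatest≤-holds P? P0 zero    = P0
greatest≤-holds P? P0 (suc m) with P? (suc m)
... | yes p = p
... | no  _ = greatest≤-holds P? P0 m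

greatest≤-fails : ∀ {P : Pred ℕ 0ℓ} (P? : Decidable P) m → ¬ P (suc m) →
                  ¬ P (suc (greatest≤ P? m))
greatest≤-fails P? zero    ¬p = ¬p
greatest≤-fails P? (suc m) ¬p with P? (suc m)
... | yes _  = ¬p
... | no ¬p′ = greatest≤-fails P? m ¬p′

^-distribʳ-* : ∀ m n o → (m ℕ.* n) ℕ.^ o ≡ m ℕ.^ o ℕ.* n ℕ.^ o
^-distribʳ-* m n zero    = refl
^-distribʳ-* m n (suc o) = trans (cong (m ℕ.* n ℕ.*_) (^-distribʳ-* m n o))
                                 (lem m n (m ℕ.^ o) (n ℕ.^ o))
  where
  lem : ∀ a b c d → a ℕ.* b ℕ.* (c ℕ.* d) ≡ a ℕ.* c ℕ.* (b ℕ.* d)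
  lem = ℕ-Solver.solve-∀

rootNumerator-below : ∀ n q M → RootBelow n q M (rootNumerator n q M)
rootNumerator-below n q@record{} M =
  greatest≤-holds (rootBelow? n q M) z≤n (n ℕ.^ posPart (↥ q) ℕ.* M)

rootNumerator-max : ∀ n .{{_ : NonZero n}} q M .{{_ : NonZero M}} →
                    ¬ RootBelow n q M (suc (rootNumerator n q M))
rootNumerator-max n q@(mkℚ a d _) M =
  greatest≤-fails (rootBelow? n q M) (c ℕ.* M) λ below → ℕ.<-irrefl refl (begin-strict
    (c ℕ.* M) ℕ.^ suc d          <⟨ ℕ.^-monoˡ-< (suc d) (ℕ.n<1+n (c ℕ.* M)) ⟩
    suc (c ℕ.* M) ℕ.^ suc d      ≤⟨ ℕ.m≤m*n _ (n ℕ.^ negPart a) {{ℕ.m^n≢0 n (negPart a)}} ⟩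
    suc (c ℕ.* M) ℕ.^ suc d ℕ.* n ℕ.^ negPart a  ≤⟨ below ⟩
    c ℕ.* M ℕ.^ suc d            ≤⟨ ℕ.*-monoˡ-≤ (M ℕ.^ suc d) (ℕ.m≤m*n c (c ℕ.^ d) {{ℕ.m^n≢0 c d {{c≢0}}}}) ⟩
    c ℕ.^ suc d ℕ.* M ℕ.^ suc d  ≡⟨ ^-distribʳ-* c M (suc d) ⟨
    (c ℕ.* M) ℕ.^ suc d ∎)
  where
  open ℕ.≤-Reasoning
  c : ℕ
  c = n ℕ.^ posPart a
  c≢0 : NonZero c
  c≢0 = ℕ.m^n≢0 n (posPart a)

^-cancelʳ-≤ : ∀ {m n} o .{{_ : NonZero o}} → m ℕ.^ o ℕ.≤ n ℕ.^ o → m ℕ.≤ n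
^-cancelʳ-≤ {m} {n} o h = ℕ.≮⇒≥ λ n<m → ℕ.<⇒≱ (ℕ.^-monoˡ-< o n<m) h

-- With s = s⁺ - s⁻ and t = t⁺ - t⁻: if (m / M) ^ b ≤ n ^ s, n ^ t ≤ (l / L) ^ c and
-- s / b ≤ t / c + 1 / K, then (m / M) ^ K ≤ n * (l / L) ^ K.
compare : ∀ n .{{_ : NonZero n}} m M l L s⁺ s⁻ t⁺ t⁻ b c K
          .{{_ : NonZero b}} .{{_ : NonZero c}} →
          m ℕ.^ b ℕ.* n ℕ.^ s⁻ ℕ.≤ n ℕ.^ s⁺ ℕ.* M ℕ.^ b →
          n ℕ.^ t⁺ ℕ.* L ℕ.^ c ℕ.≤ l ℕ.^ c ℕ.* n ℕ.^ t⁻ →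
          s⁺ ℕ.* (c ℕ.* K) ℕ.+ t⁻ ℕ.* (b ℕ.* K) ℕ.≤
            b ℕ.* c ℕ.+ (s⁻ ℕ.* (c ℕ.* K) ℕ.+ t⁺ ℕ.* (b ℕ.* K)) →
          (m ℕ.* L) ℕ.^ K ℕ.≤ (l ℕ.* M) ℕ.^ K ℕ.* n
compare n m M l L s⁺ s⁻ t⁺ t⁻ b c K h₁ h₂ hq = ^-cancelʳ-≤ (b ℕ.* c) {{ℕ.m*n≢0 b c}}
  (ℕ.*-cancelʳ-≤ _ _ (n ^ (s⁻ * (c * K) + t⁺ * (b * K))) {{ℕ.m^n≢0 n (s⁻ * (c * K) + t⁺ * (b * K))}} (begin
    ((m * L) ^ K) ^ (b * c) * n ^ (s⁻ * (c * K) + t⁺ * (b * K))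
      ≡⟨ cong₂ _*_ (ℕ.^-*-assoc (m * L) K (b * c)) (ℕ.^-distribˡ-+-* n (s⁻ * (c * K)) (t⁺ * (b * K))) ⟩
    (m * L) ^ (K * (b * c)) * (n ^ (s⁻ * (c * K)) * n ^ (t⁺ * (b * K)))
      ≡⟨ cong (_* (n ^ (s⁻ * (c * K)) * n ^ (t⁺ * (b * K)))) (^-distribʳ-* m L (K * (b * c))) ⟩
    m ^ (K * (b * c)) * L ^ (K * (b * c)) * (n ^ (s⁻ * (c * K)) * n ^ (t⁺ * (b * K)))
      ≡⟨ swap (m ^ (K * (b * c))) (L ^ (K * (b * c))) (n ^ (s⁻ * (c * K))) (n ^ (t⁺ * (b * K))) ⟩
    (m ^ (K * (b * c)) * n ^ (s⁻ * (c * K))) * (n ^ (t⁺ * (b * K)) * L ^ (K * (b * c)))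
      ≤⟨ ℕ.*-mono-≤ first second ⟩
    (n ^ (s⁺ * (c * K)) * M ^ (K * (b * c))) * (l ^ (K * (b * c)) * n ^ (t⁻ * (b * K)))
      ≡⟨ swap′ (n ^ (s⁺ * (c * K))) (M ^ (K * (b * c))) (l ^ (K * (b * c))) (n ^ (t⁻ * (b * K))) ⟩
    (l ^ (K * (b * c)) * M ^ (K * (b * c))) * (n ^ (s⁺ * (c * K)) * n ^ (t⁻ * (b * K)))
      ≡⟨ cong₂ _*_ (^-distribʳ-* l M (K * (b * c))) (ℕ.^-distribˡ-+-* n (s⁺ * (c * K)) (t⁻ * (b * K))) ⟨
    (l * M) ^ (K * (b * c)) * n ^ (s⁺ * (c * K) + t⁻ * (b * K))
      ≤⟨ ℕ.*-monoʳ-≤ ((l * M) ^ (K * (b * c))) (ℕ.^-monoʳ-≤ n hq) ⟩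
    (l * M) ^ (K * (b * c)) * n ^ (b * c + (s⁻ * (c * K) + t⁺ * (b * K)))
      ≡⟨ cong₂ _*_ (sym (ℕ.^-*-assoc (l * M) K (b * c))) (ℕ.^-distribˡ-+-* n (b * c) _) ⟩
    ((l * M) ^ K) ^ (b * c) * (n ^ (b * c) * n ^ (s⁻ * (c * K) + t⁺ * (b * K)))
      ≡⟨ ℕ.*-assoc (((l * M) ^ K) ^ (b * c)) (n ^ (b * c)) _ ⟨
    ((l * M) ^ K) ^ (b * c) * n ^ (b * c) * n ^ (s⁻ * (c * K) + t⁺ * (b * K))
      ≡⟨ cong (_* n ^ (s⁻ * (c * K) + t⁺ * (b * K))) (^-distribʳ-* ((l * M) ^ K) n (b * c)) ⟨
    ((l * M) ^ K * n) ^ (b * c) * n ^ (s⁻ * (c * K) + t⁺ * (b * K)) ∎))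
  where
  open import Data.Nat.Base using (_*_; _+_; _^_)
  open ℕ.≤-Reasoning
  swap : ∀ w x y z → w * x * (y * z) ≡ (w * y) * (z * x)
  swap = ℕ-Solver.solve-∀
  swap′ : ∀ w x y z → (w * x) * (y * z) ≡ (y * x) * (w * z)
  swap′ = ℕ-Solver.solve-∀
  e₁ : ∀ b c K → b * (c * K) ≡ K * (b * c)
  e₁ = ℕ-Solver.solve-∀
  e₂ : ∀ b c K → c * (b * K) ≡ K * (b * c)
  e₂ = ℕ-Solver.solve-∀
  raise : ∀ x y i j o → (x ^ i * y ^ j) ^ o ≡ x ^ (i * o) * y ^ (j * o)
  raise x y i j o = trans (^-distribʳ-* (x ^ i) (y ^ j) o)
                          (cong₂ _*_ (ℕ.^-*-assoc x i o) (ℕ.^-*-assoc y j o))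
  first : m ^ (K * (b * c)) * n ^ (s⁻ * (c * K)) ℕ.≤ n ^ (s⁺ * (c * K)) * M ^ (K * (b * c))
  first = subst₂ ℕ._≤_
    (trans (raise m n b s⁻ (c * K)) (cong (λ e → m ^ e * n ^ (s⁻ * (c * K))) (e₁ b c K)))
    (trans (raise n M s⁺ b (c * K)) (cong (λ e → n ^ (s⁺ * (c * K)) * M ^ e) (e₁ b c K)))
    (ℕ.^-monoˡ-≤ (c * K) h₁)
  second : n ^ (t⁺ * (b * K)) * L ^ (K * (b * c)) ℕ.≤ l ^ (K * (b * c)) * n ^ (t⁻ * (b * K))
  second = subst₂ ℕ._≤_
    (trans (raise n L t⁺ c (b * K)) (cong (λ e → n ^ (t⁺ * (b * K)) * L ^ e) (e₂ b c K)))
    (trans (raise l n c t⁻ (b * K)) (cong (λ e → l ^ e * n ^ (t⁻ * (b * K))) (e₂ b c K)))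
    (ℕ.^-monoˡ-≤ (b * K) h₂)

bernoulli : ∀ v d K → v ℕ.^ K ℕ.* (v ℕ.+ K ℕ.* d) ℕ.≤ v ℕ.* (v ℕ.+ d) ℕ.^ K
bernoulli v d zero    = ℕ.≤-reflexive (lem v)
  where
  lem : ∀ v → 1 ℕ.* (v ℕ.+ 0) ≡ v ℕ.* 1
  lem = ℕ-Solver.solve-∀
bernoulli v d (suc K) = begin
  v * w * (v + (d + K * d))                    ≤⟨ ℕ.m≤m+n _ (w * (d * (K * d))) ⟩
  v * w * (v + (d + K * d)) + w * (d * (K * d))  ≡⟨ e₁ v d w (K * d) ⟩
  (v + d) * (w * (v + K * d))                  ≤⟨ ℕ.*-monoʳ-≤ (v + d) (bernoulli v d K) ⟩
  (v + d) * (v * (v + d) ^ K)                  ≡⟨ e₂ v (v + d) ((v + d) ^ K) ⟩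
  v * ((v + d) * (v + d) ^ K) ∎
  where
  open import Data.Nat.Base using (_*_; _+_; _^_)
  open ℕ.≤-Reasoning
  w : ℕ
  w = v ^ K
  e₁ : ∀ v d w x → v * w * (v + (d + x)) + w * (d * x) ≡ (v + d) * (w * (v + x))
  e₁ = ℕ-Solver.solve-∀
  e₂ : ∀ v x y → x * (v * y) ≡ v * (x * y)
  e₂ = ℕ-Solver.solve-∀

ratio-bound : ∀ u v n K .{{_ : NonZero v}} → u ℕ.^ K ℕ.≤ v ℕ.^ K ℕ.* n →
              K ℕ.* u ℕ.≤ K ℕ.* v ℕ.+ v ℕ.* n
ratio-bound u v n K h with ℕ.≤-total u v
... | inj₁ u≤v = ℕ.≤-trans (ℕ.*-monoʳ-≤ K u≤v) (ℕ.m≤m+n (K ℕ.* v) (v ℕ.* n))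
... | inj₂ v≤u with ℕ.m≤n⇒∃[o]m+o≡n v≤u
... | d , refl = begin
    K * (v + d)        ≡⟨ ℕ.*-distribˡ-+ K v d ⟩
    K * v + K * d      ≤⟨ ℕ.+-monoʳ-≤ (K * v) (ℕ.≤-trans (ℕ.m≤n+m (K * d) v) step) ⟩
    K * v + v * n ∎
  where
  open import Data.Nat.Base using (_*_; _+_; _^_)
  open ℕ.≤-Reasoning
  lem : ∀ v w n → v * (w * n) ≡ w * (v * n)
  lem = ℕ-Solver.solve-∀
  step : v + K * d ℕ.≤ v * n
  step = ℕ.*-cancelˡ-≤ (v ^ K) {{ℕ.m^n≢0 v K}} (begin
    v ^ K * (v + K * d)  ≤⟨ bernoulli v d K ⟩
    v * (v + d) ^ K      ≤⟨ ℕ.*-monoʳ-≤ v h ⟩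
    v * (v ^ K * n)      ≡⟨ lem v (v ^ K) n ⟩
    v ^ K * (v * n) ∎)

parts : ∀ i → i ≡ + posPart i ℤ.- + negPart i
parts (+ n)    = sym (ℤ.+-identityʳ (+ n))
parts -[1+ n ] = refl

exponent-≤ : ∀ q q′ k → q ℚ.≤ q′ ℚ.+ (+ 1 ℚ./ suc k) →
             posPart (↥ q) ℕ.* (↧ₙ q′ ℕ.* suc k) ℕ.+ negPart (↥ q′) ℕ.* (↧ₙ q ℕ.* suc k) ℕ.≤
             ↧ₙ q ℕ.* ↧ₙ q′ ℕ.+ (negPart (↥ q) ℕ.* (↧ₙ q′ ℕ.* suc k)
                                  ℕ.+ posPart (↥ q′) ℕ.* (↧ₙ q ℕ.* suc k))
exponent-≤ q@(mkℚ s b _) q′@(mkℚ t c _) k h = ℤ.drop‿+≤+ (subst₂ ℤ._≤_ lhs rhs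
  (ℤ.+-monoˡ-≤ (S⁻ ℤ.* (C ℤ.* K) ℤ.+ T⁻ ℤ.* (B ℤ.* K)) cross))
  where
  S⁺ S⁻ T⁺ T⁻ B C K : ℤ
  S⁺ = + posPart s
  S⁻ = + negPart s
  T⁺ = + posPart t
  T⁻ = + negPart t
  B = + suc b
  C = + suc c
  K = + suc k
  hᵘ : ℚᵘ.mkℚᵘ s b ℚᵘ.≤ ℚᵘ.mkℚᵘ t c ℚᵘ.+ ℚᵘ.mkℚᵘ (+ 1) k
  hᵘ = ℚᵘ.≤-respʳ-≃ (ℚᵘ.≃-trans (ℚ.toℚᵘ-homo-+ q′ (+ 1 ℚ./ suc k))
         (ℚᵘ.+-congʳ (ℚᵘ.mkℚᵘ t c) (ℚ.toℚᵘ-fromℚᵘ (ℚᵘ.mkℚᵘ (+ 1) k)))) (ℚ.toℚᵘ-mono-≤ h)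
  cross : s ℤ.* (C ℤ.* K) ℤ.≤ (t ℤ.* K ℤ.+ + 1 ℤ.* C) ℤ.* B
  cross with hᵘ
  ... | ℚᵘ.*≤* le = le
  e₁ : ∀ S⁺ S⁻ T⁻ B C K → (S⁺ ℤ.- S⁻) ℤ.* (C ℤ.* K) ℤ.+ (S⁻ ℤ.* (C ℤ.* K) ℤ.+ T⁻ ℤ.* (B ℤ.* K))
       ≡ S⁺ ℤ.* (C ℤ.* K) ℤ.+ T⁻ ℤ.* (B ℤ.* K)
  e₁ = ℤ-Solver.solve-∀
  e₂ : ∀ S⁻ T⁺ T⁻ B C K →
       ((T⁺ ℤ.- T⁻) ℤ.* K ℤ.+ + 1 ℤ.* C) ℤ.* B ℤ.+ (S⁻ ℤ.* (C ℤ.* K) ℤ.+ T⁻ ℤ.* (B ℤ.* K))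
       ≡ B ℤ.* C ℤ.+ (S⁻ ℤ.* (C ℤ.* K) ℤ.+ T⁺ ℤ.* (B ℤ.* K))
  e₂ = ℤ-Solver.solve-∀
  pos₃ : ∀ x y z → + x ℤ.* (+ y ℤ.* + z) ≡ + (x ℕ.* (y ℕ.* z))
  pos₃ x y z = trans (cong (+ x ℤ.*_) (sym (ℤ.pos-* y z))) (sym (ℤ.pos-* x (y ℕ.* z)))
  lhs : s ℤ.* (C ℤ.* K) ℤ.+ (S⁻ ℤ.* (C ℤ.* K) ℤ.+ T⁻ ℤ.* (B ℤ.* K))
        ≡ + (posPart s ℕ.* (suc c ℕ.* suc k) ℕ.+ negPart t ℕ.* (suc b ℕ.* suc k))
  lhs = trans (cong (λ z → z ℤ.* (C ℤ.* K) ℤ.+ (S⁻ ℤ.* (C ℤ.* K) ℤ.+ T⁻ ℤ.* (B ℤ.* K))) (parts s))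
       (trans (e₁ S⁺ S⁻ T⁻ B C K)
              (cong₂ ℤ._+_ (pos₃ (posPart s) (suc c) (suc k)) (pos₃ (negPart t) (suc b) (suc k))))
  rhs : (t ℤ.* K ℤ.+ + 1 ℤ.* C) ℤ.* B ℤ.+ (S⁻ ℤ.* (C ℤ.* K) ℤ.+ T⁻ ℤ.* (B ℤ.* K))
        ≡ + (suc b ℕ.* suc c ℕ.+ (negPart s ℕ.* (suc c ℕ.* suc k) ℕ.+ posPart t ℕ.* (suc b ℕ.* suc k)))
  rhs = trans (cong (λ z → (z ℤ.* K ℤ.+ + 1 ℤ.* C) ℤ.* B ℤ.+ (S⁻ ℤ.* (C ℤ.* K) ℤ.+ T⁻ ℤ.* (B ℤ.* K))) (parts t))
       (trans (e₂ S⁻ T⁺ T⁻ B C K)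
              (cong₂ ℤ._+_ (sym (ℤ.pos-* (suc b) (suc c)))
                (cong₂ ℤ._+_ (pos₃ (negPart s) (suc c) (suc k)) (pos₃ (posPart t) (suc b) (suc k)))))

frac : ℕ → ℕ → ℚ
frac m i = + m ℚ./ suc i

frac-bound : ∀ m i l j n k → suc k ℕ.* (m ℕ.* suc j) ℕ.≤ suc k ℕ.* (l ℕ.* suc i) ℕ.+ l ℕ.* suc i ℕ.* n →
             frac m i ℚ.≤ frac l j ℚ.+ frac l j ℚ.* (frac n 0 ℚ.* frac 1 k)
frac-bound m i l j n k h = ℚ.toℚᵘ-cancel-≤ (ℚᵘ.≤-respʳ-≃ (ℚᵘ.≃-sym right)
  (ℚᵘ.≤-respˡ-≃ (ℚᵘ.≃-sym (un m i)) (ℚᵘ.*≤* (subst₂ ℤ._≤_ lhs rhs (ℤ.+≤+ nat)))))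
  where
  M L K : ℕ
  M = suc i
  L = suc j
  K = suc k
  mk : ℕ → ℕ → ℚᵘ.ℚᵘ
  mk m i = ℚᵘ.mkℚᵘ (+ m) i
  un : ∀ m i → ℚ.toℚᵘ (frac m i) ℚᵘ.≃ mk m i
  un m i = ℚ.toℚᵘ-fromℚᵘ (mk m i)
  right : ℚ.toℚᵘ (frac l j ℚ.+ frac l j ℚ.* (frac n 0 ℚ.* frac 1 k)) ℚᵘ.≃
          mk l j ℚᵘ.+ mk l j ℚᵘ.* (mk n 0 ℚᵘ.* mk 1 k)
  right = ℚᵘ.≃-trans (ℚ.toℚᵘ-homo-+ (frac l j) (frac l j ℚ.* (frac n 0 ℚ.* frac 1 k)))
    (ℚᵘ.+-cong (un l j)
      (ℚᵘ.≃-trans (ℚ.toℚᵘ-homo-* (frac l j) (frac n 0 ℚ.* frac 1 k))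
        (ℚᵘ.*-cong (un l j)
          (ℚᵘ.≃-trans (ℚ.toℚᵘ-homo-* (frac n 0) (frac 1 k))
            (ℚᵘ.*-cong (un n 0) (un 1 k))))))
  e₁ : ∀ m L K → L ℕ.* (K ℕ.* (m ℕ.* L)) ≡ m ℕ.* (L ℕ.* (L ℕ.* (1 ℕ.* K)))
  e₁ = ℕ-Solver.solve-∀
  e₂ : ∀ l M L K n → L ℕ.* (K ℕ.* (l ℕ.* M) ℕ.+ l ℕ.* M ℕ.* n) ≡
       (l ℕ.* (L ℕ.* (1 ℕ.* K)) ℕ.+ l ℕ.* (n ℕ.* 1) ℕ.* L) ℕ.* M
  e₂ = ℕ-Solver.solve-∀
  nat : m ℕ.* (L ℕ.* (L ℕ.* (1 ℕ.* K))) ℕ.≤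
        (l ℕ.* (L ℕ.* (1 ℕ.* K)) ℕ.+ l ℕ.* (n ℕ.* 1) ℕ.* L) ℕ.* M
  nat = subst₂ ℕ._≤_ (e₁ m L K) (e₂ l M L K n) (ℕ.*-monoʳ-≤ L h)
  lhs : + (m ℕ.* (L ℕ.* (L ℕ.* (1 ℕ.* K)))) ≡ + m ℤ.* + (L ℕ.* (L ℕ.* (1 ℕ.* K)))
  lhs = ℤ.pos-* m (L ℕ.* (L ℕ.* (1 ℕ.* K)))
  rhs : + ((l ℕ.* (L ℕ.* (1 ℕ.* K)) ℕ.+ l ℕ.* (n ℕ.* 1) ℕ.* L) ℕ.* M) ≡
        (+ l ℤ.* + (L ℕ.* (1 ℕ.* K)) ℤ.+ + l ℤ.* (+ n ℤ.* + 1) ℤ.* + L) ℤ.* + M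
  rhs = trans (ℤ.pos-* (l ℕ.* (L ℕ.* (1 ℕ.* K)) ℕ.+ l ℕ.* (n ℕ.* 1) ℕ.* L) M)
    (cong (ℤ._* + M) (cong₂ ℤ._+_ (ℤ.pos-* l (L ℕ.* (1 ℕ.* K)))
      (trans (ℤ.pos-* (l ℕ.* (n ℕ.* 1)) L)
        (cong (ℤ._* + L) (trans (ℤ.pos-* l (n ℕ.* 1)) (cong (+ l ℤ.*_) (ℤ.pos-* n 1)))))))

frac-suc : ∀ m i → frac (suc m) i ≡ frac m i ℚ.+ frac 1 i
frac-suc m i = ℚ.toℚᵘ-injective (ℚᵘ.≃-trans (ℚ.toℚᵘ-fromℚᵘ (ℚᵘ.mkℚᵘ (+ suc m) i))
  (ℚᵘ.≃-trans (ℚᵘ.*≡* (e (+ m) (+ suc i)))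
  (ℚᵘ.≃-sym (ℚᵘ.≃-trans (ℚ.toℚᵘ-homo-+ (frac m i) (frac 1 i))
    (ℚᵘ.+-cong (ℚ.toℚᵘ-fromℚᵘ (ℚᵘ.mkℚᵘ (+ m) i)) (ℚ.toℚᵘ-fromℚᵘ (ℚᵘ.mkℚᵘ (+ 1) i)))))))
  where
  e : ∀ x y → (+ 1 ℤ.+ x) ℤ.* (y ℤ.* y) ≡ (x ℤ.* y ℤ.+ + 1 ℤ.* y) ℤ.* y
  e = ℤ-Solver.solve-∀

frac-nonNeg : ∀ m i → 0ℚ ℚ.≤ frac m i
frac-nonNeg m i = ℚ.nonNegative⁻¹ (frac m i) {{ℚ.normalize-nonNeg m (suc i)}}

unit-small : ∀ γ → 0ℚ ℚ.< γ → ∀ i → ↧ₙ γ ℕ.≤ suc i → frac 1 i ℚ.≤ γ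
unit-small γ 0<γ i h with γ | ℚ.positive 0<γ
... | mkℚ (+ suc a) d _ | _ = ℚ.toℚᵘ-cancel-≤
  (ℚᵘ.≤-respˡ-≃ (ℚᵘ.≃-sym (ℚ.toℚᵘ-fromℚᵘ (ℚᵘ.mkℚᵘ (+ 1) i)))
    (ℚᵘ.*≤* (ℤ.+≤+ (ℕ.*-mono-≤ (s≤s {0} {a} z≤n) h))))

-- If s ≤ t + 1 / (k + 1) then n ^ s ≤ n ^ t * (1 + n / (k + 1)), for the approximants.
approxPow-compare : ∀ n .{{_ : NonZero n}} q q′ k i j → q ℚ.≤ q′ ℚ.+ frac 1 k →
  approxPow n q i ℚ.≤ (approxPow n q′ j ℚ.+ frac 1 j)
                    ℚ.+ (approxPow n q′ j ℚ.+ frac 1 j) ℚ.* (frac n 0 ℚ.* frac 1 k)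
approxPow-compare n q@record{} q′@record{} k i j h =
  subst (λ z → approxPow n q i ℚ.≤ z ℚ.+ z ℚ.* (frac n 0 ℚ.* frac 1 k)) (frac-suc l j)
    (frac-bound m i (suc l) j n k
      (ratio-bound (m ℕ.* suc j) (suc l ℕ.* suc i) n (suc k)
        (compare n m (suc i) (suc l) (suc j)
          (posPart (↥ q)) (negPart (↥ q)) (posPart (↥ q′)) (negPart (↥ q′)) (↧ₙ q) (↧ₙ q′) (suc k)
          (rootNumerator-below n q (suc i))
          (ℕ.<⇒≤ (ℕ.≰⇒> (rootNumerator-max n q′ (suc j))))
          (exponent-≤ q q′ k h))))
  where
  m l : ℕ
  m = rootNumerator n q (suc i)
  l = rootNumerator n q′ (suc j)

abs-upper : ∀ a b δ → ℚ.∣ a ℚ.- b ∣ ℚ.≤ δ → a ℚ.≤ b ℚ.+ δ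
abs-upper a b δ h = begin
  a                  ≡⟨ eq a b ⟩
  b ℚ.+ (a ℚ.- b)    ≤⟨ ℚ.+-monoʳ-≤ b (ℚ.≤-trans (p≤∣p∣ (a ℚ.- b)) h) ⟩
  b ℚ.+ δ ∎
  where
  open ℚ.≤-Reasoning
  eq : ∀ a b → a ≡ b ℚ.+ (a ℚ.- b)
  eq = solve-∀ ℚ-ring
  p≤∣p∣ : ∀ p → p ℚ.≤ ℚ.∣ p ∣
  p≤∣p∣ p with ℚ.≤-total 0ℚ p
  ... | inj₁ 0≤p = ℚ.≤-reflexive (sym (ℚ.0≤p⇒∣p∣≡p 0≤p))
  ... | inj₂ p≤0 = ℚ.≤-trans p≤0 (ℚ.0≤∣p∣ p)

approxPow-close : ∀ n .{{_ : NonZero n}} q q′ k i j C γ δ → q ℚ.≤ q′ ℚ.+ frac 1 k →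
  approxPow n q′ j ℚ.+ frac 1 j ℚ.≤ C → frac n 0 ℚ.* frac 1 k ℚ.≤ γ → C ℚ.* γ ≡ ½ ℚ.* δ →
  frac 1 j ℚ.≤ ½ ℚ.* δ → approxPow n q i ℚ.≤ approxPow n q′ j ℚ.+ δ
approxPow-close n q q′ k i j C γ δ q≤ y≤C nk≤γ Cγ j≤ = begin
  approxPow n q i                               ≤⟨ approxPow-compare n q q′ k i j q≤ ⟩
  y ℚ.+ y ℚ.* (frac n 0 ℚ.* frac 1 k)           ≤⟨ ℚ.+-mono-≤ (ℚ.+-monoʳ-≤ r j≤)
                                                     (*-mono-≤-nonNeg nk≥0 (ℚ.≤-trans y≥0 y≤C) y≤C nk≤γ) ⟩
  (r ℚ.+ ½ ℚ.* δ) ℚ.+ C ℚ.* γ                   ≡⟨ cong (r ℚ.+ ½ ℚ.* δ ℚ.+_) Cγ ⟩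
  (r ℚ.+ ½ ℚ.* δ) ℚ.+ ½ ℚ.* δ                   ≡⟨ ℚ.+-assoc r (½ ℚ.* δ) (½ ℚ.* δ) ⟩
  r ℚ.+ (½ ℚ.* δ ℚ.+ ½ ℚ.* δ)                   ≡⟨ cong (r ℚ.+_) (half+half δ) ⟩
  r ℚ.+ δ ∎
  where
  open ℚ.≤-Reasoning
  r y : ℚ
  r = approxPow n q′ j
  y = r ℚ.+ frac 1 j
  y≥0 : 0ℚ ℚ.≤ y
  y≥0 = ℚ.+-mono-≤ (frac-nonNeg (rootNumerator n q′ (suc j)) j) (frac-nonNeg 1 j)
  nk≥0 : 0ℚ ℚ.≤ frac n 0 ℚ.* frac 1 k
  nk≥0 = subst (ℚ._≤ frac n 0 ℚ.* frac 1 k) (ℚ.*-zeroʳ (frac n 0))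
    (ℚ.*-monoˡ-≤-nonNeg (frac n 0) {{ℚ.nonNegative (frac-nonNeg n 0)}} (frac-nonNeg 1 k))

-- n ^ x is the limit of n ^ q along the rational approximants q of x; the i-th term
-- rounds n ^ (seq x i) down to a multiple of 1 / (i + 1).

infixr 8 _^ʳ_

_^ʳ_ : (n : ℕ) .{{_ : NonZero n}} → ℝ → ℝ
n ^ʳ x = mkℝ (λ i → approxPow n (seq x i) i)
             (λ δ 0<δ → start δ 0<δ (cauchy x (frac 1 0) (ℚ.positive⁻¹ (frac 1 0))))
  where
  upper : ℕ → ℚ
  upper j = approxPow n (seq x j) j ℚ.+ frac 1 j

  n>0 : 0ℚ ℚ.< frac n 0
  n>0 = ℚ.positive⁻¹ (frac n 0) {{ℚ.normalize-pos n 1}}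

  finish : ∀ δ C γ k → 0ℚ ℚ.< δ → C ℚ.* γ ≡ ½ ℚ.* δ → frac n 0 ℚ.* frac 1 k ℚ.≤ γ →
           ∃[ L ] (∀ j → L ℕ.≤ j → upper j ℚ.≤ C) →
           TailWithin (seq x) (frac 1 k) →
           TailWithin (λ i → approxPow n (seq x i) i) δ
  finish δ C γ k 0<δ Cγ nk≤γ (L , y≤C) (M , close) =
    (L ⊔ M) ⊔ ↧ₙ (½ ℚ.* δ) , λ i j i≥ j≥ → one-sided (half i j i≥ j≥) (half j i j≥ i≥)
    where
    half : ∀ i j → (L ⊔ M) ⊔ ↧ₙ (½ ℚ.* δ) ℕ.≤ i → (L ⊔ M) ⊔ ↧ₙ (½ ℚ.* δ) ℕ.≤ j →
           approxPow n (seq x i) i ℚ.≤ approxPow n (seq x j) j ℚ.+ δ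
    half i j i≥ j≥ = approxPow-close n (seq x i) (seq x j) k i j C γ δ
      (abs-upper (seq x i) (seq x j) (frac 1 k) (close i j (≥M i≥) (≥M j≥)))
      (y≤C j (ℕ.m⊔n≤o⇒m≤o L M (ℕ.m⊔n≤o⇒m≤o (L ⊔ M) (↧ₙ (½ ℚ.* δ)) j≥)))
      nk≤γ Cγ
      (unit-small (½ ℚ.* δ) (half>0 0<δ) j
        (ℕ.≤-trans (ℕ.m⊔n≤o⇒n≤o (L ⊔ M) (↧ₙ (½ ℚ.* δ)) j≥) (ℕ.n≤1+n j)))
      where
      ≥M : ∀ {i} → (L ⊔ M) ⊔ ↧ₙ (½ ℚ.* δ) ℕ.≤ i → M ℕ.≤ i
      ≥M h = ℕ.m⊔n≤o⇒n≤o L M (ℕ.m⊔n≤o⇒m≤o (L ⊔ M) (↧ₙ (½ ℚ.* δ)) h)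

  refine : ∀ δ C γ → 0ℚ ℚ.< δ → C ℚ.* γ ≡ ½ ℚ.* δ →
           ∃[ L ] (∀ j → L ℕ.≤ j → upper j ℚ.≤ C) →
           ∃[ α ] (0ℚ ℚ.< α × frac n 0 ℚ.* α ≡ γ) →
           TailWithin (λ i → approxPow n (seq x i) i) δ
  refine δ C γ 0<δ Cγ y≤C (α , 0<α , nα) =
    finish δ C γ k 0<δ Cγ
      (subst (frac n 0 ℚ.* frac 1 k ℚ.≤_) nα
        (ℚ.*-monoˡ-≤-nonNeg (frac n 0) {{ℚ.nonNegative (frac-nonNeg n 0)}}
          (unit-small α 0<α k ℕ.≤-refl)))
      y≤C
      (cauchy x (frac 1 k) (ℚ.positive⁻¹ (frac 1 k) {{ℚ.normalize-pos 1 (suc k)}}))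
    where
    k : ℕ
    k = ℚ.denominator-1 α

  scale : ∀ δ C → 0ℚ ℚ.< δ → ∃[ L ] (∀ j → L ℕ.≤ j → upper j ℚ.≤ C) →
          ∃[ γ ] (0ℚ ℚ.< γ × C ℚ.* γ ≡ ½ ℚ.* δ) →
          TailWithin (λ i → approxPow n (seq x i) i) δ
  scale δ C 0<δ y≤C (γ , 0<γ , Cγ) =
    refine δ C γ 0<δ Cγ y≤C (scaled (frac n 0) n>0 γ 0<γ)

  start : ∀ δ → 0ℚ ℚ.< δ → TailWithin (seq x) (frac 1 0) →
          TailWithin (λ i → approxPow n (seq x i) i) δ
  start δ 0<δ (L , close) =
    scale δ C 0<δ (L , y≤C) (scaled C C>0 (½ ℚ.* δ) (half>0 0<δ))
    where
    C₀ C : ℚ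
    C₀ = upper L ℚ.+ upper L ℚ.* (frac n 0 ℚ.* frac 1 0)
    C = C₀ ℚ.+ 1ℚ
    y≤C : ∀ j → L ℕ.≤ j → upper j ℚ.≤ C
    y≤C j L≤j = ℚ.+-mono-≤
      (approxPow-compare n (seq x j) (seq x L) 0 j L
        (abs-upper (seq x j) (seq x L) (frac 1 0) (close j L L≤j ℕ.≤-refl)))
      (unit-small 1ℚ (ℚ.positive⁻¹ 1ℚ) j (s≤s z≤n))
    C>0 : 0ℚ ℚ.< C
    C>0 = ℚ.+-mono-≤-< (ℚ.≤-trans (frac-nonNeg (rootNumerator n (seq x L) (suc L)) L)
            (approxPow-compare n (seq x L) (seq x L) 0 L L
              (abs-upper (seq x L) (seq x L) (frac 1 0) (close L L ℕ.≤-refl ℕ.≤-refl))))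
            (ℚ.positive⁻¹ 1ℚ)

------------------------------------------------------------------------
-- Simplicial complexes and collapses

private
  variable
    n : ℕ

-- The empty set is not counted as a face, and a vertex of Fin n need not be one.

record Complex (n : ℕ) : Set₁ where
  field
    Face     : Pred (Subset n) 0ℓ
    face?    : Decidable Face
    nonempty : ∀ {σ} → Face σ → Nonempty σ
    closed   : ∀ {σ τ} → Face τ → σ ⊆ τ → Nonempty σ → Face σ

open Complex public

-- Faces are nonempty, so the subtraction never truncates on a face.

dim : Subset n → ℕ
dim σ = ∣ σ ∣ ℕ.∸ 1

Maximal : Complex n → Pred (Subset n) 0ℓ
Maximal Δ τ = Face Δ τ × (∀ ρ → Face Δ ρ → τ ⊆ ρ → ρ ≡ τ)

FreeFace : Complex n → Subset n → Subset n → Set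
FreeFace Δ σ τ =
  Face Δ σ × σ ⊂ τ × Maximal Δ τ × (∀ τ′ → Maximal Δ τ′ → σ ⊆ τ′ → τ′ ≡ τ)

Interval : Subset n → Subset n → Pred (Subset n) 0ℓ
Interval σ τ η = σ ⊆ η × η ⊆ τ

infix 4 _↘_

_↘_ : Complex n → Complex n → Set
Δ ↘ Δ′ = ∃[ σ ] ∃[ τ ] (FreeFace Δ σ τ ×
  (∀ η → Face Δ′ η ⇔ (Face Δ η × ¬ Interval σ τ η)))

Collapsible : ℕ → Complex n → Set₁
Collapsible m Δ = ∃[ Δ′ ] (Star _↘_ Δ Δ′ × (∀ σ → Face Δ′ σ → dim σ ℕ.< m))

_≟ˢ_ : (σ τ : Subset n) → Dec (σ ≡ τ)
_≟ˢ_ = Vec.≡-dec Bool._≟_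

allSubset? : ∀ {P : Pred (Subset n) 0ℓ} → Decidable P → Dec (∀ σ → P σ)
allSubset? P? = map′ (λ ¬∃¬ σ → decidable-stable (P? σ) (λ ¬p → ¬∃¬ (σ , ¬p)))
                     (λ { ∀p (σ , ¬p) → ¬p (∀p σ) })
                     (¬? (anySubset? (λ σ → ¬? (P? σ))))

maximal? : (Δ : Complex n) → Decidable (Maximal Δ)
maximal? Δ τ = face? Δ τ ×-dec
  allSubset? (λ ρ → face? Δ ρ →-dec (τ ⊆? ρ →-dec (ρ ≟ˢ τ)))

freeFace? : (Δ : Complex n) → ∀ σ τ → Dec (FreeFace Δ σ τ)
freeFace? Δ σ τ = face? Δ σ ×-dec (σ ⊂? τ) ×-dec maximal? Δ τ ×-dec
  allSubset? (λ τ′ → maximal? Δ τ′ →-dec (σ ⊆? τ′ →-dec (τ′ ≟ˢ τ)))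

maximal-above : (Δ : Complex n) → ∀ τ → Acc _⊃_ τ → Face Δ τ →
                ∃[ μ ] (Maximal Δ μ × τ ⊆ μ)
maximal-above Δ τ (acc above) τ∈Δ with anySubset? (λ ρ → face? Δ ρ ×-dec (τ ⊂? ρ))
... | yes (ρ , ρ∈Δ , τ⊂ρ) =
        let μ , μ-max , ρ⊆μ = maximal-above Δ ρ (above τ⊂ρ) ρ∈Δ
        in μ , μ-max , ⊆-trans (proj₁ τ⊂ρ) ρ⊆μ
... | no none = τ , (τ∈Δ , max) , ⊆-refl
  where
  max : ∀ ρ → Face Δ ρ → τ ⊆ ρ → ρ ≡ τ
  max ρ ρ∈Δ τ⊆ρ = ⊆-antisym
    (λ {x} x∈ρ → decidable-stable (x ∈? τ)
      (λ x∉τ → none (ρ , ρ∈Δ , τ⊆ρ , x , x∈ρ , x∉τ)))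
    τ⊆ρ

remove : (Δ : Complex n) → ∀ σ τ → FreeFace Δ σ τ → Complex n
remove Δ σ τ (_ , _ , _ , unique) = record
  { Face     = λ η → Face Δ η × ¬ Interval σ τ η
  ; face?    = λ η → face? Δ η ×-dec ¬? ((σ ⊆? η) ×-dec (η ⊆? τ))
  ; nonempty = λ (η∈Δ , _) → nonempty Δ η∈Δ
  ; closed   = λ {ρ} {η} (η∈Δ , η∉I) ρ⊆η ρ≢∅ → closed Δ η∈Δ ρ⊆η ρ≢∅ , λ (σ⊆ρ , _) →
      let μ , μ-max , η⊆μ = maximal-above Δ η (⊃-wellFounded η) η∈Δ
          σ⊆η = ⊆-trans σ⊆ρ ρ⊆η
      in η∉I (σ⊆η , subst (η ⊆_) (unique μ μ-max (⊆-trans σ⊆η η⊆μ)) η⊆μ)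
  }

remove-↘ : (Δ : Complex n) → ∀ σ τ (free : FreeFace Δ σ τ) → Δ ↘ remove Δ σ τ free
remove-↘ Δ σ τ free = σ , τ , free , λ _ → mk⇔ (λ h → h) (λ h → h)

_≐_ : Complex n → Complex n → Set
Δ ≐ Δ′ = ∀ η → Face Δ η ⇔ Face Δ′ η

maximal-resp : ∀ {Δ Δ′ : Complex n} → Δ ≐ Δ′ → ∀ {τ} → Maximal Δ τ → Maximal Δ′ τ
maximal-resp e {τ} (τ∈Δ , max) =
  Equivalence.to (e τ) τ∈Δ , λ ρ ρ∈Δ′ → max ρ (Equivalence.from (e ρ) ρ∈Δ′)

≐-sym : ∀ {Δ Δ′ : Complex n} → Δ ≐ Δ′ → Δ′ ≐ Δ
≐-sym e η = mk⇔ (Equivalence.from (e η)) (Equivalence.to (e η))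

freeFace-resp : ∀ {Δ Δ′ : Complex n} → Δ ≐ Δ′ → ∀ {σ τ} → FreeFace Δ σ τ → FreeFace Δ′ σ τ
freeFace-resp {Δ = Δ} {Δ′} e {σ} (σ∈Δ , σ⊂τ , τ-max , unique) =
  Equivalence.to (e σ) σ∈Δ , σ⊂τ , maximal-resp {Δ = Δ} {Δ′} e τ-max ,
  λ τ′ τ′-max → unique τ′ (maximal-resp {Δ = Δ′} {Δ} (≐-sym {Δ = Δ} {Δ′} e) τ′-max)

collapsible-resp : ∀ {m} {Δ Δ′ : Complex n} → Δ ≐ Δ′ → Collapsible m Δ → Collapsible m Δ′
collapsible-resp {Δ′ = Δ′} e (_ , ε , small) =
  Δ′ , ε , λ σ σ∈Δ′ → small σ (Equivalence.from (e σ) σ∈Δ′)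
collapsible-resp {Δ = Δ} {Δ′} e (Γ , ((σ , τ , free , faces) ◅ steps) , small) =
  Γ , ((σ , τ , freeFace-resp {Δ = Δ} {Δ′} e free , λ η → mk⇔
         (λ η∈ → let η∈Δ , η∉I = Equivalence.to (faces η) η∈ in Equivalence.to (e η) η∈Δ , η∉I)
         (λ (η∈Δ′ , η∉I) → Equivalence.from (faces η) (Equivalence.from (e η) η∈Δ′ , η∉I)))
       ◅ steps) , small

subsets : ∀ n → List (Subset n)
subsets zero    = [ [] ]
subsets (suc n) = List.map (inside ∷_) (subsets n) ++ List.map (outside ∷_) (subsets n)

∈-subsets : (σ : Subset n) → σ ∈ˡ subsets n
∈-subsets []                          = here refl
∈-subsets {suc n} (true  ∷ σ) = ∈-++⁺ˡ (∈-map⁺ (inside ∷_) (∈-subsets σ))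
∈-subsets {suc n} (false ∷ σ) =
  ∈-++⁺ʳ (List.map (inside ∷_) (subsets n)) (∈-map⁺ (outside ∷_) (∈-subsets σ))

module _ {A : Set} {P Q : Pred A 0ℓ} (P? : Decidable P) (Q? : Decidable Q)
         (P⇒Q : ∀ {x} → P x → Q x) where

  filter-length-≤ : ∀ xs → length (filter P? xs) ℕ.≤ length (filter Q? xs)
  filter-length-≤ []       = z≤n
  filter-length-≤ (x ∷ xs) with P? x | Q? x
  ... | yes p | yes q = s≤s (filter-length-≤ xs)
  ... | yes p | no ¬q = contradiction (P⇒Q p) ¬q
  ... | no ¬p | yes q = ℕ.m≤n⇒m≤1+n (filter-length-≤ xs)
  ... | no ¬p | no ¬q = filter-length-≤ xs

  filter-length-< : ∀ {x} xs → x ∈ˡ xs → Q x → ¬ P x →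
                    length (filter P? xs) ℕ.< length (filter Q? xs)
  filter-length-< (x ∷ xs) (here refl) q ¬p with P? x | Q? x
  ... | yes p | _     = contradiction p ¬p
  ... | no _  | yes _ = s≤s (filter-length-≤ xs)
  ... | no _  | no ¬q = contradiction q ¬q
  filter-length-< (y ∷ xs) (there x∈) q ¬p with P? y | Q? y
  ... | yes p | yes _ = s≤s (filter-length-< xs x∈ q ¬p)
  ... | yes p | no ¬q = contradiction (P⇒Q p) ¬q
  ... | no _  | yes _ = ℕ.m<n⇒m<1+n (filter-length-< xs x∈ q ¬p)
  ... | no _  | no _  = filter-length-< xs x∈ q ¬p

#faces : Complex n → ℕ
#faces {n} Δ = length (filter (face? Δ) (subsets n))

#faces-remove : (Δ : Complex n) → ∀ σ τ (free : FreeFace Δ σ τ) →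
                #faces (remove Δ σ τ free) ℕ.< #faces Δ
#faces-remove {n} Δ σ τ free@(σ∈Δ , σ⊂τ , _) =
  filter-length-< (face? (remove Δ σ τ free)) (face? Δ) proj₁ (subsets n)
    (∈-subsets σ) σ∈Δ (λ (_ , σ∉I) → σ∉I (⊆-refl , proj₁ σ⊂τ))

dim<? : ∀ m (Δ : Complex n) → Dec (∀ σ → Face Δ σ → dim σ ℕ.< m)
dim<? m Δ = allSubset? (λ σ → face? Δ σ →-dec (dim σ ℕ.<? m))

Step : ℕ → Complex n → Subset n → Subset n → Set₁
Step m Δ σ τ = Σ[ free ∈ FreeFace Δ σ τ ] Collapsible m (remove Δ σ τ free)

collapsible-acc : ∀ m (Δ : Complex n) → Acc ℕ._<_ (#faces Δ) → Dec (Collapsible m Δ)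
collapsible-acc m Δ (acc smaller) with dim<? m Δ
... | yes small = yes (Δ , ε , small)
... | no large  = map′ to from (anySubset? (λ σ → anySubset? (λ τ → step? σ τ)))
  where
  step? : ∀ σ τ → Dec (Step m Δ σ τ)
  step? σ τ with freeFace? Δ σ τ
  ... | no ¬free = no (λ (free , _) → ¬free free)
  ... | yes free = map′ (free ,_)
          (λ (free′ , c) → collapsible-resp {Δ = remove Δ σ τ free′} {remove Δ σ τ free}
                             (λ _ → mk⇔ (λ h → h) (λ h → h)) c)
          (collapsible-acc m (remove Δ σ τ free) (smaller (#faces-remove Δ σ τ free)))
  to : ∃[ σ ] ∃[ τ ] Step m Δ σ τ → Collapsible m Δ
  to (σ , τ , free , Γ , steps , small) = Γ , remove-↘ Δ σ τ free ◅ steps , small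
  from : Collapsible m Δ → ∃[ σ ] ∃[ τ ] Step m Δ σ τ
  from (_ , ε , small) = contradiction small large
  from (Γ , (_◅_ {j = Δ₁} (σ , τ , free , faces) steps) , small) =
    σ , τ , free , collapsible-resp {Δ = Δ₁} {remove Δ σ τ free} faces (Γ , steps , small)

collapsible? : ∀ m → Decidable (Collapsible {n} m)
collapsible? m Δ = collapsible-acc m Δ (<-wellFounded (#faces Δ))

------------------------------------------------------------------------
-- Random clique complexes

-- A graph on Fin (suc n) is the neighbourhood of vertex zero among the other
-- vertices, followed by the graph induced on those.

data Graph : ℕ → Set where
  []  : Graph 0
  _∷_ : Subset n → Graph n → Graph (suc n)

adjacent : Graph n → Fin n → Fin n → Bool
adjacent (s ∷ G) zero    zero    = false
adjacent (s ∷ G) zero    (suc j) = lookup s j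
adjacent (s ∷ G) (suc i) zero    = lookup s i
adjacent (s ∷ G) (suc i) (suc j) = adjacent G i j

cliqueComplex : Graph n → Complex n
cliqueComplex G = record
  { Face     = λ σ → Nonempty σ × (∀ i j → i ∈ σ → j ∈ σ → i ≢ j → T (adjacent G i j))
  ; face?    = λ σ → nonempty? σ ×-dec Fin.all? λ i → Fin.all? λ j →
                 (i ∈? σ) →-dec ((j ∈? σ) →-dec (¬? (i Fin.≟ j) →-dec Bool.T? (adjacent G i j)))
  ; nonempty = proj₁
  ; closed   = λ (_ , clique) σ⊆τ σ≢∅ →
                 σ≢∅ , λ i j i∈σ j∈σ → clique i j (σ⊆τ i∈σ) (σ⊆τ j∈σ)
  }

graphs : ∀ n → List (Graph n)
graphs zero    = [ [] ]
graphs (suc n) = List.cartesianProductWith _∷_ (subsets n) (graphs n)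

-- The probability of a single outcome of G(n , p): a factor p for each edge and
-- 1 - p for each non-edge.

slots : ℝ → Subset n → ℝ
slots p []            = 1ʳ
slots p (inside  ∷ s) = p *ʳ slots p s
slots p (outside ∷ s) = (1ʳ -ʳ p) *ʳ slots p s

weight : ℝ → Graph n → ℝ
weight p []      = 1ʳ
weight p (s ∷ G) = slots p s *ʳ weight p G

Σʳ : List ℝ → ℝ
Σʳ = foldr _+ʳ_ 0ʳ

-- The probability that X ∼ X(n , p) has the decidable property P.

Pr[X⟨_,_⟩∈_] : ∀ n → ℝ → ∀ {ℓ} {P : Pred (Complex n) ℓ} → Decidable P → ℝ
Pr[X⟨ n , p ⟩∈ P? ] =
  Σʳ (List.map (weight p) (filter (λ G → P? (cliqueComplex G)) (graphs n)))

{-# OPTIONS --safe #-}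

-- Write K = k + 1 and choose E with 1 / E ≤ ε. Starting from a set of K vertices, keep adding
-- vertices that have at least K neighbours in it. The set grows by one vertex and at least K
-- edges at a time, so it either reaches M = K + E + 1 vertices with K (E + 1) edges, or stops
-- at a saturated set U of fewer than M vertices. A clique with K vertices in a saturated set
-- lies inside it, so the large faces inside different saturated sets can be collapsed
-- independently of each other. If no set of fewer than M vertices spans K edges per vertex,
-- then every subset of U has a vertex of degree at most 2 K - 1, whose link collapses to
-- dimension less than K - 1 because it is a flag complex on at most 2 (K - 1) + 1 vertices;
-- deleting such vertices one after another collapses all faces in U of dimension at least K.
--
-- So failure forces a dense set of at most M vertices. With z = n p ^ K, where
-- z ^ E n ^ K ≤ 1, the expected number of dense sets of each size is at most a constant
-- times z, and z tends to 0.

module Submission where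

open import Defs
open import Algebra.Bundles using (CommutativeRing)
import Algebra.Properties.CommutativeSemiring.Exp as Exp
open import Data.Bool.Base using (Bool; true; false; T; _∧_; _∨_; if_then_else_)
open import Data.Bool.Properties using (∧-zeroʳ; ∧-identityʳ; ∨-identityʳ)
import Data.Empty as Empty
open import Data.Fin.Base using (Fin; zero; suc)
import Data.Fin.Properties as Fin
open import Data.Fin.Subset using (Subset; inside; outside; _∩_; ∣_∣)
open import Data.Integer.Base using (+_; -[1+_])
import Data.Integer.Base as ℤ
import Data.Integer.Properties as ℤ
import Data.Integer.Tactic.RingSolver as ℤ-Solver
open import Data.List.Base as List using (List; []; _∷_; _++_; filter; cartesianProductWith)
open import Data.List.Membership.Propositional using () renaming (_∈_ to _∈ˡ_)
open import Data.List.Relation.Unary.Any using (here; there)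
open import Data.Nat.Base using (ℕ; zero; suc; z≤n; s≤s; NonZero; _⊔_)
import Data.Nat.Base as ℕ
import Data.Nat.Properties as ℕ
import Data.Nat.Tactic.RingSolver as ℕ-Solver
open import Data.Product.Base using (∃-syntax; _×_; _,_; proj₁; proj₂)
open import Data.Rational.Base using (ℚ; 0ℚ; 1ℚ; ½; mkℚ; ↧ₙ_; _/_)
import Data.Rational.Base as ℚ
import Data.Rational.Properties as ℚ
import Data.Rational.Unnormalised.Base as ℚᵘ
import Data.Rational.Unnormalised.Properties as ℚᵘ
open import Data.Sum.Base using (_⊎_; inj₁; inj₂)
open import Data.Vec.Base using ([]; _∷_; lookup; here; there)
open import Data.Vec.Properties using (lookup⇒[]=; []=⇒lookup)
open import Level using (0ℓ)
open import Relation.Binary.PropositionalEquality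
  using (_≡_; _≢_; refl; sym; trans; cong; cong₂; subst; module ≡-Reasoning)
open import Relation.Nullary using (¬_; Dec; yes; no; does; contradiction)
open import Relation.Nullary.Decidable
  using (¬?; _×-dec_; _⊎-dec_; dec-true; dec-false; decidable-stable)
open import Relation.Unary using (Pred; Decidable)
open import Tactic.RingSolver using (solve-∀)

module Combinatorics where

  open import Data.Fin.Subset hiding (Subset; inside; outside; _∩_; ∣_∣)
  open import Data.Fin.Subset.Properties
  open import Data.Nat.Base using (_+_; _*_; _≤_; _<_)
  open import Relation.Binary.Construct.Closure.ReflexiveTransitive using (Star; ε; _◅_; _◅◅_)

  -- Neighbourhoods and cardinalities of finite sets.

  nbrs : ∀ {n} → Graph n → Fin n → Subset n
  nbrs (s ∷ G) zero    = outside ∷ s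
  nbrs (s ∷ G) (suc i) = lookup s i ∷ nbrs G i

  lookup-nbrs : ∀ {n} (G : Graph n) i j → lookup (nbrs G i) j ≡ adjacent G i j
  lookup-nbrs (s ∷ G) zero    zero    = refl
  lookup-nbrs (s ∷ G) zero    (suc j) = refl
  lookup-nbrs (s ∷ G) (suc i) zero    = refl
  lookup-nbrs (s ∷ G) (suc i) (suc j) = lookup-nbrs G i j

  adjacent-sym : ∀ {n} (G : Graph n) i j → adjacent G i j ≡ adjacent G j i
  adjacent-sym (s ∷ G) zero    zero    = refl
  adjacent-sym (s ∷ G) zero    (suc j) = refl
  adjacent-sym (s ∷ G) (suc i) zero    = refl
  adjacent-sym (s ∷ G) (suc i) (suc j) = adjacent-sym G i j

  nbrs-sym : ∀ {n} (G : Graph n) {i j} → j ∈ nbrs G i → i ∈ nbrs G j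
  nbrs-sym G {i} {j} j∈ = lookup⇒[]= i (nbrs G j) (begin
    lookup (nbrs G j) i  ≡⟨ lookup-nbrs G j i ⟩
    adjacent G j i       ≡⟨ adjacent-sym G j i ⟩
    adjacent G i j       ≡⟨ lookup-nbrs G i j ⟨
    lookup (nbrs G i) j  ≡⟨ []=⇒lookup j∈ ⟩
    inside               ∎)
    where open ≡-Reasoning

  nbrs-irrefl : ∀ {n} (G : Graph n) i → i ∉ nbrs G i
  nbrs-irrefl (s ∷ G) (suc i) (there i∈) = nbrs-irrefl G i i∈

  T-adjacent⇒∈nbrs : ∀ {n} (G : Graph n) i j → T (adjacent G i j) → j ∈ nbrs G i
  T-adjacent⇒∈nbrs G i j t = lookup⇒[]= j (nbrs G i) (trans (lookup-nbrs G i j) (T⇒≡ t))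
    where
    T⇒≡ : ∀ {b} → T b → b ≡ true
    T⇒≡ {true} _ = refl

  ∈nbrs⇒T-adjacent : ∀ {n} (G : Graph n) i j → j ∈ nbrs G i → T (adjacent G i j)
  ∈nbrs⇒T-adjacent G i j j∈ =
    subst T (sym (trans (sym (lookup-nbrs G i j)) ([]=⇒lookup j∈))) _

  ∪-mono-⊆ : ∀ {n} {p q p′ q′ : Subset n} → p ⊆ p′ → q ⊆ q′ → p ∪ q ⊆ p′ ∪ q′
  ∪-mono-⊆ {p = p} {q} p⊆ q⊆ x∈ with x∈p∪q⁻ p q x∈
  ... | inj₁ x∈p = x∈p∪q⁺ (inj₁ (p⊆ x∈p))
  ... | inj₂ x∈q = x∈p∪q⁺ (inj₂ (q⊆ x∈q))

  ∪-least : ∀ {n} {p q r : Subset n} → p ⊆ r → q ⊆ r → p ∪ q ⊆ r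
  ∪-least {p = p} {q} p⊆ q⊆ x∈ with x∈p∪q⁻ p q x∈
  ... | inj₁ x∈p = p⊆ x∈p
  ... | inj₂ x∈q = q⊆ x∈q

  ⁅x⁆⊆ : ∀ {n} {x : Fin n} {p} → x ∈ p → ⁅ x ⁆ ⊆ p
  ⁅x⁆⊆ {x = x} {p} x∈p y∈ = subst (_∈ p) (sym (x∈⁅y⁆⇒x≡y x y∈)) x∈p

  ∣p∪⁅x⁆∣ : ∀ {n} {x : Fin n} {p} → x ∉ p → ∣ p ∪ ⁅ x ⁆ ∣ ≡ suc ∣ p ∣
  ∣p∪⁅x⁆∣ {x = zero}  {inside ∷ p}  x∉ = contradiction here x∉
  ∣p∪⁅x⁆∣ {x = zero}  {outside ∷ p} x∉ = cong (λ q → suc ∣ q ∣) (∪-identityʳ p)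
  ∣p∪⁅x⁆∣ {x = suc x} {inside ∷ p}  x∉ = cong suc (∣p∪⁅x⁆∣ {x = x} {p} (λ x∈ → x∉ (there x∈)))
  ∣p∪⁅x⁆∣ {x = suc x} {outside ∷ p} x∉ = ∣p∪⁅x⁆∣ {x = x} {p} (λ x∈ → x∉ (there x∈))

  p⊆q∧∣q∣≤∣p∣⇒q⊆p : ∀ {n} {p q : Subset n} → p ⊆ q → ∣ q ∣ ≤ ∣ p ∣ → q ⊆ p
  p⊆q∧∣q∣≤∣p∣⇒q⊆p {p = p} {q} p⊆q ∣q∣≤∣p∣ {x} x∈q with x ∈? p
  ... | yes x∈p = x∈p
  ... | no x∉p  = contradiction (ℕ.<-≤-trans (p⊂q⇒∣p∣<∣q∣ (p⊆q , x , x∈q , x∉p)) ∣q∣≤∣p∣) (ℕ.<-irrefl refl)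

  bit : Bool → ℕ
  bit b = if b then 1 else 0

  ∣∷∣ : ∀ {n} b (p : Subset n) → ∣ b ∷ p ∣ ≡ bit b + ∣ p ∣
  ∣∷∣ true  p = refl
  ∣∷∣ false p = refl

  ∣∩∪⁅⁆∣ : ∀ {n} (s : Subset n) {p j} → j ∉ p → ∣ s ∩ (p ∪ ⁅ j ⁆) ∣ ≡ ∣ s ∩ p ∣ + bit (lookup s j)
  ∣∩∪⁅⁆∣ s {inside ∷ p} {zero} j∉ = contradiction here j∉
  ∣∩∪⁅⁆∣ (b ∷ s) {outside ∷ p} {zero} j∉ = begin
    ∣ (b ∧ true) ∷ (s ∩ (p ∪ ⊥)) ∣          ≡⟨ cong₂ (λ a q → ∣ a ∷ (s ∩ q) ∣) (∧-identityʳ b) (∪-identityʳ p) ⟩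
    ∣ b ∷ (s ∩ p) ∣                         ≡⟨ ∣∷∣ b (s ∩ p) ⟩
    bit b + ∣ s ∩ p ∣                       ≡⟨ ℕ.+-comm (bit b) _ ⟩
    ∣ s ∩ p ∣ + bit b                       ≡⟨ cong (λ a → ∣ a ∷ (s ∩ p) ∣ + bit b) (∧-zeroʳ b) ⟨
    ∣ (b ∧ false) ∷ (s ∩ p) ∣ + bit b       ∎
    where open ≡-Reasoning
  ∣∩∪⁅⁆∣ (b ∷ s) {c ∷ p} {suc j} j∉ = begin
    ∣ (b ∧ (c ∨ false)) ∷ (s ∩ (p ∪ ⁅ j ⁆)) ∣
      ≡⟨ cong (λ a → ∣ (b ∧ a) ∷ (s ∩ (p ∪ ⁅ j ⁆)) ∣) (∨-identityʳ c) ⟩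
    ∣ (b ∧ c) ∷ (s ∩ (p ∪ ⁅ j ⁆)) ∣               ≡⟨ ∣∷∣ (b ∧ c) (s ∩ (p ∪ ⁅ j ⁆)) ⟩
    bit (b ∧ c) + ∣ s ∩ (p ∪ ⁅ j ⁆) ∣             ≡⟨ cong (λ z → bit (b ∧ c) + z) (∣∩∪⁅⁆∣ s (λ j∈ → j∉ (there j∈))) ⟩
    bit (b ∧ c) + (∣ s ∩ p ∣ + bit (lookup s j))  ≡⟨ ℕ.+-assoc (bit (b ∧ c)) _ _ ⟨
    bit (b ∧ c) + ∣ s ∩ p ∣ + bit (lookup s j)    ≡⟨ cong (_+ bit (lookup s j)) (∣∷∣ (b ∧ c) (s ∩ p)) ⟨
    ∣ (b ∧ c) ∷ (s ∩ p) ∣ + bit (lookup s j)      ∎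
    where
    open ≡-Reasoning

  -- Edge counts and degrees.

  edges : ∀ {n} → Graph n → Subset n → ℕ
  edges []      []            = 0
  edges (s ∷ G) (outside ∷ W) = edges G W
  edges (s ∷ G) (inside  ∷ W) = ∣ s ∩ W ∣ + edges G W

  -- The recursion peels off vertex zero. When it lies in `W`, its possible edge to a later `u` is
  -- counted at vertex zero on the left and at `u` on the right.
  edges-∪⁅⁆ : ∀ {n} (G : Graph n) {W u} → u ∉ W →
              edges G (W ∪ ⁅ u ⁆) ≡ edges G W + ∣ nbrs G u ∩ W ∣
  edges-∪⁅⁆ (s ∷ G) {inside ∷ W}  {zero} u∉ = contradiction here u∉
  edges-∪⁅⁆ (s ∷ G) {outside ∷ W} {zero} u∉ = begin
    ∣ s ∩ (W ∪ ⊥) ∣ + edges G (W ∪ ⊥)  ≡⟨ cong (λ p → ∣ s ∩ p ∣ + edges G p) (∪-identityʳ W) ⟩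
    ∣ s ∩ W ∣ + edges G W              ≡⟨ ℕ.+-comm ∣ s ∩ W ∣ _ ⟩
    edges G W + ∣ s ∩ W ∣              ∎
    where open ≡-Reasoning
  edges-∪⁅⁆ (s ∷ G) {outside ∷ W} {suc u} u∉ = begin
    edges G (W ∪ ⁅ u ⁆)                    ≡⟨ edges-∪⁅⁆ G (λ u∈ → u∉ (there u∈)) ⟩
    edges G W + ∣ nbrs G u ∩ W ∣           ≡⟨ cong (λ b → edges G W + ∣ b ∷ (nbrs G u ∩ W) ∣) (∧-zeroʳ (lookup s u)) ⟨
    edges G W + ∣ (lookup s u ∧ false) ∷ (nbrs G u ∩ W) ∣ ∎
    where open ≡-Reasoning
  edges-∪⁅⁆ (s ∷ G) {inside ∷ W} {suc u} u∉ = begin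
    ∣ s ∩ (W ∪ ⁅ u ⁆) ∣ + edges G (W ∪ ⁅ u ⁆)
      ≡⟨ cong₂ _+_ (∣∩∪⁅⁆∣ s u∉W) (edges-∪⁅⁆ G u∉W) ⟩
    ∣ s ∩ W ∣ + a + (edges G W + d)
      ≡⟨ lem ∣ s ∩ W ∣ a (edges G W) d ⟩
    ∣ s ∩ W ∣ + edges G W + (a + d)
      ≡⟨ cong (λ b → ∣ s ∩ W ∣ + edges G W + (bit b + d)) (∧-identityʳ (lookup s u)) ⟨
    ∣ s ∩ W ∣ + edges G W + (bit (lookup s u ∧ true) + d)
      ≡⟨ cong (λ z → ∣ s ∩ W ∣ + edges G W + z) (∣∷∣ (lookup s u ∧ true) (nbrs G u ∩ W)) ⟨
    ∣ s ∩ W ∣ + edges G W + ∣ (lookup s u ∧ true) ∷ (nbrs G u ∩ W) ∣ ∎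
    where
    open ≡-Reasoning
    a d : ℕ
    a = bit (lookup s u)
    d = ∣ nbrs G u ∩ W ∣
    u∉W : u ∉ W
    u∉W u∈ = u∉ (there u∈)
    lem : ∀ w x y z → w + x + (y + z) ≡ w + y + (x + z)
    lem = ℕ-Solver.solve-∀

  sumOver : ∀ {n} → Subset n → (Fin n → ℕ) → ℕ
  sumOver []            g = 0
  sumOver (outside ∷ W) g = sumOver W (λ i → g (suc i))
  sumOver (inside  ∷ W) g = g zero + sumOver W (λ i → g (suc i))

  sumOver-cong : ∀ {n} (W : Subset n) {g h} → (∀ i → g i ≡ h i) → sumOver W g ≡ sumOver W h
  sumOver-cong []            e = refl
  sumOver-cong (outside ∷ W) e = sumOver-cong W (λ i → e (suc i))
  sumOver-cong (inside  ∷ W) e = cong₂ _+_ (e zero) (sumOver-cong W (λ i → e (suc i)))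

  sumOver-+ : ∀ {n} (W : Subset n) g h → sumOver W (λ i → g i + h i) ≡ sumOver W g + sumOver W h
  sumOver-+ []            g h = refl
  sumOver-+ (outside ∷ W) g h = sumOver-+ W _ _
  sumOver-+ (inside  ∷ W) g h = trans (cong (λ z → g zero + h zero + z) (sumOver-+ W _ _))
    (lem (g zero) (h zero) (sumOver W (λ i → g (suc i))) (sumOver W (λ i → h (suc i))))
    where
    lem : ∀ w x y z → w + x + (y + z) ≡ w + y + (x + z)
    lem = ℕ-Solver.solve-∀

  sumOver-lower : ∀ {n} (W : Subset n) {g} c → (∀ i → i ∈ W → c ≤ g i) → c * ∣ W ∣ ≤ sumOver W g
  sumOver-lower []            c h = ℕ.≤-reflexive (ℕ.*-zeroʳ c)
  sumOver-lower (outside ∷ W) c h = sumOver-lower W c (λ i i∈ → h (suc i) (there i∈))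
  sumOver-lower (inside  ∷ W) c h = ℕ.≤-trans (ℕ.≤-reflexive (ℕ.*-suc c ∣ W ∣))
    (ℕ.+-mono-≤ (h zero here) (sumOver-lower W c (λ i i∈ → h (suc i) (there i∈))))

  sumOver-bit : ∀ {n} (s W : Subset n) → sumOver W (λ i → bit (lookup s i)) ≡ ∣ s ∩ W ∣
  sumOver-bit []      []            = refl
  sumOver-bit (b ∷ s) (outside ∷ W) = trans (sumOver-bit s W)
    (cong (λ a → ∣ a ∷ (s ∩ W) ∣) (sym (∧-zeroʳ b)))
  sumOver-bit (b ∷ s) (inside ∷ W)  = trans (cong (λ z → bit b + z) (sumOver-bit s W))
    (trans (sym (∣∷∣ b (s ∩ W))) (cong (λ a → ∣ a ∷ (s ∩ W) ∣) (sym (∧-identityʳ b))))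

  -- By recursion on vertex zero: its edges into `W` are counted once as its own degree and once
  -- more as a bit in the degree of each neighbour.
  handshake : ∀ {n} (G : Graph n) W → sumOver W (λ v → ∣ nbrs G v ∩ W ∣) ≡ edges G W + edges G W
  handshake []      []            = refl
  handshake (s ∷ G) (outside ∷ W) = trans
    (sumOver-cong W (λ i → cong (λ a → ∣ a ∷ (nbrs G i ∩ W) ∣) (∧-zeroʳ (lookup s i))))
    (handshake G W)
  handshake (s ∷ G) (inside ∷ W)  = begin
    ∣ s ∩ W ∣ + sumOver W (λ i → ∣ (lookup s i ∧ true) ∷ (nbrs G i ∩ W) ∣)
      ≡⟨ cong (λ z → ∣ s ∩ W ∣ + z) (sumOver-cong W (λ i → trans
           (cong (λ a → ∣ a ∷ (nbrs G i ∩ W) ∣) (∧-identityʳ (lookup s i))) (∣∷∣ (lookup s i) (nbrs G i ∩ W)))) ⟩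
    ∣ s ∩ W ∣ + sumOver W (λ i → bit (lookup s i) + ∣ nbrs G i ∩ W ∣)
      ≡⟨ cong (λ z → ∣ s ∩ W ∣ + z) (sumOver-+ W _ _) ⟩
    ∣ s ∩ W ∣ + (sumOver W (λ i → bit (lookup s i)) + sumOver W (λ i → ∣ nbrs G i ∩ W ∣))
      ≡⟨ cong (λ z → ∣ s ∩ W ∣ + z) (cong₂ _+_ (sumOver-bit s W) (handshake G W)) ⟩
    ∣ s ∩ W ∣ + (∣ s ∩ W ∣ + (edges G W + edges G W))
      ≡⟨ lem ∣ s ∩ W ∣ (edges G W) ⟩
    ∣ s ∩ W ∣ + edges G W + (∣ s ∩ W ∣ + edges G W) ∎
    where
    open ≡-Reasoning
    lem : ∀ x y → x + (x + (y + y)) ≡ x + y + (x + y)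
    lem = ℕ-Solver.solve-∀

  -- If all degrees inside `S` were at least `2 * K`, they would add up to at least `2 * K * ∣ S ∣`,
  -- while the handshake identity and sparsity keep the sum below that.
  low-degree : ∀ {n} (G : Graph n) S K → edges G S < K * ∣ S ∣ →
               ∃[ v ] (v ∈ S × ∣ nbrs G v ∩ S ∣ < 2 * K)
  low-degree G S K sparse with Fin.any? (λ v → (v ∈? S) ×-dec (∣ nbrs G v ∩ S ∣ ℕ.<? 2 * K))
  ... | yes found = found
  ... | no none   = contradiction dense (ℕ.<⇒≱ (ℕ.+-mono-< sparse sparse))
    where
    open ℕ.≤-Reasoning
    lem : ∀ K w → K * w + K * w ≡ 2 * K * w
    lem = ℕ-Solver.solve-∀
    dense : K * ∣ S ∣ + K * ∣ S ∣ ≤ edges G S + edges G S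
    dense = begin
      K * ∣ S ∣ + K * ∣ S ∣  ≡⟨ lem K ∣ S ∣ ⟩
      2 * K * ∣ S ∣          ≤⟨ sumOver-lower S (2 * K) (λ v v∈S → ℕ.≮⇒≥ (λ low → none (v , v∈S , low))) ⟩
      sumOver S (λ v → ∣ nbrs G v ∩ S ∣)  ≡⟨ handshake G S ⟩
      edges G S + edges G S  ∎

  -- Elimination of faces between two sets.

  Clique : ∀ {n} → Graph n → Subset n → Set
  Clique G σ = ∀ i j → i ∈ σ → j ∈ σ → i ≢ j → j ∈ nbrs G i

  clique-⊆ : ∀ {n} (G : Graph n) {σ τ} → σ ⊆ τ → Clique G τ → Clique G σ
  clique-⊆ G σ⊆τ c i j i∈ j∈ = c i j (σ⊆τ i∈) (σ⊆τ j∈)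

  0<∣p∣⇒Nonempty : ∀ {n} {p : Subset n} → 0 < ∣ p ∣ → Nonempty p
  0<∣p∣⇒Nonempty {n} {p} 0<p with nonempty? p
  ... | yes ne = ne
  ... | no ¬ne = contradiction (subst (λ q → 0 < ∣ q ∣) (Empty-unique ¬ne) 0<p)
                   (λ 0<⊥ → ℕ.<-irrefl (sym (∣⊥∣≡0 n)) 0<⊥)

  -- The faces between B and B ∪ S can be collapsed down to size K, using only free faces of
  -- size at least K. In a split, the faces containing v go first: those that survive have
  -- size at most K, so they do not meet the later collapses.

  data Eliminable {n} (G : Graph n) (K : ℕ) (B S : Subset n) : Set where
    trivial : ∣ B ∪ S ∣ ≤ K → Eliminable G K B S
    simplex : ∣ B ∣ ≡ K → B ⊂ B ∪ S → Clique G (B ∪ S) → Eliminable G K B S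
    split   : ∀ v → v ∈ S → v ∉ B →
              Eliminable G K (B ∪ ⁅ v ⁆) (S ∩ nbrs G v) → Eliminable G K B (S - v) →
              Eliminable G K B S

  module _ {n} (G : Graph n) (K : ℕ) (0<K : 0 < K) {A : Pred (Subset n) 0ℓ} (A? : Decidable A)
           (A-up   : ∀ {σ η} → σ ⊆ η → K ≤ ∣ σ ∣ → Clique G η → A σ → A η)
           (A-down : ∀ {σ η} → σ ⊆ η → K ≤ ∣ σ ∣ → Clique G η → A η → A σ)
    where

    -- A selects the faces that still have to be collapsed.

    Between : Subset n → Subset n → Pred (Subset n) 0ℓ
    Between B S η = B ⊆ η × η ⊆ B ∪ S × A η

    -- Induction on `Eliminable`. Since `A` does not change along inclusions between cliques of at
    -- least `K` vertices, every interval to be collapsed is entirely active or entirely inactive.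
    -- The last two hypotheses keep the induction local: the large active cliques between `B` and
    -- `B ∪ S` are still present, and no larger active face above `B` leaves `B ∪ S`. The conclusion
    -- records that all other faces survive, so that eliminations can be chained.
    eliminate : ∀ {B S} → Eliminable G K B S → (Δ : Complex n) →
      (∀ {η} → Face Δ η → Clique G η) →
      (∀ {η} → Between B S η → Clique G η → K ≤ ∣ η ∣ → Face Δ η) →
      (∀ {η} → Face Δ η → B ⊆ η → A η → K < ∣ η ∣ → η ⊆ B ∪ S) →
      ∃[ Δ′ ] (Star _↘_ Δ Δ′
             × (∀ {η} → Face Δ′ η → Face Δ η)
             × (∀ {η} → Face Δ η → ¬ (Between B S η × K ≤ ∣ η ∣) → Face Δ′ η)
             × (∀ {η} → Face Δ′ η → Between B S η → ∣ η ∣ ≤ K))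
    eliminate {B} {S} (trivial B∪S≤K) Δ cl full only = Δ , ε , (λ f → f) , (λ f _ → f) ,
      λ _ (_ , η⊆ , _) → ℕ.≤-trans (p⊆q⇒∣p∣≤∣q∣ η⊆) B∪S≤K
    eliminate {B} {S} (simplex ∣B∣≡K B⊂@(B⊆τ , _) cτ) Δ cl full only with A? B
    -- If `B` is inactive, so is every face above it, and there is nothing to collapse.
    ... | no ¬AB = Δ , ε , (λ f → f) , (λ f _ → f) ,
      λ f (B⊆η , _ , Aη) → contradiction (A-down B⊆η (ℕ.≤-reflexive (sym ∣B∣≡K)) (cl f) Aη) ¬AB
    ... | yes AB = remove Δ B τ free , remove-↘ Δ B τ free ◅ ε , proj₁ ,
        (λ f out → f , λ (B⊆η , η⊆τ) → out ((B⊆η , η⊆τ , A-up B⊆η K≤B (cl f) AB)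
                                            , ℕ.≤-trans K≤B (p⊆q⇒∣p∣≤∣q∣ B⊆η))) ,
        (λ (_ , ∉I) (B⊆η , η⊆τ , _) → Empty.⊥-elim (∉I (B⊆η , η⊆τ)))
      where
      τ : Subset n
      τ = B ∪ S
      K≤B : K ≤ ∣ B ∣
      K≤B = ℕ.≤-reflexive (sym ∣B∣≡K)
      τ∈Δ : Face Δ τ
      τ∈Δ = full (B⊆τ , ⊆-refl , A-up B⊆τ K≤B cτ AB) cτ (ℕ.≤-trans K≤B (p⊆q⇒∣p∣≤∣q∣ B⊆τ))
      -- A face above `B` with at most `K` vertices is `B` itself, and `only` confines a larger one
      -- to `τ`. So `τ` is the only maximal face above `B`.
      below-τ : ∀ η → Face Δ η → B ⊆ η → η ⊆ τ
      below-τ η f B⊆η with K ℕ.<? ∣ η ∣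
      ... | yes K<η = only f B⊆η (A-up B⊆η K≤B (cl f) AB) K<η
      ... | no K≮η  = ⊆-trans (p⊆q∧∣q∣≤∣p∣⇒q⊆p B⊆η (ℕ.≤-trans (ℕ.≮⇒≥ K≮η) K≤B)) B⊆τ
      free : FreeFace Δ B τ
      free = closed Δ τ∈Δ B⊆τ (0<∣p∣⇒Nonempty (ℕ.<-≤-trans 0<K K≤B)) , B⊂ ,
             (τ∈Δ , λ ρ f τ⊆ρ → ⊆-antisym (below-τ ρ f (⊆-trans B⊆τ τ⊆ρ)) τ⊆ρ) ,
             λ τ′ (f , τ′-max) B⊆τ′ → sym (τ′-max τ τ∈Δ (below-τ τ′ f B⊆τ′))
    eliminate {B} {S} (split v v∈S v∉B e₁ e₂) Δ cl full only =
      let Δ₁ , s₁ , sub₁ , keep₁ , dim₁ = eliminate e₁ Δ cl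
            (λ (B′⊆η , η⊆ , Aη) → full (⊆-trans (p⊆p∪q ⁅ v ⁆) B′⊆η , ⊆-trans η⊆ link⊆ , Aη))
            (λ f B′⊆η Aη K<η → in-link (cl f) B′⊆η (only f (⊆-trans (p⊆p∪q ⁅ v ⁆) B′⊆η) Aη K<η))
          Δ₂ , s₂ , sub₂ , keep₂ , dim₂ = eliminate e₂ Δ₁ (λ f → cl (sub₁ f))
            (λ (B⊆η , η⊆ , Aη) c K≤η → keep₁ (full (B⊆η , ⊆-trans η⊆ deletion⊆ , Aη) c K≤η)
               λ ((B′⊆η , _) , _) → v∉deletion (η⊆ (B′⊆η v∈B′)))
            (λ {η} f B⊆η Aη K<η → without-v (only (sub₁ f) B⊆η Aη K<η) λ v∈η → ℕ.<⇒≱ K<η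
               (dim₁ f (link-between v∈η (cl (sub₁ f)) B⊆η (only (sub₁ f) B⊆η Aη K<η) Aη)))
      in Δ₂ , s₁ ◅◅ s₂ , (λ f → sub₁ (sub₂ f)) ,
         (λ f out → keep₂
           (keep₁ f λ ((B′⊆η , η⊆ , Aη) , K≤η) →
             out ((⊆-trans (p⊆p∪q ⁅ v ⁆) B′⊆η , ⊆-trans η⊆ link⊆ , Aη) , K≤η))
           λ ((B⊆η , η⊆ , Aη) , K≤η) → out ((B⊆η , ⊆-trans η⊆ deletion⊆ , Aη) , K≤η)) ,
         λ {η} f (B⊆η , η⊆ , Aη) → dim-after η (λ v∈η → dim₁ (sub₂ f)
             (link-between v∈η (cl (sub₁ (sub₂ f))) B⊆η η⊆ Aη))
           (λ v∉η → dim₂ f (B⊆η , without-v η⊆ v∉η , Aη))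
      where
      v∈B′ : v ∈ B ∪ ⁅ v ⁆
      v∈B′ = x∈p∪q⁺ (inj₂ (x∈⁅x⁆ v))
      link⊆ : (B ∪ ⁅ v ⁆) ∪ (S ∩ nbrs G v) ⊆ B ∪ S
      link⊆ = ∪-least (∪-mono-⊆ ⊆-refl (⁅x⁆⊆ v∈S)) (⊆-trans (p∩q⊆p S (nbrs G v)) (q⊆p∪q B S))
      deletion⊆ : B ∪ (S - v) ⊆ B ∪ S
      deletion⊆ = ∪-mono-⊆ ⊆-refl (p─q⊆p S ⁅ v ⁆)
      v∉deletion : v ∉ B ∪ (S - v)
      v∉deletion v∈ with x∈p∪q⁻ B (S - v) v∈
      ... | inj₁ v∈B   = v∉B v∈B
      -- Were `v` in `S - v`, removing it again would lower the cardinality, yet removal is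
      -- idempotent.
      ... | inj₂ v∈S-v = ℕ.<-irrefl (cong ∣_∣ (p─q─q≡p─q S ⁅ v ⁆)) (x∈p⇒∣p-x∣<∣p∣ v∈S-v)
      in-link : ∀ {η} → Clique G η → B ∪ ⁅ v ⁆ ⊆ η → η ⊆ B ∪ S → η ⊆ (B ∪ ⁅ v ⁆) ∪ (S ∩ nbrs G v)
      in-link c B′⊆η η⊆ {x} x∈η with x∈p∪q⁻ B S (η⊆ x∈η) | v Fin.≟ x
      ... | inj₁ x∈B | _        = x∈p∪q⁺ (inj₁ (x∈p∪q⁺ (inj₁ x∈B)))
      ... | inj₂ _   | yes refl = x∈p∪q⁺ (inj₁ v∈B′)
      ... | inj₂ x∈S | no v≢x   = x∈p∪q⁺ (inj₂ (x∈p∩q⁺ (x∈S , c v x (B′⊆η v∈B′) x∈η v≢x)))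
      link-between : ∀ {η} → v ∈ η → Clique G η → B ⊆ η → η ⊆ B ∪ S → A η →
                     Between (B ∪ ⁅ v ⁆) (S ∩ nbrs G v) η
      link-between v∈η c B⊆η η⊆ Aη = B′⊆η , in-link c B′⊆η η⊆ , Aη
        where B′⊆η = ∪-least B⊆η (⁅x⁆⊆ v∈η)
      without-v : ∀ {η} → η ⊆ B ∪ S → v ∉ η → η ⊆ B ∪ (S - v)
      without-v η⊆ v∉η {x} x∈η with x∈p∪q⁻ B S (η⊆ x∈η)
      ... | inj₁ x∈B = x∈p∪q⁺ (inj₁ x∈B)
      ... | inj₂ x∈S = x∈p∪q⁺ (inj₂ (x∈p∧x≢y⇒x∈p-y x∈S λ { refl → v∉η x∈η }))
      dim-after : ∀ η → (v ∈ η → ∣ η ∣ ≤ K) → (v ∉ η → ∣ η ∣ ≤ K) → ∣ η ∣ ≤ K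
      dim-after η h₁ h₂ with v ∈? η
      ... | yes v∈η = h₁ v∈η
      ... | no v∉η  = h₂ v∉η

  -- Cliques, small links and sparse sets.

  module _ {n} (G : Graph n) where

    eliminable-empty : ∀ {K B S} → ∣ B ∣ ≤ K → ¬ Nonempty S → Eliminable G K B S
    eliminable-empty {K} {B} B≤K S-empty = trivial (subst (λ S → ∣ B ∪ S ∣ ≤ K)
      (sym (Empty-unique S-empty)) (subst (λ p → ∣ p ∣ ≤ K) (sym (∪-identityʳ B)) B≤K))

    Joined : Subset n → Subset n → Set
    Joined B S = ∀ {b s} → b ∈ B → s ∈ S → s ∈ nbrs G b

    joined⇒disjoint : ∀ {B S v} → Joined B S → v ∈ S → v ∉ B
    joined⇒disjoint {v = v} J v∈S v∈B = nbrs-irrefl G v (J v∈B v∈S)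

    joined-link : ∀ {B S v} → Joined B S → v ∈ S → Joined (B ∪ ⁅ v ⁆) (S ∩ nbrs G v)
    joined-link {B} {S} {v} J v∈S b∈ s∈ with x∈p∪q⁻ B ⁅ v ⁆ b∈ | x∈p∩q⁻ S (nbrs G v) s∈
    ... | inj₁ b∈B | s∈S , _  = J b∈B s∈S
    ... | inj₂ b∈v | _ , s∈Nv = subst (λ b → _ ∈ nbrs G b) (sym (x∈⁅y⁆⇒x≡y v b∈v)) s∈Nv

    clique-join : ∀ {B S} → Clique G B → Clique G S → Joined B S → Clique G (B ∪ S)
    clique-join {B} {S} cB cS J i j i∈ j∈ i≢j with x∈p∪q⁻ B S i∈ | x∈p∪q⁻ B S j∈
    ... | inj₁ i∈B | inj₁ j∈B = cB i j i∈B j∈B i≢j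
    ... | inj₁ i∈B | inj₂ j∈S = J i∈B j∈S
    ... | inj₂ i∈S | inj₁ j∈B = nbrs-sym G (J j∈B i∈S)
    ... | inj₂ i∈S | inj₂ j∈S = cS i j i∈S j∈S i≢j

    clique-⁅⁆ : ∀ v → Clique G ⁅ v ⁆
    clique-⁅⁆ v i j i∈ j∈ i≢j = contradiction (trans (x∈⁅y⁆⇒x≡y v i∈) (sym (x∈⁅y⁆⇒x≡y v j∈))) i≢j

    clique-∪⁅⁆ : ∀ {B S v} → Clique G B → Joined B S → v ∈ S → Clique G (B ∪ ⁅ v ⁆)
    clique-∪⁅⁆ {v = v} cB J v∈S = clique-join cB (clique-⁅⁆ v) λ b∈ s∈ → J b∈ (⁅x⁆⊆ v∈S s∈)

    ∣B∪⁅v⁆∣+m : ∀ {B : Subset n} {v m K} → v ∉ B → ∣ B ∣ + suc m ≡ K → ∣ B ∪ ⁅ v ⁆ ∣ + m ≡ K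
    ∣B∪⁅v⁆∣+m {B} {m = m} v∉B e = trans (cong (_+ m) (∣p∪⁅x⁆∣ v∉B)) (trans (sym (ℕ.+-suc ∣ B ∣ m)) e)

    -- Vertices of `S` are moved into `B` or deleted until `B` has `K` vertices; `B ∪ S` is then a
    -- clique, and a single collapse suffices. Here `m` counts the vertices missing from `B`, `s`
    -- bounds the size of `S`, and the recursion is lexicographic in the two.
    clique-eliminable : ∀ {K B S} m s → ∣ B ∣ + m ≡ K → ∣ S ∣ ≤ s → Clique G B → Clique G S →
                        Joined B S → Eliminable G K B S
    clique-eliminable {K} {B} {S} m s eq S≤s cB cS J with nonempty? S
    ... | no S-empty = eliminable-empty (ℕ.m+n≤o⇒m≤o ∣ B ∣ (ℕ.≤-reflexive eq)) S-empty
    clique-eliminable {B = B} zero s eq S≤s cB cS J | yes (v , v∈S) =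
      simplex (trans (sym (ℕ.+-identityʳ ∣ B ∣)) eq)
        (p⊆p∪q _ , v , x∈p∪q⁺ (inj₂ v∈S) , joined⇒disjoint J v∈S) (clique-join cB cS J)
    clique-eliminable (suc m) zero eq S≤0 cB cS J | yes (v , v∈S) =
      contradiction (ℕ.<-≤-trans (x∈p⇒∣p-x∣<∣p∣ v∈S) S≤0) λ ()
    clique-eliminable {S = S} (suc m) (suc s) eq S≤s cB cS J | yes (v , v∈S) =
      split v v∈S v∉B
        (clique-eliminable m (suc s) (∣B∪⁅v⁆∣+m v∉B eq) (ℕ.≤-trans (∣p∩q∣≤∣p∣ S (nbrs G v)) S≤s)
          (clique-∪⁅⁆ cB J v∈S) (clique-⊆ G (p∩q⊆p S (nbrs G v)) cS) (joined-link J v∈S))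
        (clique-eliminable (suc m) s eq (ℕ.≤-pred (ℕ.<-≤-trans (x∈p⇒∣p-x∣<∣p∣ v∈S) S≤s)) cB
          (clique-⊆ G (p─q⊆p S ⁅ v ⁆) cS) (λ b∈ s∈ → J b∈ (p─q⊆p S ⁅ v ⁆ s∈)))
      where v∉B = joined⇒disjoint J v∈S

    -- If `S` is not a clique, split at a vertex `u` with a non-neighbour `v` in `S`. The link of
    -- `u` lacks both `u` and `v`, so the bound `2 * m + 1` drops by two while `m` drops by one; the
    -- deletion of `u` keeps `m` and has fewer vertices. For `m = 0` there is no room for such a
    -- pair.
    few-eliminable : ∀ {K B S} m s → ∣ B ∣ + m ≡ K → ∣ S ∣ ≤ suc (2 * m) → ∣ S ∣ ≤ s → Clique G B →
                     Joined B S → Eliminable G K B S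
    few-eliminable {K} {B} {S} m s eq S≤2m+1 S≤s cB J
      with Fin.any? (λ u → Fin.any? (λ v →
             (u ∈? S) ×-dec (v ∈? S) ×-dec ¬? (u Fin.≟ v) ×-dec ¬? (v ∈? nbrs G u)))
    ... | no complete = clique-eliminable m s eq S≤s cB
          (λ i j i∈ j∈ i≢j → decidable-stable (j ∈? nbrs G i) λ j∉ → complete (i , j , i∈ , j∈ , i≢j , j∉)) J
    ... | yes (u , v , u∈S , v∈S , u≢v , v∉Nu) = by-deleting m s eq S≤2m+1 S≤s
      where
      S-u<S : ∣ S - u ∣ < ∣ S ∣
      S-u<S = x∈p⇒∣p-x∣<∣p∣ u∈S
      link⊂ : S ∩ nbrs G u ⊂ S - u
      link⊂ = (λ x∈ → let x∈S , x∈Nu = x∈p∩q⁻ S (nbrs G u) x∈ in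
                 x∈p∧x≢y⇒x∈p-y x∈S λ { refl → nbrs-irrefl G _ x∈Nu }) ,
              v , x∈p∧x≢y⇒x∈p-y v∈S (λ v≡u → u≢v (sym v≡u)) ,
              λ v∈ → v∉Nu (p∩q⊆q S (nbrs G u) v∈)
      link+2≤S : 2 + ∣ S ∩ nbrs G u ∣ ≤ ∣ S ∣
      link+2≤S = ℕ.≤-trans (s≤s (p⊂q⇒∣p∣<∣q∣ link⊂)) S-u<S
      by-deleting : ∀ m s → ∣ B ∣ + m ≡ K → ∣ S ∣ ≤ suc (2 * m) → ∣ S ∣ ≤ s → Eliminable G K B S
      by-deleting zero s eq S≤1 S≤s = contradiction (ℕ.≤-trans link+2≤S S≤1) λ { (s≤s ()) }
      by-deleting (suc m) zero eq S≤2m+1 S≤0 = contradiction (ℕ.≤-trans link+2≤S S≤0) λ ()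
      by-deleting (suc m) (suc s) eq S≤2m+1 S≤s =
        split u u∈S u∉B
          (few-eliminable m (suc s) (∣B∪⁅v⁆∣+m u∉B eq)
            (ℕ.≤-pred (ℕ.≤-pred (ℕ.≤-trans link+2≤S (subst (∣ S ∣ ≤_) (cong suc (ℕ.*-suc 2 m)) S≤2m+1))))
            (ℕ.≤-trans (∣p∩q∣≤∣p∣ S (nbrs G u)) S≤s) (clique-∪⁅⁆ cB J u∈S) (joined-link J u∈S))
          (few-eliminable (suc m) s eq (ℕ.≤-trans (ℕ.<⇒≤ S-u<S) S≤2m+1)
            (ℕ.≤-pred (ℕ.<-≤-trans S-u<S S≤s)) cB (λ b∈ s∈ → J b∈ (p─q⊆p S ⁅ u ⁆ s∈)))
        where u∉B = joined⇒disjoint J u∈S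

    -- Sparsity passes to subsets, so vertices of low degree can be deleted one after another. The
    -- faces through the deleted vertex are governed by its link, which is small enough for
    -- `few-eliminable`.
    sparse-eliminable : ∀ k {W} s → ∣ W ∣ ≤ s →
      (∀ S → S ⊆ W → Nonempty S → edges G S < suc k * ∣ S ∣) → Eliminable G (suc k) ⊥ W
    sparse-eliminable k {W} s W≤s sparse with nonempty? W
    ... | no W-empty = eliminable-empty (subst (_≤ suc k) (sym (∣⊥∣≡0 n)) z≤n) W-empty
    sparse-eliminable k zero W≤0 sparse | yes (v , v∈W) =
      contradiction (ℕ.<-≤-trans (x∈p⇒∣p-x∣<∣p∣ v∈W) W≤0) λ ()
    sparse-eliminable k {W} (suc s) W≤s sparse | yes ne =
      let v , v∈W , low = low-degree G W (suc k) (sparse W ⊆-refl ne) in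
      split v v∈W ∉⊥
        (few-eliminable k (suc s) (∣B∪⁅v⁆∣+m ∉⊥ (cong (_+ suc k) (∣⊥∣≡0 n)))
          -- A degree below `2 * suc k` is at most `2 * k + 1`, the bound required when `k` vertices
          -- are missing from the base `⁅ v ⁆`.
          (ℕ.≤-pred (subst (∣ W ∩ nbrs G v ∣ <_) (ℕ.*-suc 2 k)
            (subst (λ p → ∣ p ∣ < 2 * suc k) (∩-comm (nbrs G v) W) low)))
          (ℕ.≤-trans (∣p∩q∣≤∣p∣ W (nbrs G v)) W≤s)
          (clique-∪⁅⁆ {S = W} (λ _ _ i∈ → contradiction i∈ ∉⊥) (λ b∈ → contradiction b∈ ∉⊥) v∈W)
          (joined-link {B = ⊥} (λ b∈ → contradiction b∈ ∉⊥) v∈W))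
        (sparse-eliminable k s (ℕ.≤-pred (ℕ.<-≤-trans (x∈p⇒∣p-x∣<∣p∣ v∈W) W≤s))
          (λ S S⊆ → sparse S (⊆-trans S⊆ (p─q⊆p W ⁅ v ⁆))))

  -- Saturated sets and dense sets.

  subset-of-size : ∀ {n} j (p : Subset n) → j ≤ ∣ p ∣ → ∃[ q ] (q ⊆ p × ∣ q ∣ ≡ j)
  subset-of-size {n} zero p       _        = ⊥ , ⊥⊆ , ∣⊥∣≡0 n
  subset-of-size (suc j) (outside ∷ p) j≤       =
    let q , q⊆p , e = subset-of-size (suc j) p j≤ in outside ∷ q , s⊆s q⊆p , e
  subset-of-size (suc j) (inside ∷ p)  (s≤s j≤) =
    let q , q⊆p , e = subset-of-size j p j≤ in inside ∷ q , s⊆s q⊆p , cong suc e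

  Saturated : ∀ {n} → Graph n → ℕ → Subset n → Set
  Saturated G K W = ∀ u → u ∉ W → ∣ nbrs G u ∩ W ∣ < K

  -- Hence collapses inside a saturated set do not interact with faces outside it.

  saturated-absorbs : ∀ {n} (G : Graph n) {K W σ η} → Saturated G K W →
                      σ ⊆ η → K ≤ ∣ σ ∣ → Clique G η → σ ⊆ W → η ⊆ W
  saturated-absorbs G {K} {W} {σ} sat σ⊆η K≤σ c σ⊆W {x} x∈η with x ∈? W
  ... | yes x∈W = x∈W
  ... | no x∉W  = contradiction (ℕ.≤-trans K≤σ (p⊆q⇒∣p∣≤∣q∣ σ⊆)) (ℕ.<⇒≱ (sat x x∉W))
    where
    σ⊆ : σ ⊆ nbrs G x ∩ W
    σ⊆ {y} y∈σ = x∈p∩q⁺ (c x y x∈η (σ⊆η y∈σ) (λ { refl → x∉W (σ⊆W y∈σ) }) , σ⊆W y∈σ)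

  -- A dense set is either a set of fewer than K + E + 1 vertices with average degree at
  -- least 2 K, or a set of exactly K + E + 1 vertices that saturation can reach.

  order : ℕ → ℕ → ℕ → ℕ
  order K E w = if does (w ℕ.<? K + suc E) then w else suc E

  Dense : ∀ {n} → ℕ → ℕ → Graph n → Subset n → Set
  Dense K E G W = 0 < ∣ W ∣ × ∣ W ∣ ≤ K + suc E × K * order K E ∣ W ∣ ≤ edges G W

  dense? : ∀ {n} K E (G : Graph n) → Decidable (Dense K E G)
  dense? K E G W = (_ ℕ.<? _) ×-dec (_ ℕ.≤? _) ×-dec (_ ℕ.≤? _)

  order-< : ∀ {K E w} → w < K + suc E → order K E w ≡ w
  order-< {K} {E} {w} w<M =
    cong (λ b → if b then w else suc E) (dec-true (w ℕ.<? K + suc E) w<M)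

  order-max : ∀ K E → order K E (K + suc E) ≡ suc E
  order-max K E = cong (λ b → if b then K + suc E else suc E)
    (dec-false (K + suc E ℕ.<? K + suc E) (ℕ.<-irrefl refl))

  -- `d` counts the vertices added to an initial set of size `K`, and `f` those still to come. Each
  -- addition brings at least `K` edges, so when `f` runs out the set meets the exceptional clause
  -- of `order`, which asks for `K * suc E` edges only.
  saturate : ∀ {n} (G : Graph n) K E d f {W} → d + f ≡ suc E → ∣ W ∣ ≡ K + d → K * d ≤ edges G W →
             ∃[ U ] Dense K E G U ⊎ ∃[ U ] (W ⊆ U × ∣ U ∣ < K + suc E × Saturated G K U)
  saturate G K E d zero {W} d+0 W≡ e rewrite trans (sym (ℕ.+-identityʳ d)) d+0 = inj₁ (W ,
    subst (0 <_) (sym W≡) (ℕ.<-≤-trans (s≤s z≤n) (ℕ.m≤n+m (suc E) K)) , ℕ.≤-reflexive W≡ ,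
    subst (λ r → K * r ≤ edges G W) (sym (trans (cong (order K E) W≡) (order-max K E))) e)
  saturate G K E d (suc f) {W} d+f W≡ e
    with Fin.any? (λ u → ¬? (u ∈? W) ×-dec (K ℕ.≤? ∣ nbrs G u ∩ W ∣))
  ... | no none = inj₂ (W , ⊆-refl ,
          subst (_< K + suc E) (sym W≡) (ℕ.+-monoʳ-< K (subst (d <_) d+f (ℕ.m<m+n d (s≤s z≤n)))) ,
          λ u u∉W → ℕ.≰⇒> λ K≤ → none (u , u∉W , K≤))
  ... | yes (u , u∉W , K≤)
    with saturate G K E (suc d) f (trans (sym (ℕ.+-suc d f)) d+f)
           (trans (∣p∪⁅x⁆∣ u∉W) (trans (cong suc W≡) (sym (ℕ.+-suc K d))))
           (subst (K * suc d ≤_) (sym (edges-∪⁅⁆ G u∉W))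
             (ℕ.≤-trans (ℕ.≤-reflexive (trans (ℕ.*-suc K d) (ℕ.+-comm K (K * d)))) (ℕ.+-mono-≤ e K≤)))
  ...   | inj₁ dense                = inj₁ dense
  ...   | inj₂ (U , W∪u⊆U , rest) = inj₂ (U , ⊆-trans (p⊆p∪q ⁅ u ⁆) W∪u⊆U , rest)

  -- Collapsing a clique complex without dense sets.

  module _ {n} (G : Graph n) (k E : ℕ) (sparse : ¬ (∃[ W ] Dense (suc k) E G W)) where

    private
      K : ℕ
      K = suc k

    -- A subset of `U` is too small for the exceptional clause of `order`, so absence of dense sets
    -- means fewer than `K` edges per vertex.
    saturated-eliminable : ∀ {U} → ∣ U ∣ < K + suc E → Eliminable G K ⊥ U
    saturated-eliminable {U} U<M = sparse-eliminable G k ∣ U ∣ ℕ.≤-refl λ S S⊆U S≢∅ → ℕ.≰⇒> λ dense →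
      let S<M = ℕ.≤-<-trans (p⊆q⇒∣p∣≤∣q∣ S⊆U) U<M in
      sparse (S , ℕ.≤-<-trans z≤n (x∈p⇒∣p-x∣<∣p∣ (proj₂ S≢∅)) , ℕ.<⇒≤ S<M ,
              subst (λ r → K * r ≤ edges G S) (sym (order-< {K} S<M)) dense)

    -- The invariant of a run through `seeds`. `Done` holds of the sets contained in a saturated set
    -- already treated: among cliques of at least `K` vertices it is constant along inclusions,
    -- those outside it are untouched, and those inside have been reduced to size at most `K`.
    record Progress (seeds : List (Subset n)) : Set₁ where
      field
        Δ       : Complex n
        steps   : Star _↘_ (cliqueComplex G) Δ
        cliques : ∀ {η} → Face Δ η → Clique G η
        Done    : Pred (Subset n) 0ℓ
        done?   : Decidable Done
        up      : ∀ {σ η} → σ ⊆ η → K ≤ ∣ σ ∣ → Clique G η → Done σ → Done η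
        down    : ∀ {σ η} → σ ⊆ η → K ≤ ∣ σ ∣ → Clique G η → Done η → Done σ
        intact  : ∀ {η} → Clique G η → ¬ Done η → K ≤ ∣ η ∣ → Face Δ η
        shrunk  : ∀ {η} → Face Δ η → Done η → ∣ η ∣ ≤ K
        covered : ∀ {σ} → σ ∈ˡ seeds → ∣ σ ∣ ≡ K → Done σ

    -- A seed of size `K` is grown to a saturated set `U`, and elimination runs from the empty base
    -- on the part of `U` not yet done. Seeds of other sizes leave the complex unchanged.
    progress : ∀ seeds → Progress seeds
    progress [] = record
      { Δ       = cliqueComplex G
      ; steps   = ε
      ; cliques = λ (_ , c) i j i∈ j∈ i≢j → T-adjacent⇒∈nbrs G i j (c i j i∈ j∈ i≢j)
      ; Done    = λ _ → Empty.⊥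
      ; done?   = λ _ → no λ ()
      ; up      = λ _ _ _ ()
      ; down    = λ _ _ _ ()
      ; intact  = λ c _ K≤η → 0<∣p∣⇒Nonempty (ℕ.<-≤-trans (s≤s z≤n) K≤η) ,
                    λ i j i∈ j∈ i≢j → ∈nbrs⇒T-adjacent G i j (c i j i∈ j∈ i≢j)
      ; shrunk  = λ _ ()
      ; covered = λ ()
      }
    progress (σ ∷ seeds) with ∣ σ ∣ ℕ.≟ K | progress seeds
    ... | no σ≢K | P = record
      { Progress P
      ; covered = λ { (here refl) σ≡K → contradiction σ≡K σ≢K ; (there ρ∈) → Progress.covered P ρ∈ } }
    ... | yes σ≡K | P with saturate G K E 0 (suc E) {σ} refl (trans σ≡K (sym (ℕ.+-identityʳ K)))
                             (ℕ.≤-trans (ℕ.≤-reflexive (ℕ.*-zeroʳ K)) z≤n)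
    ...   | inj₁ dense = contradiction dense sparse
    ...   | inj₂ (U , σ⊆U , U<M , sat) =
      let Δ′ , s , sub , keep , dim≤ = eliminate G K (s≤s z≤n) active? active-up active-down
            (saturated-eliminable U<M) Δ cliques
            (λ (_ , _ , _ , ¬done) c K≤η → intact c ¬done K≤η)
            (λ _ _ (η⊆U , _) _ → ⊆-trans η⊆U (q⊆p∪q ⊥ U)) in
      record
      { Δ       = Δ′
      ; steps   = steps ◅◅ s
      ; cliques = λ f → cliques (sub f)
      ; Done    = λ η → Done η ⊎ η ⊆ U
      ; done?   = λ η → done? η ⊎-dec (η ⊆? U)
      ; up      = λ { σ⊆η K≤σ c (inj₁ d)   → inj₁ (up σ⊆η K≤σ c d)
                    ; σ⊆η K≤σ c (inj₂ σ⊆U) → inj₂ (saturated-absorbs G sat σ⊆η K≤σ c σ⊆U) }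
      ; down    = λ { σ⊆η K≤σ c (inj₁ d)   → inj₁ (down σ⊆η K≤σ c d)
                    ; σ⊆η K≤σ c (inj₂ η⊆U) → inj₂ (⊆-trans σ⊆η η⊆U) }
      ; intact  = λ c ¬d K≤η → keep (intact c (λ d → ¬d (inj₁ d)) K≤η)
                    λ ((_ , _ , η⊆U , _) , _) → ¬d (inj₂ η⊆U)
      ; shrunk  = λ { {η} f (inj₁ d) → shrunk (sub f) d
                    ; {η} f (inj₂ η⊆U) → small-in-U Δ′ sub dim≤ f η⊆U }
      ; covered = λ { (here refl) _ → inj₂ σ⊆U ; (there ρ∈) ρ≡K → inj₁ (covered ρ∈ ρ≡K) }
      }
      where
      open Progress P
      -- Saturated sets may overlap; a face in several of them is treated with the first one only.
      Active : Pred (Subset n) 0ℓ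
      Active η = η ⊆ U × ¬ Done η
      active? : Decidable Active
      active? η = (η ⊆? U) ×-dec ¬? (done? η)
      active-up : ∀ {σ η} → σ ⊆ η → K ≤ ∣ σ ∣ → Clique G η → Active σ → Active η
      active-up σ⊆η K≤σ c (σ⊆U , ¬d) =
        saturated-absorbs G sat σ⊆η K≤σ c σ⊆U , λ d → ¬d (down σ⊆η K≤σ c d)
      active-down : ∀ {σ η} → σ ⊆ η → K ≤ ∣ σ ∣ → Clique G η → Active η → Active σ
      active-down σ⊆η K≤σ c (η⊆U , ¬d) = ⊆-trans σ⊆η η⊆U , λ d → ¬d (up σ⊆η K≤σ c d)
      small-in-U : ∀ Δ′ → (∀ {η} → Face Δ′ η → Face Δ η) →
        (∀ {η} → Face Δ′ η → ⊥ ⊆ η × η ⊆ ⊥ ∪ U × Active η → ∣ η ∣ ≤ K) →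
        ∀ {η} → Face Δ′ η → η ⊆ U → ∣ η ∣ ≤ K
      small-in-U Δ′ sub dim≤ {η} f η⊆U with done? η
      ... | yes d = shrunk (sub f) d
      ... | no ¬d = dim≤ f (⊥⊆ , ⊆-trans η⊆U (q⊆p∪q ⊥ U) , η⊆U , ¬d)

    -- All subsets serve as seeds. A remaining face with more than `K` vertices would contain a seed
    -- of size `K`, hence be done by `up`, and so have at most `K` vertices by `shrunk`.
    sparse-collapsible : Collapsible K (cliqueComplex G)
    sparse-collapsible = Δ , steps , λ η f → s≤s (ℕ.∸-monoˡ-≤ 1 (size≤K f))
      where
      open Progress (progress (subsets n))
      size≤K : ∀ {η} → Face Δ η → ∣ η ∣ ≤ K
      size≤K {η} f with ∣ η ∣ ℕ.≤? K
      ... | yes η≤K = η≤K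
      ... | no η≰K  =
        let σ , σ⊆η , σ≡K = subset-of-size K η (ℕ.<⇒≤ (ℕ.≰⇒> η≰K)) in
        shrunk f (up σ⊆η (ℕ.≤-reflexive (sym σ≡K)) (cliques f) (covered (∈-subsets σ) σ≡K))

  collapsible-or-dense : ∀ {n} (G : Graph n) k E →
                         Collapsible (suc k) (cliqueComplex G) ⊎ ∃[ W ] Dense (suc k) E G W
  collapsible-or-dense G k E with anySubset? (dense? (suc k) E G)
  ... | yes dense  = inj₂ dense
  ... | no ¬dense = inj₁ (sparse-collapsible G k E ¬dense)

open Combinatorics

-- Sums of rationals

open import Data.Rational.Base using (_+_; _*_; _-_; -_; _≤_; _<_)
open Exp (CommutativeRing.commutativeSemiring ℚ.+-*-commutativeRing)
  using (_^_; ^-homo-*; ^-assocʳ; ^-distrib-*)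

0≤1 : 0ℚ ≤ 1ℚ
0≤1 = ℚ.<⇒≤ (ℚ.positive⁻¹ 1ℚ)

*-nonNeg : ∀ {a b} → 0ℚ ≤ a → 0ℚ ≤ b → 0ℚ ≤ a * b
*-nonNeg {a} {b} 0≤a 0≤b =
  subst (_≤ a * b) (ℚ.*-zeroˡ 0ℚ) (*-mono-≤-nonNeg {0ℚ} ℚ.≤-refl 0≤a 0≤a 0≤b)

*-monoʳ-≤ : ∀ {a b c} → 0ℚ ≤ c → a ≤ b → a * c ≤ b * c
*-monoʳ-≤ {c = c} 0≤c = ℚ.*-monoʳ-≤-nonNeg c {{ℚ.nonNegative 0≤c}}

*-monoˡ-≤ : ∀ {a b c} → 0ℚ ≤ c → a ≤ b → c * a ≤ c * b
*-monoˡ-≤ {c = c} 0≤c = ℚ.*-monoˡ-≤-nonNeg c {{ℚ.nonNegative 0≤c}}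

≤-+ʳ : ∀ {a b} → 0ℚ ≤ b → a ≤ a + b
≤-+ʳ {a} {b} 0≤b = subst (_≤ a + b) (ℚ.+-identityʳ a) (ℚ.+-monoʳ-≤ a 0≤b)

≤-+ˡ : ∀ {a b} → 0ℚ ≤ b → a ≤ b + a
≤-+ˡ {a} {b} 0≤b = subst (_≤ b + a) (ℚ.+-identityˡ a) (ℚ.+-monoˡ-≤ a 0≤b)

^-nonNeg : ∀ {a} n → 0ℚ ≤ a → 0ℚ ≤ a ^ n
^-nonNeg zero    0≤a = 0≤1
^-nonNeg (suc n) 0≤a = *-nonNeg 0≤a (^-nonNeg n 0≤a)

^-mono-≤ : ∀ {a b} n → 0ℚ ≤ a → a ≤ b → a ^ n ≤ b ^ n
^-mono-≤ zero    0≤a a≤b = ℚ.≤-refl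
^-mono-≤ (suc n) 0≤a a≤b =
  *-mono-≤-nonNeg (^-nonNeg n 0≤a) (ℚ.≤-trans 0≤a a≤b) a≤b (^-mono-≤ n 0≤a a≤b)

1^n≡1 : ∀ n → 1ℚ ^ n ≡ 1ℚ
1^n≡1 zero    = refl
1^n≡1 (suc n) = trans (ℚ.*-identityˡ (1ℚ ^ n)) (1^n≡1 n)

^-≤1 : ∀ {a} n → 0ℚ ≤ a → a ≤ 1ℚ → a ^ n ≤ 1ℚ
^-≤1 {a} n 0≤a a≤1 = subst (a ^ n ≤_) (1^n≡1 n) (^-mono-≤ n 0≤a a≤1)

^-≥1 : ∀ {a} n → 1ℚ ≤ a → 1ℚ ≤ a ^ n
^-≥1 {a} n 1≤a = subst (_≤ a ^ n) (1^n≡1 n) (^-mono-≤ n 0≤1 1≤a)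

^-antimonoʳ-≤ : ∀ {a m n} → 0ℚ ≤ a → a ≤ 1ℚ → m ℕ.≤ n → a ^ n ≤ a ^ m
^-antimonoʳ-≤ {n = n} 0≤a a≤1 z≤n       = ^-≤1 n 0≤a a≤1
^-antimonoʳ-≤         0≤a a≤1 (s≤s m≤n) = *-monoˡ-≤ 0≤a (^-antimonoʳ-≤ 0≤a a≤1 m≤n)

^-cancel-≤1 : ∀ {a} n → a ^ suc n ≤ 1ℚ → a ≤ 1ℚ
^-cancel-≤1 {a} n h = ℚ.≮⇒≥ λ 1<a → ℚ.<-irrefl refl (ℚ.<-≤-trans 1<a (ℚ.≤-trans (begin
  a          ≡⟨ ℚ.*-identityʳ a ⟨
  a * 1ℚ     ≤⟨ *-monoˡ-≤ (ℚ.≤-trans 0≤1 (ℚ.<⇒≤ 1<a)) (^-≥1 n (ℚ.<⇒≤ 1<a)) ⟩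
  a ^ suc n  ∎) h))
  where open ℚ.≤-Reasoning

private
  +-interchange : ∀ a b c d → (a + b) + (c + d) ≡ (a + c) + (b + d)
  +-interchange = solve-∀ ℚ-ring

sum : ∀ {A : Set} → (A → ℚ) → List A → ℚ
sum f []       = 0ℚ
sum f (x ∷ xs) = f x + sum f xs

module _ {A : Set} where

  sum-++ : ∀ (f : A → ℚ) xs ys → sum f (xs ++ ys) ≡ sum f xs + sum f ys
  sum-++ f []       ys = sym (ℚ.+-identityˡ _)
  sum-++ f (x ∷ xs) ys = trans (cong (λ z → f x + z) (sum-++ f xs ys)) (sym (ℚ.+-assoc (f x) _ _))

  sum-cong : ∀ {f g : A → ℚ} xs → (∀ x → f x ≡ g x) → sum f xs ≡ sum g xs
  sum-cong []       e = refl
  sum-cong (x ∷ xs) e = cong₂ _+_ (e x) (sum-cong xs e)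

  sum-mono : ∀ {f g : A → ℚ} xs → (∀ x → f x ≤ g x) → sum f xs ≤ sum g xs
  sum-mono []       h = ℚ.≤-refl
  sum-mono (x ∷ xs) h = ℚ.+-mono-≤ (h x) (sum-mono xs h)

  sum-zero : ∀ (xs : List A) → sum (λ _ → 0ℚ) xs ≡ 0ℚ
  sum-zero []       = refl
  sum-zero (x ∷ xs) = trans (ℚ.+-identityˡ _) (sum-zero xs)

  sum-nonNeg : ∀ {f : A → ℚ} xs → (∀ x → 0ℚ ≤ f x) → 0ℚ ≤ sum f xs
  sum-nonNeg {f} xs h = subst (_≤ sum f xs) (sum-zero xs) (sum-mono xs h)

  sum-+ : ∀ (f g : A → ℚ) xs → sum (λ x → f x + g x) xs ≡ sum f xs + sum g xs
  sum-+ f g []       = refl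
  sum-+ f g (x ∷ xs) =
    trans (cong (λ z → f x + g x + z) (sum-+ f g xs)) (+-interchange (f x) (g x) (sum f xs) (sum g xs))

  sum-*ˡ : ∀ c (f : A → ℚ) xs → sum (λ x → c * f x) xs ≡ c * sum f xs
  sum-*ˡ c f []       = sym (ℚ.*-zeroʳ c)
  sum-*ˡ c f (x ∷ xs) = trans (cong (λ z → c * f x + z) (sum-*ˡ c f xs)) (sym (ℚ.*-distribˡ-+ c (f x) _))

  sum-∈ : ∀ {f : A → ℚ} {x xs} → (∀ x → 0ℚ ≤ f x) → x ∈ˡ xs → f x ≤ sum f xs
  sum-∈ {xs = x ∷ xs} h (here refl) = ≤-+ʳ (sum-nonNeg xs h)
  sum-∈ {xs = y ∷ xs} h (there x∈)  = ℚ.≤-trans (sum-∈ h x∈) (≤-+ˡ (h y))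

  sum-map : ∀ {B : Set} (f : B → ℚ) (g : A → B) xs → sum f (List.map g xs) ≡ sum (λ x → f (g x)) xs
  sum-map f g []       = refl
  sum-map f g (x ∷ xs) = cong (λ z → f (g x) + z) (sum-map f g xs)

sum-swap : ∀ {A B : Set} (f : A → B → ℚ) xs ys →
           sum (λ x → sum (f x) ys) xs ≡ sum (λ y → sum (λ x → f x y) xs) ys
sum-swap f []       ys = sym (sum-zero ys)
sum-swap f (x ∷ xs) ys = trans (cong (λ z → sum (f x) ys + z) (sum-swap f xs ys))
  (sym (sum-+ (f x) (λ y → sum (λ x → f x y) xs) ys))

sum-cartesianProductWith : ∀ {A B C : Set} (f : C → ℚ) (g : A → B → C) xs ys →
  sum f (cartesianProductWith g xs ys) ≡ sum (λ x → sum (λ y → f (g x y)) ys) xs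
sum-cartesianProductWith f g []       ys = refl
sum-cartesianProductWith f g (x ∷ xs) ys = trans (sum-++ f (List.map (g x) ys) _)
  (cong₂ _+_ (sum-map f (g x) ys) (sum-cartesianProductWith f g xs ys))

-- Expresses independence: the row of vertex zero and the graph on the other vertices contribute
-- separate factors to a total over `graphs`.
sum-product : ∀ {A B C : Set} (f : C → ℚ) (g : A → B → C) (a : A → ℚ) (b : B → ℚ) xs ys →
  (∀ x y → f (g x y) ≡ a x * b y) →
  sum f (cartesianProductWith g xs ys) ≡ sum a xs * sum b ys
sum-product f g a b xs ys e = begin
  sum f (cartesianProductWith g xs ys)        ≡⟨ sum-cartesianProductWith f g xs ys ⟩
  sum (λ x → sum (λ y → f (g x y)) ys) xs     ≡⟨ sum-cong xs (λ x → trans (sum-cong ys (e x)) (sum-*ˡ (a x) b ys)) ⟩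
  sum (λ x → a x * sum b ys) xs               ≡⟨ sum-cong xs (λ x → ℚ.*-comm (a x) (sum b ys)) ⟩
  sum (λ x → sum b ys * a x) xs               ≡⟨ sum-*ˡ (sum b ys) a xs ⟩
  sum b ys * sum a xs                         ≡⟨ ℚ.*-comm (sum b ys) (sum a xs) ⟩
  sum a xs * sum b ys                         ∎
  where open ≡-Reasoning

-- Serves to bound the mass of the good outcomes from below: the total of `f` will be 1, and `g`
-- will be the charge to dense sets.
sum-filter-≤ : ∀ {A : Set} {ℓ} {P : Pred A ℓ} (P? : Decidable P) {f g : A → ℚ} xs →
  (∀ x → 0ℚ ≤ g x) → (∀ x → ¬ P x → f x ≤ g x) → sum f xs ≤ sum f (filter P? xs) + sum g xs
sum-filter-≤ P? []       0≤g h = ℚ.≤-refl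
sum-filter-≤ P? {f} {g} (x ∷ xs) 0≤g h with P? x
... | yes _ = begin
  f x + sum f xs                              ≤⟨ ℚ.+-monoʳ-≤ (f x) (sum-filter-≤ P? xs 0≤g h) ⟩
  f x + (F + G)                               ≤⟨ ℚ.+-monoʳ-≤ (f x) (ℚ.+-monoʳ-≤ F (≤-+ˡ (0≤g x))) ⟩
  f x + (F + (g x + G))                       ≡⟨ ℚ.+-assoc (f x) F _ ⟨
  f x + F + (g x + G)                         ∎
  where
  open ℚ.≤-Reasoning
  F G : ℚ
  F = sum f (filter P? xs)
  G = sum g xs
... | no ¬p = begin
  f x + sum f xs                              ≤⟨ ℚ.+-mono-≤ (h x ¬p) (sum-filter-≤ P? xs 0≤g h) ⟩
  g x + (F + G)                               ≡⟨ lem (g x) F G ⟩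
  F + (g x + G)                               ∎
  where
  open ℚ.≤-Reasoning
  F G : ℚ
  F = sum f (filter P? xs)
  G = sum g xs
  lem : ∀ a b c → a + (b + c) ≡ b + (a + c)
  lem = solve-∀ ℚ-ring

sum-filter-mono : ∀ {A : Set} {ℓ} {P : Pred A ℓ} (P? : Decidable P) {f : A → ℚ} xs →
  (∀ x → 0ℚ ≤ f x) → sum f (filter P? xs) ≤ sum f xs
sum-filter-mono P? []       0≤f = ℚ.≤-refl
sum-filter-mono P? {f} (x ∷ xs) 0≤f with P? x
... | yes _ = ℚ.+-monoʳ-≤ (f x) (sum-filter-mono P? xs 0≤f)
... | no _  = ℚ.≤-trans (sum-filter-mono P? xs 0≤f) (≤-+ˡ (0≤f x))

-- Sums over subsets, grouped by size.

sum-subsets-suc : ∀ n (f : Subset (suc n) → ℚ) →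
  sum f (subsets (suc n)) ≡ sum (λ s → f (inside ∷ s)) (subsets n) + sum (λ s → f (outside ∷ s)) (subsets n)
sum-subsets-suc n f = trans (sum-++ f (List.map (inside ∷_) (subsets n)) _)
  (cong₂ _+_ (sum-map f (inside ∷_) (subsets n)) (sum-map f (outside ∷_) (subsets n)))

-- The polynomial with coefficients `f 0`, ..., `f (m - 1)` evaluated at `N`, in the nested form
-- that matches the recursion over subsets.
horner : ℚ → ℕ → (ℕ → ℚ) → ℚ
horner N zero    f = 0ℚ
horner N (suc m) f = f 0 + N * horner N m (λ w → f (suc w))

horner-nonNeg : ∀ {N} m {f} → 0ℚ ≤ N → (∀ w → 0ℚ ≤ f w) → 0ℚ ≤ horner N m f
horner-nonNeg zero    0≤N 0≤f = ℚ.≤-refl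
horner-nonNeg (suc m) 0≤N 0≤f =
  ℚ.+-mono-≤ (0≤f 0) (*-nonNeg 0≤N (horner-nonNeg m 0≤N (λ w → 0≤f (suc w))))

horner-mono : ∀ {N N′} m {f} → 0ℚ ≤ N → N ≤ N′ → (∀ w → 0ℚ ≤ f w) → horner N m f ≤ horner N′ m f
horner-mono zero    0≤N N≤N′ 0≤f = ℚ.≤-refl
horner-mono (suc m) {f} 0≤N N≤N′ 0≤f = ℚ.+-monoʳ-≤ (f 0)
  (*-mono-≤-nonNeg (horner-nonNeg m 0≤N (λ w → 0≤f (suc w))) (ℚ.≤-trans 0≤N N≤N′) N≤N′
    (horner-mono m 0≤N N≤N′ (λ w → 0≤f (suc w))))

-- Each of the `m` terms contributes at most `z`. The factor `c` collects the powers of `N` as the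
-- recursion descends to the shifted coefficients.
horner-bound : ∀ {N c z} m f → (∀ w → c * N ^ w * f w ≤ z) → c * horner N m f ≤ frac m 0 * z
horner-bound {c = c} {z} zero    f h = ℚ.≤-reflexive (trans (ℚ.*-zeroʳ c) (sym (ℚ.*-zeroˡ z)))
horner-bound {N} {c} {z} (suc m) f h = begin
  c * (f 0 + N * H)          ≡⟨ e₁ c N (f 0) H ⟩
  c * 1ℚ * f 0 + c * N * H   ≤⟨ ℚ.+-mono-≤ (h 0) (horner-bound {N} {c * N} m _ λ w →
                                  subst (λ t → t * f (suc w) ≤ z) (sym (ℚ.*-assoc c N (N ^ w))) (h (suc w))) ⟩
  z + frac m 0 * z           ≡⟨ e₂ z (frac m 0) ⟩
  (frac m 0 + 1ℚ) * z        ≡⟨ cong (_* z) (frac-suc m 0) ⟨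
  frac (suc m) 0 * z         ∎
  where
  open ℚ.≤-Reasoning
  H : ℚ
  H = horner N m (λ w → f (suc w))
  e₁ : ∀ c N a H → c * (a + N * H) ≡ c * 1ℚ * a + c * N * H
  e₁ = solve-∀ ℚ-ring
  e₂ : ∀ z m → z + m * z ≡ (m + 1ℚ) * z
  e₂ = solve-∀ ℚ-ring

-- There are at most n ^ w subsets of size w.
sum-subsets-by-size : ∀ n m f → (∀ w → 0ℚ ≤ f w) → (∀ w → m ℕ.≤ w → f w ≡ 0ℚ) →
  sum (λ W → f ∣ W ∣) (subsets n) ≤ horner (frac n 0) m f
sum-subsets-by-size n zero f 0≤f f≡0 = ℚ.≤-reflexive
  (trans (sum-cong (subsets n) (λ W → f≡0 ∣ W ∣ z≤n)) (sum-zero (subsets n)))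
sum-subsets-by-size zero (suc m) f 0≤f f≡0 =
  ℚ.+-monoʳ-≤ (f 0) (*-nonNeg (frac-nonNeg 0 0) (horner-nonNeg m (frac-nonNeg 0 0) (λ w → 0≤f (suc w))))
sum-subsets-by-size (suc n) (suc m) f 0≤f f≡0 = begin
  sum (λ W → f ∣ W ∣) (subsets (suc n))
    ≡⟨ sum-subsets-suc n (λ W → f ∣ W ∣) ⟩
  sum (λ W → f (suc ∣ W ∣)) (subsets n) + sum (λ W → f ∣ W ∣) (subsets n)
    ≤⟨ ℚ.+-mono-≤ (sum-subsets-by-size n m f′ (λ w → 0≤f (suc w)) (λ w m≤w → f≡0 (suc w) (s≤s m≤w)))
                  (sum-subsets-by-size n (suc m) f 0≤f f≡0) ⟩
  H + (f 0 + frac n 0 * H)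
    ≡⟨ e H (f 0) (frac n 0) ⟩
  f 0 + (frac n 0 + 1ℚ) * H
    ≡⟨ cong (λ N → f 0 + N * H) (frac-suc n 0) ⟨
  f 0 + frac (suc n) 0 * H
    ≤⟨ ℚ.+-monoʳ-≤ (f 0) (*-monoˡ-≤ (frac-nonNeg (suc n) 0)
         (horner-mono m (frac-nonNeg n 0) n≤1+n (λ w → 0≤f (suc w)))) ⟩
  f 0 + frac (suc n) 0 * horner (frac (suc n) 0) m f′ ∎
  where
  open ℚ.≤-Reasoning
  f′ : ℕ → ℚ
  f′ w = f (suc w)
  H : ℚ
  H = horner (frac n 0) m f′
  n≤1+n : frac n 0 ≤ frac (suc n) 0
  n≤1+n = subst (frac n 0 ≤_) (sym (frac-suc n 0)) (≤-+ʳ 0≤1)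
  e : ∀ H a N → H + (a + N * H) ≡ a + (N + 1ℚ) * H
  e = solve-∀ ℚ-ring

-- Weights of graphs with a rational edge probability.

slotWeight : ∀ {n} → ℚ → Subset n → ℚ
slotWeight y []            = 1ℚ
slotWeight y (inside  ∷ s) = y * slotWeight y s
slotWeight y (outside ∷ s) = (1ℚ - y) * slotWeight y s

-- Together with `slotWeight`, the rational counterpart of `weight` and `slots`.
graphWeight : ∀ {n} → ℚ → Graph n → ℚ
graphWeight y []      = 1ℚ
graphWeight y (s ∷ G) = slotWeight y s * graphWeight y G

-- As slotWeight and graphWeight, but pairs with both ends in W get weight 1. The relaxed
-- weights still have a total independent of y, while a graph with many edges in W loses
-- the factor y ^ edges.

slotWeightOff : ∀ {n} → Subset n → ℚ → Subset n → ℚ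
slotWeightOff []            y []            = 1ℚ
slotWeightOff (inside  ∷ W) y (_       ∷ s) = slotWeightOff W y s
slotWeightOff (outside ∷ W) y (inside  ∷ s) = y * slotWeightOff W y s
slotWeightOff (outside ∷ W) y (outside ∷ s) = (1ℚ - y) * slotWeightOff W y s

graphWeightOff : ∀ {n} → Subset n → ℚ → Graph n → ℚ
graphWeightOff []            y []      = 1ℚ
graphWeightOff (inside  ∷ W) y (s ∷ G) = slotWeightOff W y s * graphWeightOff W y G
graphWeightOff (outside ∷ W) y (s ∷ G) = slotWeight y s * graphWeightOff W y G

2ℚ : ℚ
2ℚ = 1ℚ + 1ℚ

0≤2 : 0ℚ ≤ 2ℚ
0≤2 = ℚ.+-mono-≤ 0≤1 0≤1

-- 2 to the number of pairs in a set of size w.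
pairChoices : ℕ → ℚ
pairChoices zero    = 1ℚ
pairChoices (suc w) = 2ℚ ^ w * pairChoices w

pairChoices-nonNeg : ∀ w → 0ℚ ≤ pairChoices w
pairChoices-nonNeg zero    = 0≤1
pairChoices-nonNeg (suc w) = *-nonNeg (^-nonNeg w 0≤2) (pairChoices-nonNeg w)

pairChoices-mono : ∀ {w m} → w ℕ.≤ m → pairChoices w ≤ pairChoices m
pairChoices-mono w≤m = go (ℕ.≤⇒≤′ w≤m)
  where
  1≤2^ : ∀ w → 1ℚ ≤ 2ℚ ^ w
  1≤2^ w = ^-≥1 w (≤-+ʳ 0≤1)
  go : ∀ {w m} → w ℕ.≤′ m → pairChoices w ≤ pairChoices m
  go ℕ.≤′-refl               = ℚ.≤-refl
  go (ℕ.≤′-step {n = m} w≤m) = ℚ.≤-trans (go w≤m)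
    (subst (_≤ pairChoices (suc m)) (ℚ.*-identityˡ (pairChoices m))
      (*-monoʳ-≤ (pairChoices-nonNeg m) (1≤2^ m)))

split-slot : ∀ y a → y * a + (1ℚ - y) * a ≡ a
split-slot = solve-∀ ℚ-ring

sum-slotWeight : ∀ n y → sum (slotWeight y) (subsets n) ≡ 1ℚ
sum-slotWeight zero    y = refl
sum-slotWeight (suc n) y = begin
  sum (slotWeight y) (subsets (suc n))      ≡⟨ sum-subsets-suc n (slotWeight y) ⟩
  sum (λ s → y * slotWeight y s) (subsets n) + sum (λ s → (1ℚ - y) * slotWeight y s) (subsets n)
    ≡⟨ cong₂ _+_ (sum-*ˡ y (slotWeight y) (subsets n)) (sum-*ˡ (1ℚ - y) (slotWeight y) (subsets n)) ⟩
  y * S + (1ℚ - y) * S                      ≡⟨ split-slot y S ⟩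
  S                                         ≡⟨ sum-slotWeight n y ⟩
  1ℚ                                        ∎
  where
  open ≡-Reasoning
  S : ℚ
  S = sum (slotWeight y) (subsets n)

-- A position in `W` is free and doubles the total; any other position contributes
-- `y + (1 - y) = 1`.
sum-slotWeightOff : ∀ {n} (W : Subset n) y → sum (slotWeightOff W y) (subsets n) ≡ 2ℚ ^ ∣ W ∣
sum-slotWeightOff []            y = refl
sum-slotWeightOff {suc n} (inside ∷ W)  y = begin
  sum (slotWeightOff (inside ∷ W) y) (subsets (suc n))   ≡⟨ sum-subsets-suc n (slotWeightOff (inside ∷ W) y) ⟩
  S + S                                                  ≡⟨ double S ⟩
  2ℚ * S                                                 ≡⟨ cong (2ℚ *_) (sum-slotWeightOff W y) ⟩
  2ℚ * 2ℚ ^ ∣ W ∣                                        ∎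
  where
  open ≡-Reasoning
  S : ℚ
  S = sum (slotWeightOff W y) (subsets n)
  double : ∀ a → a + a ≡ (1ℚ + 1ℚ) * a
  double = solve-∀ ℚ-ring
sum-slotWeightOff {suc n} (outside ∷ W) y = begin
  sum (slotWeightOff (outside ∷ W) y) (subsets (suc n))  ≡⟨ sum-subsets-suc n (slotWeightOff (outside ∷ W) y) ⟩
  sum (λ s → y * slotWeightOff W y s) (subsets n) + sum (λ s → (1ℚ - y) * slotWeightOff W y s) (subsets n)
    ≡⟨ cong₂ _+_ (sum-*ˡ y (slotWeightOff W y) (subsets n)) (sum-*ˡ (1ℚ - y) (slotWeightOff W y) (subsets n)) ⟩
  y * S + (1ℚ - y) * S                                   ≡⟨ split-slot y S ⟩
  S                                                      ≡⟨ sum-slotWeightOff W y ⟩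
  2ℚ ^ ∣ W ∣                                             ∎
  where
  open ≡-Reasoning
  S : ℚ
  S = sum (slotWeightOff W y) (subsets n)

sum-graphWeight : ∀ n y → sum (graphWeight y) (graphs n) ≡ 1ℚ
sum-graphWeight zero    y = refl
sum-graphWeight (suc n) y = begin
  sum (graphWeight y) (graphs (suc n))
    ≡⟨ sum-product (graphWeight y) _∷_ (slotWeight y) (graphWeight y) (subsets n) (graphs n) (λ _ _ → refl) ⟩
  sum (slotWeight y) (subsets n) * sum (graphWeight y) (graphs n)
    ≡⟨ cong₂ _*_ (sum-slotWeight n y) (sum-graphWeight n y) ⟩
  1ℚ ∎
  where open ≡-Reasoning

sum-graphWeightOff : ∀ {n} (W : Subset n) y →
                     sum (graphWeightOff W y) (graphs n) ≡ pairChoices ∣ W ∣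
sum-graphWeightOff []            y = refl
sum-graphWeightOff {suc n} (inside ∷ W)  y = trans
  (sum-product (graphWeightOff (inside ∷ W) y) _∷_ (slotWeightOff W y) (graphWeightOff W y)
    (subsets n) (graphs n) (λ _ _ → refl))
  (cong₂ _*_ (sum-slotWeightOff W y) (sum-graphWeightOff W y))
sum-graphWeightOff {suc n} (outside ∷ W) y = trans
  (sum-product (graphWeightOff (outside ∷ W) y) _∷_ (slotWeight y) (graphWeightOff W y)
    (subsets n) (graphs n) (λ _ _ → refl))
  (trans (cong₂ _*_ (sum-slotWeight n y) (sum-graphWeightOff W y)) (ℚ.*-identityˡ _))

module _ {y : ℚ} (0≤y : 0ℚ ≤ y) (y≤1 : y ≤ 1ℚ) where

  0≤1-y : 0ℚ ≤ 1ℚ - y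
  0≤1-y = subst (_≤ 1ℚ - y) (ℚ.+-inverseʳ y) (ℚ.+-monoˡ-≤ (ℚ.- y) y≤1)

  1-y≤1 : 1ℚ - y ≤ 1ℚ
  1-y≤1 = subst (1ℚ - y ≤_) (e y) (≤-+ʳ {1ℚ - y} 0≤y)
    where
    e : ∀ y → 1ℚ - y + y ≡ 1ℚ
    e = solve-∀ ℚ-ring

  slotWeight-nonNeg : ∀ {n} (s : Subset n) → 0ℚ ≤ slotWeight y s
  slotWeight-nonNeg []            = 0≤1
  slotWeight-nonNeg (inside  ∷ s) = *-nonNeg 0≤y (slotWeight-nonNeg s)
  slotWeight-nonNeg (outside ∷ s) = *-nonNeg 0≤1-y (slotWeight-nonNeg s)

  graphWeight-nonNeg : ∀ {n} (G : Graph n) → 0ℚ ≤ graphWeight y G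
  graphWeight-nonNeg []      = 0≤1
  graphWeight-nonNeg (s ∷ G) = *-nonNeg (slotWeight-nonNeg s) (graphWeight-nonNeg G)

  slotWeightOff-nonNeg : ∀ {n} (W s : Subset n) → 0ℚ ≤ slotWeightOff W y s
  slotWeightOff-nonNeg []            []            = 0≤1
  slotWeightOff-nonNeg (inside  ∷ W) (_       ∷ s) = slotWeightOff-nonNeg W s
  slotWeightOff-nonNeg (outside ∷ W) (inside  ∷ s) = *-nonNeg 0≤y (slotWeightOff-nonNeg W s)
  slotWeightOff-nonNeg (outside ∷ W) (outside ∷ s) = *-nonNeg 0≤1-y (slotWeightOff-nonNeg W s)

  graphWeightOff-nonNeg : ∀ {n} (W : Subset n) G → 0ℚ ≤ graphWeightOff W y G
  graphWeightOff-nonNeg []            []      = 0≤1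
  graphWeightOff-nonNeg (inside  ∷ W) (s ∷ G) = *-nonNeg (slotWeightOff-nonNeg W s) (graphWeightOff-nonNeg W G)
  graphWeightOff-nonNeg (outside ∷ W) (s ∷ G) = *-nonNeg (slotWeight-nonNeg s) (graphWeightOff-nonNeg W G)

  private
    pull : ∀ a e x → a * (e * x) ≡ e * (a * x)
    pull = solve-∀ ℚ-ring

  -- On positions in `W`, an edge supplies one factor of the power of `y`, and a non-edge gives up a
  -- factor `1 - y ≤ 1`. Elsewhere both sides carry the same factor.
  slotWeight-≤ : ∀ {n} (W s : Subset n) → slotWeight y s ≤ y ^ ∣ s ∩ W ∣ * slotWeightOff W y s
  slotWeight-≤ []            []            = ℚ.≤-refl
  slotWeight-≤ (inside ∷ W)  (inside ∷ s)  = ℚ.≤-trans (*-monoˡ-≤ 0≤y (slotWeight-≤ W s))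
    (ℚ.≤-reflexive (sym (ℚ.*-assoc y (y ^ ∣ s ∩ W ∣) _)))
  slotWeight-≤ (inside ∷ W)  (outside ∷ s) = ℚ.≤-trans
    (*-mono-≤-nonNeg (slotWeight-nonNeg s) 0≤1 1-y≤1 (slotWeight-≤ W s))
    (ℚ.≤-reflexive (ℚ.*-identityˡ _))
  slotWeight-≤ (outside ∷ W) (inside ∷ s)  = ℚ.≤-trans (*-monoˡ-≤ 0≤y (slotWeight-≤ W s))
    (ℚ.≤-reflexive (pull y (y ^ ∣ s ∩ W ∣) (slotWeightOff W y s)))
  slotWeight-≤ (outside ∷ W) (outside ∷ s) = ℚ.≤-trans (*-monoˡ-≤ 0≤1-y (slotWeight-≤ W s))
    (ℚ.≤-reflexive (pull (1ℚ - y) (y ^ ∣ s ∩ W ∣) (slotWeightOff W y s)))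

  graphWeight-≤ : ∀ {n} (W : Subset n) G → graphWeight y G ≤ y ^ edges G W * graphWeightOff W y G
  graphWeight-≤ []            []      = ℚ.≤-refl
  graphWeight-≤ (outside ∷ W) (s ∷ G) = ℚ.≤-trans
    (*-monoˡ-≤ (slotWeight-nonNeg s) (graphWeight-≤ W G))
    (ℚ.≤-reflexive (pull (slotWeight y s) (y ^ edges G W) (graphWeightOff W y G)))
  graphWeight-≤ (inside ∷ W)  (s ∷ G) = begin
    slotWeight y s * graphWeight y G
      ≤⟨ *-mono-≤-nonNeg (graphWeight-nonNeg G) (*-nonNeg (^-nonNeg d 0≤y) (slotWeightOff-nonNeg W s))
           (slotWeight-≤ W s) (graphWeight-≤ W G) ⟩
    (y ^ d * a) * (y ^ e * b)     ≡⟨ interchange (y ^ d) a (y ^ e) b ⟩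
    (y ^ d * y ^ e) * (a * b)     ≡⟨ cong (_* (a * b)) (^-homo-* y d e) ⟨
    y ^ (d ℕ.+ e) * (a * b)       ∎
    where
    open ℚ.≤-Reasoning
    d e : ℕ
    d = ∣ s ∩ W ∣
    e = edges G W
    a b : ℚ
    a = slotWeightOff W y s
    b = graphWeightOff W y G
    interchange : ∀ p q r s → (p * q) * (r * s) ≡ (p * r) * (q * s)
    interchange = solve-∀ ℚ-ring

  -- The union bound over dense sets.

  module _ (k E : ℕ) where

    private
      K M : ℕ
      K = suc k
      M = K ℕ.+ suc E

      inRange? : ∀ w → Dec (0 ℕ.< w × w ℕ.≤ M)
      inRange? w = (0 ℕ.<? w) ×-dec (w ℕ.≤? M)

    -- Bounds the probability that a given set of size w is dense, up to pairChoices w.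
    cost : ℕ → ℚ
    cost w with inRange? w
    ... | yes _ = y ^ (K ℕ.* order K E w)
    ... | no _  = 0ℚ

    cost-nonNeg : ∀ w → 0ℚ ≤ cost w
    cost-nonNeg w with inRange? w
    ... | yes _ = ^-nonNeg (K ℕ.* order K E w) 0≤y
    ... | no _  = ℚ.≤-refl

    cost-zero : ∀ w → suc M ℕ.≤ w → cost w ≡ 0ℚ
    cost-zero w M<w with inRange? w
    ... | yes (_ , w≤M) = contradiction w≤M (ℕ.<⇒≱ M<w)
    ... | no _          = refl

    graphWeight-dense : ∀ {n} (G : Graph n) W → Dense K E G W →
                        graphWeight y G ≤ cost ∣ W ∣ * graphWeightOff W y G
    graphWeight-dense G W (0<W , W≤M , dense) with inRange? ∣ W ∣
    ... | yes _ = ℚ.≤-trans (graphWeight-≤ W G)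
                    (*-monoʳ-≤ (graphWeightOff-nonNeg W G) (^-antimonoʳ-≤ 0≤y y≤1 dense))
    ... | no ∉  = contradiction (0<W , W≤M) ∉

    -- The total weight is 1. A graph that is not collapsible has a dense set `W`, and its weight is
    -- charged to the term of that `W`; after exchanging the sums, the relaxed weights add up to
    -- `pairChoices`.
    collapsible-probability : ∀ n →
      1ℚ ≤ sum (graphWeight y) (filter (λ G → collapsible? K (cliqueComplex G)) (graphs n))
           + sum (λ W → cost ∣ W ∣ * pairChoices ∣ W ∣) (subsets n)
    collapsible-probability n = begin
      1ℚ
        ≡⟨ sum-graphWeight n y ⟨
      sum (graphWeight y) (graphs n)
        ≤⟨ sum-filter-≤ (λ G → collapsible? K (cliqueComplex G)) (graphs n)
             (λ G → sum-nonNeg (subsets n) (term-nonNeg G)) bad ⟩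
      good + sum (λ G → sum (term G) (subsets n)) (graphs n)
        ≡⟨ cong (λ z → good + z) (sum-swap term (graphs n) (subsets n)) ⟩
      good + sum (λ W → sum (λ G → term G W) (graphs n)) (subsets n)
        ≡⟨ cong (λ z → good + z) (sum-cong (subsets n) λ W →
             trans (sum-*ˡ (cost ∣ W ∣) (graphWeightOff W y) (graphs n))
                   (cong (cost ∣ W ∣ *_) (sum-graphWeightOff W y))) ⟩
      good + sum (λ W → cost ∣ W ∣ * pairChoices ∣ W ∣) (subsets n) ∎
      where
      open ℚ.≤-Reasoning
      good : ℚ
      good = sum (graphWeight y) (filter (λ G → collapsible? K (cliqueComplex G)) (graphs n))
      term : Graph n → Subset n → ℚ
      term G W = cost ∣ W ∣ * graphWeightOff W y G
      term-nonNeg : ∀ G W → 0ℚ ≤ term G W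
      term-nonNeg G W = *-nonNeg (cost-nonNeg ∣ W ∣) (graphWeightOff-nonNeg W G)
      bad : ∀ G → ¬ Collapsible K (cliqueComplex G) → graphWeight y G ≤ sum (term G) (subsets n)
      bad G ¬c with collapsible-or-dense G k E
      ... | inj₁ c           = contradiction c ¬c
      ... | inj₂ (W , dense) = ℚ.≤-trans (graphWeight-dense G W dense)
                                 (sum-∈ {f = term G} (term-nonNeg G) (∈-subsets W))

    module _ (n : ℕ) {z : ℚ} (z≡ : frac n 0 * y ^ K ≡ z) (z≤1 : z ≤ 1ℚ)
             (z^E : frac n 0 ^ K * z ^ E ≤ 1ℚ) where

      private
        N : ℚ
        N = frac n 0
        0≤N : 0ℚ ≤ N
        0≤N = frac-nonNeg n 0
        0≤z : 0ℚ ≤ z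
        0≤z = subst (0ℚ ≤_) z≡ (*-nonNeg 0≤N (^-nonNeg K 0≤y))

      z-power : ∀ r → N ^ r * y ^ (K ℕ.* r) ≡ z ^ r
      z-power r = begin
        N ^ r * y ^ (K ℕ.* r)  ≡⟨ cong (N ^ r *_) (^-assocʳ y K r) ⟨
        N ^ r * (y ^ K) ^ r    ≡⟨ ^-distrib-* N (y ^ K) r ⟨
        (N * y ^ K) ^ r        ≡⟨ cong (_^ r) z≡ ⟩
        z ^ r                  ∎
        where open ≡-Reasoning

      -- Below the maximal size every vertex is paid for by `K` edges, which gives `z ^ w ≤ z`. At
      -- size `K + E + 1` only `E + 1` vertices are paid for; the remaining factor `N ^ K` is
      -- absorbed by `z ^ E`, and one `z` is left.
      cost-bound : ∀ w → N ^ w * cost w ≤ z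
      cost-bound w with inRange? w
      ... | no _ = subst (_≤ z) (sym (ℚ.*-zeroʳ (N ^ w))) 0≤z
      ... | yes (0<w , w≤M) with w ℕ.<? M
      ...   | yes w<M = begin
        N ^ w * y ^ (K ℕ.* order K E w)  ≡⟨ cong (λ r → N ^ w * y ^ (K ℕ.* r)) (order-< {K} {E} w<M) ⟩
        N ^ w * y ^ (K ℕ.* w)            ≡⟨ z-power w ⟩
        z ^ w                            ≤⟨ ^-antimonoʳ-≤ 0≤z z≤1 0<w ⟩
        z * 1ℚ                           ≡⟨ ℚ.*-identityʳ z ⟩
        z                                ∎
        where open ℚ.≤-Reasoning
      ...   | no w≮M = begin
        N ^ w * y ^ (K ℕ.* order K E w)  ≡⟨ cong (λ w → N ^ w * y ^ (K ℕ.* order K E w)) w≡M ⟩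
        N ^ M * y ^ (K ℕ.* order K E M)  ≡⟨ cong₂ (λ a r → a * y ^ (K ℕ.* r)) (^-homo-* N K (suc E)) (order-max K E) ⟩
        (N ^ K * N ^ suc E) * y ^ (K ℕ.* suc E)  ≡⟨ ℚ.*-assoc (N ^ K) (N ^ suc E) _ ⟩
        N ^ K * (N ^ suc E * y ^ (K ℕ.* suc E))  ≡⟨ cong (N ^ K *_) (z-power (suc E)) ⟩
        N ^ K * (z * z ^ E)              ≡⟨ pull′ (N ^ K) z (z ^ E) ⟩
        (N ^ K * z ^ E) * z              ≤⟨ *-monoʳ-≤ 0≤z z^E ⟩
        1ℚ * z                           ≡⟨ ℚ.*-identityˡ z ⟩
        z                                ∎
        where
        open ℚ.≤-Reasoning
        w≡M : w ≡ M
        w≡M = ℕ.≤-antisym w≤M (ℕ.≮⇒≥ w≮M)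
        pull′ : ∀ a b c → a * (b * c) ≡ (a * c) * b
        pull′ = solve-∀ ℚ-ring

      -- The sizes `0` to `M` number `suc M`, and each contributes at most `pairChoices M * z`.
      union-bound : sum (λ W → cost ∣ W ∣ * pairChoices ∣ W ∣) (subsets n)
                    ≤ frac (suc M) 0 * (pairChoices M * z)
      union-bound = begin
        sum (λ W → f ∣ W ∣) (subsets n)
          ≤⟨ sum-subsets-by-size n (suc M) f
               (λ w → *-nonNeg (cost-nonNeg w) (pairChoices-nonNeg w))
               (λ w M<w → trans (cong (_* pairChoices w) (cost-zero w M<w)) (ℚ.*-zeroˡ (pairChoices w))) ⟩
        horner N (suc M) f
          ≡⟨ ℚ.*-identityˡ _ ⟨
        1ℚ * horner N (suc M) f
          ≤⟨ horner-bound {N} {1ℚ} (suc M) f (λ w → bound-at w (w ℕ.≤? M)) ⟩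
        frac (suc M) 0 * (pairChoices M * z) ∎
        where
        open ℚ.≤-Reasoning
        f : ℕ → ℚ
        f w = cost w * pairChoices w
        bound-at : ∀ w → Dec (w ℕ.≤ M) → 1ℚ * N ^ w * f w ≤ pairChoices M * z
        bound-at w (yes w≤M) = begin
          1ℚ * N ^ w * f w                  ≡⟨ e (N ^ w) (cost w) (pairChoices w) ⟩
          pairChoices w * (N ^ w * cost w)  ≤⟨ *-mono-≤-nonNeg (*-nonNeg (^-nonNeg w 0≤N) (cost-nonNeg w))
                                                 (pairChoices-nonNeg M) (pairChoices-mono w≤M) (cost-bound w) ⟩
          pairChoices M * z                 ∎
          where
          e : ∀ a b c → 1ℚ * a * (b * c) ≡ c * (a * b)
          e = solve-∀ ℚ-ring
        bound-at w (no w≰M) = subst (_≤ pairChoices M * z)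
          (sym (trans (cong (λ c → 1ℚ * N ^ w * (c * pairChoices w)) (cost-zero w (ℕ.≰⇒> w≰M)))
                      (e (N ^ w) (pairChoices w))))
          (*-nonNeg (pairChoices-nonNeg M) 0≤z)
          where
          e : ∀ a c → 1ℚ * a * (0ℚ * c) ≡ 0ℚ
          e = solve-∀ ℚ-ring

-- Bounds on rational powers with the roots cleared.

toℚᵘ-frac : ∀ m i → ℚ.toℚᵘ (frac m i) ℚᵘ.≃ ℚᵘ.mkℚᵘ (+ m) i
toℚᵘ-frac m i = ℚ.toℚᵘ-fromℚᵘ (ℚᵘ.mkℚᵘ (+ m) i)

frac-mono : ∀ {m n} i → m ℕ.≤ n → frac m i ≤ frac n i
frac-mono {m} {n} i m≤n = ℚ.toℚᵘ-cancel-≤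
  (ℚᵘ.≤-respˡ-≃ (ℚᵘ.≃-sym (toℚᵘ-frac m i)) (ℚᵘ.≤-respʳ-≃ (ℚᵘ.≃-sym (toℚᵘ-frac n i))
    (ℚᵘ.*≤* (ℤ.*-monoʳ-≤-nonNeg (+ suc i) (ℤ.+≤+ m≤n)))))

frac-* : ∀ m i n → frac m i * frac n 0 ≡ frac (m ℕ.* n) i
frac-* m i n = ℚ.toℚᵘ-injective (ℚᵘ.≃-trans (ℚ.toℚᵘ-homo-* (frac m i) (frac n 0))
  (ℚᵘ.≃-trans (ℚᵘ.*-cong (toℚᵘ-frac m i) (toℚᵘ-frac n 0))
  (ℚᵘ.≃-trans (ℚᵘ.*≡* (trans (e (+ m) (+ n) (+ suc i))
      (cong (ℤ._* (+ suc i ℤ.* + 1)) (sym (ℤ.pos-* m n)))))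
    (ℚᵘ.≃-sym (toℚᵘ-frac (m ℕ.* n) i)))))
  where
  e : ∀ x y z → x ℤ.* y ℤ.* z ≡ x ℤ.* y ℤ.* (z ℤ.* + 1)
  e = ℤ-Solver.solve-∀

frac-cancel : ∀ m i → frac m i * frac (suc i) 0 ≡ frac m 0
frac-cancel m i = trans (frac-* m i (suc i)) (ℚ.toℚᵘ-injective
  (ℚᵘ.≃-trans (toℚᵘ-frac (m ℕ.* suc i) i)
  (ℚᵘ.≃-trans (ℚᵘ.*≡* (trans (ℤ.*-identityʳ _) (ℤ.pos-* m (suc i))))
    (ℚᵘ.≃-sym (toℚᵘ-frac m 0)))))

frac-^ : ∀ m j → frac (m ℕ.^ j) 0 ≡ frac m 0 ^ j
frac-^ m zero    = refl
frac-^ m (suc j) = trans (sym (frac-* m 0 (m ℕ.^ j))) (cong (frac m 0 *_) (frac-^ m j))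

frac-pos : ∀ m i → 0ℚ < frac (suc m) i
frac-pos m i = ℚ.positive⁻¹ (frac (suc m) i) {{ℚ.normalize-pos (suc m) (suc i)}}

^-pos : ∀ {a} n → 0ℚ < a → 0ℚ < a ^ n
^-pos         zero    0<a = ℚ.positive⁻¹ 1ℚ
^-pos {a} (suc n) 0<a = ℚ.positive⁻¹ (a * a ^ n)
  {{ℚ.pos*pos⇒pos a {{ℚ.positive 0<a}} (a ^ n) {{ℚ.positive (^-pos n 0<a)}}}}

-- Clears the denominators. The numerator of `q` must be negative, so `RootBelow` puts the power of
-- `n` on the side of the root.
exponent-bound : ∀ k e q → q ≤ - frac 1 k - frac 1 e →
  ∃[ a ] (ℚ.↥ q ≡ -[1+ a ] × (suc k ℕ.+ suc e) ℕ.* ↧ₙ q ℕ.≤ suc a ℕ.* (suc k ℕ.* suc e))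
exponent-bound k e q@(mkℚ s d _) h = negative s cross
  where
  hᵘ : ℚᵘ.mkℚᵘ s d ℚᵘ.≤ (ℚᵘ.- ℚᵘ.mkℚᵘ (+ 1) k) ℚᵘ.+ (ℚᵘ.- ℚᵘ.mkℚᵘ (+ 1) e)
  hᵘ = ℚᵘ.≤-respʳ-≃ (ℚᵘ.≃-trans (ℚ.toℚᵘ-homo-+ (- frac 1 k) (- frac 1 e))
    (ℚᵘ.+-cong (ℚᵘ.≃-trans (ℚ.toℚᵘ-homo‿- (frac 1 k)) (ℚᵘ.-‿cong (toℚᵘ-frac 1 k)))
               (ℚᵘ.≃-trans (ℚ.toℚᵘ-homo‿- (frac 1 e)) (ℚᵘ.-‿cong (toℚᵘ-frac 1 e)))))
    (ℚ.toℚᵘ-mono-≤ h)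
  rhs : ∀ K E D → (ℤ.- (+ 1) ℤ.* E ℤ.+ ℤ.- (+ 1) ℤ.* K) ℤ.* D ≡ ℤ.- ((K ℤ.+ E) ℤ.* D)
  rhs = ℤ-Solver.solve-∀
  cross : s ℤ.* + (suc k ℕ.* suc e) ℤ.≤ ℤ.- (+ ((suc k ℕ.+ suc e) ℕ.* suc d))
  cross with hᵘ
  ... | ℚᵘ.*≤* le = subst (s ℤ.* + (suc k ℕ.* suc e) ℤ.≤_)
    (trans (rhs (+ suc k) (+ suc e) (+ suc d))
           (cong ℤ.-_ (sym (ℤ.pos-* (suc k ℕ.+ suc e) (suc d))))) le
  negative : ∀ s → s ℤ.* + (suc k ℕ.* suc e) ℤ.≤ ℤ.- (+ ((suc k ℕ.+ suc e) ℕ.* suc d)) →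
    ∃[ a ] (s ≡ -[1+ a ] × (suc k ℕ.+ suc e) ℕ.* suc d ℕ.≤ suc a ℕ.* (suc k ℕ.* suc e))
  negative (+ m) c = contradiction
    (subst (ℤ._≤ -[1+ _ ]) (sym (ℤ.pos-* m (suc k ℕ.* suc e))) c) λ ()
  negative -[1+ a ] c = a , refl , ℤ.drop‿+≤+ (ℤ.neg-cancel-≤ c)

-- n ^ q ≤ n ^ (- 1 / K - 1 / E), with the roots cleared.
approxPow-bound : ∀ n .{{_ : NonZero n}} k e q i → q ≤ - frac 1 k - frac 1 e →
  approxPow n q i ^ (suc k ℕ.* suc e) * frac n 0 ^ (suc k ℕ.+ suc e) ≤ 1ℚ
approxPow-bound n k e q i h = ℚ.*-cancelʳ-≤-pos (L ^ J) {{ℚ.positive (^-pos J (frac-pos i 0))}} (begin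
  x ^ J * N ^ R * L ^ J                 ≡⟨ swap (x ^ J) (N ^ R) (L ^ J) ⟩
  x ^ J * L ^ J * N ^ R                 ≡⟨ cong (_* N ^ R) (^-distrib-* x L J) ⟨
  (x * L) ^ J * N ^ R                   ≡⟨ cong (λ a → a ^ J * N ^ R) (frac-cancel m i) ⟩
  frac m 0 ^ J * N ^ R                  ≡⟨ cong₂ _*_ (frac-^ m J) (frac-^ n R) ⟨
  frac (m ℕ.^ J) 0 * frac (n ℕ.^ R) 0   ≡⟨ frac-* (m ℕ.^ J) 0 (n ℕ.^ R) ⟩
  frac (m ℕ.^ J ℕ.* n ℕ.^ R) 0          ≤⟨ frac-mono 0 (nat q h (rootNumerator-below n q (suc i))) ⟩
  frac (suc i ℕ.^ J) 0                  ≡⟨ frac-^ (suc i) J ⟩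
  L ^ J                                 ≡⟨ ℚ.*-identityˡ (L ^ J) ⟨
  1ℚ * L ^ J                            ∎)
  where
  open ℚ.≤-Reasoning
  J R m : ℕ
  J = suc k ℕ.* suc e
  R = suc k ℕ.+ suc e
  m = rootNumerator n q (suc i)
  x N L : ℚ
  x = approxPow n q i
  N = frac n 0
  L = frac (suc i) 0
  swap : ∀ a b c → a * b * c ≡ a * c * b
  swap = solve-∀ ℚ-ring
  nat : ∀ q → q ≤ - frac 1 k - frac 1 e → RootBelow n q (suc i) m →
        m ℕ.^ J ℕ.* n ℕ.^ R ℕ.≤ suc i ℕ.^ J
  nat q@(mkℚ s d _) h below with exponent-bound k e q h
  ... | a , refl , R≤ = ^-cancelʳ-≤ (suc d) (ℕR.begin
    (m ℕ.^ J ℕ.* n ℕ.^ R) ℕ.^ suc d            ℕR.≡⟨ raise m n J R (suc d) ⟩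
    m ℕ.^ (J ℕ.* suc d) ℕ.* n ℕ.^ (R ℕ.* suc d)
      ℕR.≤⟨ ℕ.*-monoʳ-≤ (m ℕ.^ (J ℕ.* suc d)) (ℕ.^-monoʳ-≤ n R≤) ⟩
    m ℕ.^ (J ℕ.* suc d) ℕ.* n ℕ.^ (suc a ℕ.* J)
      ℕR.≡⟨ cong (λ o → m ℕ.^ o ℕ.* n ℕ.^ (suc a ℕ.* J)) (ℕ.*-comm J (suc d)) ⟩
    m ℕ.^ (suc d ℕ.* J) ℕ.* n ℕ.^ (suc a ℕ.* J) ℕR.≡⟨ raise m n (suc d) (suc a) J ⟨
    (m ℕ.^ suc d ℕ.* n ℕ.^ suc a) ℕ.^ J        ℕR.≤⟨ ℕ.^-monoˡ-≤ J below ⟩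
    (1 ℕ.* suc i ℕ.^ suc d) ℕ.^ J              ℕR.≡⟨ cong (ℕ._^ J) (ℕ.*-identityˡ (suc i ℕ.^ suc d)) ⟩
    (suc i ℕ.^ suc d) ℕ.^ J                    ℕR.≡⟨ ℕ.^-*-assoc (suc i) (suc d) J ⟩
    suc i ℕ.^ (suc d ℕ.* J)                    ℕR.≡⟨ cong (suc i ℕ.^_) (ℕ.*-comm (suc d) J) ⟩
    suc i ℕ.^ (J ℕ.* suc d)                    ℕR.≡⟨ ℕ.^-*-assoc (suc i) J (suc d) ⟨
    (suc i ℕ.^ J) ℕ.^ suc d                    ℕR.∎)
    where
    module ℕR = ℕ.≤-Reasoning
    raise : ∀ x y i j o → (x ℕ.^ i ℕ.* y ℕ.^ j) ℕ.^ o ≡ x ℕ.^ (i ℕ.* o) ℕ.* y ℕ.^ (j ℕ.* o)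
    raise x y i j o = trans (^-distribʳ-* (x ℕ.^ i) (y ℕ.^ j) o)
                            (cong₂ ℕ._*_ (ℕ.^-*-assoc x i o) (ℕ.^-*-assoc y j o))

-- Equality of Cauchy reals, and clamping.

infix 4 _≈ʳ_

-- Equality as real numbers. It allows the terms of an edge probability to be altered at the cost of
-- an arbitrarily small change in the probabilities computed from it.
_≈ʳ_ : ℝ → ℝ → Set
x ≈ʳ y = ∀ δ → 0ℚ < δ → ∃[ N ] (∀ i → N ℕ.≤ i → ℚ.∣ seq x i - seq y i ∣ ≤ δ)

∣p-p∣≤ : ∀ a {δ} → 0ℚ < δ → ℚ.∣ a - a ∣ ≤ δ
∣p-p∣≤ a {δ} 0<δ = subst (λ z → ℚ.∣ z ∣ ≤ δ) (sym (ℚ.+-inverseʳ a)) (ℚ.<⇒≤ 0<δ)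

≈ʳ-refl : ∀ x → x ≈ʳ x
≈ʳ-refl x δ 0<δ = 0 , λ i _ → ∣p-p∣≤ (seq x i) 0<δ

∣∣-triangle : ∀ a b c d {α β} → ℚ.∣ a - c ∣ ≤ α → ℚ.∣ b - d ∣ ≤ β → ℚ.∣ (a + b) - (c + d) ∣ ≤ α + β
∣∣-triangle a b c d {α} {β} h₁ h₂ = begin
  ℚ.∣ (a + b) - (c + d) ∣           ≡⟨ cong ℚ.∣_∣ (e a b c d) ⟩
  ℚ.∣ (a - c) + (b - d) ∣           ≤⟨ ℚ.∣p+q∣≤∣p∣+∣q∣ (a - c) (b - d) ⟩
  ℚ.∣ a - c ∣ + ℚ.∣ b - d ∣         ≤⟨ ℚ.+-mono-≤ h₁ h₂ ⟩
  α + β                             ∎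
  where
  open ℚ.≤-Reasoning
  e : ∀ a b c d → (a + b) - (c + d) ≡ (a - c) + (b - d)
  e = solve-∀ ℚ-ring

+ʳ-cong : ∀ x x′ y y′ → x ≈ʳ x′ → y ≈ʳ y′ → x +ʳ y ≈ʳ x′ +ʳ y′
+ʳ-cong x x′ y y′ hx hy δ 0<δ with hx (½ * δ) (half>0 0<δ) | hy (½ * δ) (half>0 0<δ)
... | L , hx | M , hy = L ⊔ M , λ i i≥ →
  subst (ℚ.∣ (seq x i + seq y i) - (seq x′ i + seq y′ i) ∣ ≤_) (half+half δ)
    (∣∣-triangle (seq x i) (seq y i) (seq x′ i) (seq y′ i)
      (hx i (ℕ.m⊔n≤o⇒m≤o L M i≥)) (hy i (ℕ.m⊔n≤o⇒n≤o L M i≥)))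

-ʳ-cong : ∀ x x′ → x ≈ʳ x′ → -ʳ x ≈ʳ -ʳ x′
-ʳ-cong x x′ hx δ 0<δ with hx δ 0<δ
... | L , hx = L , λ i i≥ → subst (_≤ δ)
  (trans (sym (ℚ.∣-p∣≡∣p∣ (seq x i - seq x′ i))) (cong ℚ.∣_∣ (e (seq x i) (seq x′ i)))) (hx i i≥)
  where
  e : ∀ a b → - (a - b) ≡ - a - - b
  e = solve-∀ ℚ-ring

*ʳ-cong : ∀ x x′ y y′ → x ≈ʳ x′ → y ≈ʳ y′ → x *ʳ y ≈ʳ x′ *ʳ y′
*ʳ-cong x x′ y y′ hx hy δ 0<δ = go (bound x) (bound y′)
  where
  Bounded : ℝ → Set
  Bounded z = ∃[ B ] (0ℚ < B × ∃[ N ] (∀ i → N ℕ.≤ i → ℚ.∣ seq z i ∣ ≤ B))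

  Conclusion : Set
  Conclusion = ∃[ N ] (∀ i → N ℕ.≤ i → ℚ.∣ seq x i * seq y i - seq x′ i * seq y′ i ∣ ≤ δ)

  combine : ∀ A B α β → A * α ≡ ½ * δ → B * β ≡ ½ * δ →
            ∃[ N ] (∀ i → N ℕ.≤ i → ℚ.∣ seq x i ∣ ≤ A) →
            ∃[ N ] (∀ i → N ℕ.≤ i → ℚ.∣ seq y′ i ∣ ≤ B) →
            ∃[ N ] (∀ i → N ℕ.≤ i → ℚ.∣ seq y i - seq y′ i ∣ ≤ α) →
            ∃[ N ] (∀ i → N ℕ.≤ i → ℚ.∣ seq x i - seq x′ i ∣ ≤ β) → Conclusion
  combine A B α β Aα Bβ (L₁ , x≤A) (L₂ , y′≤B) (L₃ , hy) (L₄ , hx) =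
    (L₁ ⊔ L₂) ⊔ (L₃ ⊔ L₄) , λ i i≥ →
    let i≥₁₂ = ℕ.m⊔n≤o⇒m≤o (L₁ ⊔ L₂) (L₃ ⊔ L₄) i≥
        i≥₃₄ = ℕ.m⊔n≤o⇒n≤o (L₁ ⊔ L₂) (L₃ ⊔ L₄) i≥ in
    subst (ℚ.∣ seq x i * seq y i - seq x′ i * seq y′ i ∣ ≤_) (trans (cong₂ _+_ Aα Bβ) (half+half δ))
      (*-close (seq x i) (seq y i) (seq x′ i) (seq y′ i) A B α β
        (x≤A i (ℕ.m⊔n≤o⇒m≤o L₁ L₂ i≥₁₂)) (y′≤B i (ℕ.m⊔n≤o⇒n≤o L₁ L₂ i≥₁₂))
        (hy i (ℕ.m⊔n≤o⇒m≤o L₃ L₄ i≥₃₄)) (hx i (ℕ.m⊔n≤o⇒n≤o L₃ L₄ i≥₃₄)))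

  choose : ∀ A B → ∃[ N ] (∀ i → N ℕ.≤ i → ℚ.∣ seq x i ∣ ≤ A) →
           ∃[ N ] (∀ i → N ℕ.≤ i → ℚ.∣ seq y′ i ∣ ≤ B) →
           ∃[ α ] (0ℚ < α × A * α ≡ ½ * δ) → ∃[ β ] (0ℚ < β × B * β ≡ ½ * δ) → Conclusion
  choose A B x≤A y′≤B (α , 0<α , Aα) (β , 0<β , Bβ) =
    combine A B α β Aα Bβ x≤A y′≤B (hy α 0<α) (hx β 0<β)

  go : Bounded x → Bounded y′ → Conclusion
  go (A , 0<A , x≤A) (B , 0<B , y′≤B) =
    choose A B x≤A y′≤B (scaled A 0<A (½ * δ) (half>0 0<δ)) (scaled B 0<B (½ * δ) (half>0 0<δ))

module _ (p p′ : ℝ) (p≈ : p ≈ʳ p′) where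

  slots-cong : ∀ {n} (s : Subset n) → slots p s ≈ʳ slots p′ s
  slots-cong []            = ≈ʳ-refl 1ʳ
  slots-cong (inside  ∷ s) = *ʳ-cong p p′ (slots p s) (slots p′ s) p≈ (slots-cong s)
  slots-cong (outside ∷ s) = *ʳ-cong (1ʳ -ʳ p) (1ʳ -ʳ p′) (slots p s) (slots p′ s)
    (+ʳ-cong 1ʳ 1ʳ (-ʳ p) (-ʳ p′) (≈ʳ-refl 1ʳ) (-ʳ-cong p p′ p≈)) (slots-cong s)

  weight-cong : ∀ {n} (G : Graph n) → weight p G ≈ʳ weight p′ G
  weight-cong []      = ≈ʳ-refl 1ʳ
  weight-cong (s ∷ G) = *ʳ-cong (slots p s) (slots p′ s) (weight p G) (weight p′ G)
    (slots-cong s) (weight-cong G)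

  Σʳ-weight-cong : ∀ {n} (Gs : List (Graph n)) →
                   Σʳ (List.map (weight p) Gs) ≈ʳ Σʳ (List.map (weight p′) Gs)
  Σʳ-weight-cong []       = ≈ʳ-refl 0ʳ
  Σʳ-weight-cong (G ∷ Gs) = +ʳ-cong (weight p G) (weight p′ G)
    (Σʳ (List.map (weight p) Gs)) (Σʳ (List.map (weight p′) Gs)) (weight-cong G) (Σʳ-weight-cong Gs)

module _ (p : ℝ) (i : ℕ) where

  seq-slots : ∀ {n} (s : Subset n) → seq (slots p s) i ≡ slotWeight (seq p i) s
  seq-slots []            = refl
  seq-slots (inside  ∷ s) = cong (seq p i *_) (seq-slots s)
  seq-slots (outside ∷ s) = cong ((1ℚ - seq p i) *_) (seq-slots s)

  seq-weight : ∀ {n} (G : Graph n) → seq (weight p G) i ≡ graphWeight (seq p i) G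
  seq-weight []      = refl
  seq-weight (s ∷ G) = cong₂ _*_ (seq-slots s) (seq-weight G)

  -- The real operations act termwise, so the rational estimates apply index by index with edge
  -- probability `seq p i`.
  seq-Σʳ-weight : ∀ {n} (Gs : List (Graph n)) →
                  seq (Σʳ (List.map (weight p) Gs)) i ≡ sum (graphWeight (seq p i)) Gs
  seq-Σʳ-weight []       = refl
  seq-Σʳ-weight (G ∷ Gs) = cong₂ _+_ (seq-weight G) (seq-Σʳ-weight Gs)

-- Half of `δ` pays for the tail of `x`, and a quarter for each of the two passages between `x` and
-- `s`.
near-cauchy : ∀ (x : ℝ) s → (∀ δ → 0ℚ < δ → ∃[ N ] (∀ i → N ℕ.≤ i → ℚ.∣ seq x i - s i ∣ ≤ δ)) →
              ∀ δ → 0ℚ < δ → TailWithin s δ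
near-cauchy x s near δ 0<δ with near (½ * (½ * δ)) (half>0 (half>0 0<δ)) | cauchy x (½ * δ) (half>0 0<δ)
... | L , near | M , close = L ⊔ M , λ i j i≥ j≥ → begin
  ℚ.∣ s i - s j ∣
    ≡⟨ cong ℚ.∣_∣ (e (s i) (s j) (seq x i) (seq x j)) ⟩
  ℚ.∣ (seq x i - seq x j) + ((seq x j - s j) - (seq x i - s i)) ∣
    ≤⟨ ℚ.∣p+q∣≤∣p∣+∣q∣ (seq x i - seq x j) _ ⟩
  ℚ.∣ seq x i - seq x j ∣ + ℚ.∣ (seq x j - s j) - (seq x i - s i) ∣
    ≤⟨ ℚ.+-mono-≤ (close i j (ℕ.m⊔n≤o⇒n≤o L M i≥) (ℕ.m⊔n≤o⇒n≤o L M j≥))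
         (ℚ.≤-trans (ℚ.∣p-q∣≤∣p∣+∣q∣ (seq x j - s j) (seq x i - s i))
           (ℚ.+-mono-≤ (near j (ℕ.m⊔n≤o⇒m≤o L M j≥)) (near i (ℕ.m⊔n≤o⇒m≤o L M i≥)))) ⟩
  ½ * δ + (½ * (½ * δ) + ½ * (½ * δ))   ≡⟨ cong (λ z → ½ * δ + z) (half+half (½ * δ)) ⟩
  ½ * δ + ½ * δ                         ≡⟨ half+half δ ⟩
  δ                                     ∎
  where
  open ℚ.≤-Reasoning
  e : ∀ a b c d → a - b ≡ (c - d) + ((d - b) - (c - a))
  e = solve-∀ ℚ-ring

-- The terms of a real between 0 and x may leave that interval; clamping moves them back.
module _ (p x : ℝ) (0≤p : 0ʳ ≤ʳ p) (p≤x : p ≤ʳ x) (0≤x : ∀ i → 0ℚ ≤ seq x i) where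

  private
    clampSeq : ℕ → ℚ
    clampSeq i = 0ℚ ℚ.⊔ (seq p i ℚ.⊓ seq x i)

    near-clamp : ∀ δ → 0ℚ < δ → ∃[ N ] (∀ i → N ℕ.≤ i → ℚ.∣ seq p i - clampSeq i ∣ ≤ δ)
    near-clamp δ 0<δ with 0≤p δ 0<δ | p≤x δ 0<δ
    ... | L , 0≤p+δ | M , p≤x+δ = L ⊔ M , λ i i≥ → one-sided
      (ℚ.≤-trans (p≤⊓+δ i (p≤x+δ i (ℕ.m⊔n≤o⇒n≤o L M i≥)))
        (ℚ.+-monoˡ-≤ δ (ℚ.p≤q⊔p 0ℚ (seq p i ℚ.⊓ seq x i))))
      (ℚ.⊔-lub (0≤p+δ i (ℕ.m⊔n≤o⇒m≤o L M i≥))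
        (ℚ.≤-trans (ℚ.p⊓q≤p (seq p i) (seq x i)) (≤-+ʳ (ℚ.<⇒≤ 0<δ))))
      where
      p≤⊓+δ : ∀ i → seq p i ≤ seq x i + δ → seq p i ≤ (seq p i ℚ.⊓ seq x i) + δ
      p≤⊓+δ i h with ℚ.⊓-sel (seq p i) (seq x i)
      ... | inj₁ e = subst (λ z → seq p i ≤ z + δ) (sym e) (≤-+ʳ (ℚ.<⇒≤ 0<δ))
      ... | inj₂ e = subst (λ z → seq p i ≤ z + δ) (sym e) h

  clamp : ℝ
  clamp = mkℝ clampSeq (near-cauchy p clampSeq near-clamp)

  clamp-≈ : p ≈ʳ clamp
  clamp-≈ = near-clamp

  clamp-nonNeg : ∀ i → 0ℚ ≤ seq clamp i
  clamp-nonNeg i = ℚ.p≤p⊔q 0ℚ (seq p i ℚ.⊓ seq x i)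

  clamp-≤ : ∀ i → seq clamp i ≤ seq x i
  clamp-≤ i = ℚ.⊔-lub (0≤x i) (ℚ.p⊓q≤q (seq p i) (seq x i))

-- Decay of the expected number of dense sets.

1≤frac : ∀ n .{{_ : NonZero n}} → 1ℚ ≤ frac n 0
1≤frac n = frac-mono 0 (ℕ.>-nonZero⁻¹ n)

a≤a*b : ∀ {a b} → 0ℚ ≤ a → 1ℚ ≤ b → a ≤ a * b
a≤a*b {a} {b} 0≤a 1≤b = subst (_≤ a * b) (ℚ.*-identityʳ a) (*-monoˡ-≤ 0≤a 1≤b)

module _ (n : ℕ) .{{_ : NonZero n}} (k e : ℕ) {x y : ℚ}
         (x-bound : x ^ (suc k ℕ.* suc e) * frac n 0 ^ (suc k ℕ.+ suc e) ≤ 1ℚ)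
         (0≤y : 0ℚ ≤ y) (y≤x : y ≤ x) where

  private
    K E : ℕ
    K = suc k
    E = suc e
    N z : ℚ
    N = frac n 0
    z = N * y ^ K

    1≤N : 1ℚ ≤ N
    1≤N = 1≤frac n
    0≤N : 0ℚ ≤ N
    0≤N = frac-nonNeg n 0
    0≤z : 0ℚ ≤ z
    0≤z = *-nonNeg 0≤N (^-nonNeg K 0≤y)

    y-bound : y ^ (K ℕ.* E) * N ^ (K ℕ.+ E) ≤ 1ℚ
    y-bound = ℚ.≤-trans (*-monoʳ-≤ (^-nonNeg (K ℕ.+ E) 0≤N) (^-mono-≤ (K ℕ.* E) 0≤y y≤x)) x-bound

  edge-probability≤1 : y ≤ 1ℚ
  -- The successor of this exponent is `K * E` by computation.
  edge-probability≤1 = ^-cancel-≤1 (e ℕ.+ k ℕ.* suc e)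
    (ℚ.≤-trans (a≤a*b (^-nonNeg (K ℕ.* E) 0≤y) (^-≥1 (K ℕ.+ E) 1≤N)) y-bound)

  -- The factor `N ^ E` joins `y ^ (K * E)` to form `z ^ E`, and `N ^ K` is left over.
  z^E-bound : N ^ K * z ^ E ≤ 1ℚ
  z^E-bound = subst (_≤ 1ℚ) (begin
    y ^ (K ℕ.* E) * N ^ (K ℕ.+ E)   ≡⟨ cong₂ _*_ (sym (^-assocʳ y K E)) (^-homo-* N K E) ⟩
    (y ^ K) ^ E * (N ^ K * N ^ E)   ≡⟨ rearrange ((y ^ K) ^ E) (N ^ K) (N ^ E) ⟩
    N ^ K * (N ^ E * (y ^ K) ^ E)   ≡⟨ cong (N ^ K *_) (^-distrib-* N (y ^ K) E) ⟨
    N ^ K * z ^ E                   ∎) y-bound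
    where
    open ≡-Reasoning
    rearrange : ∀ a b c → a * (b * c) ≡ b * (c * a)
    rearrange = solve-∀ ℚ-ring

  z≤1 : z ≤ 1ℚ
  z≤1 = ^-cancel-≤1 e (ℚ.≤-trans (a≤a*b (^-nonNeg E 0≤z) (^-≥1 K 1≤N))
    (subst (_≤ 1ℚ) (ℚ.*-comm (N ^ K) (z ^ E)) z^E-bound))

  -- With `G = suc g`, the chain `(z * G) ^ E ≤ z ^ E * N ≤ z ^ E * N ^ K ≤ 1` forces `z * G ≤
  -- 1`. This makes `z` tend to 0 as `n` grows.
  z-small : ∀ g → suc g ℕ.^ E ℕ.≤ n → z ≤ frac 1 g
  z-small g g^E≤n = begin
    z                              ≡⟨ ℚ.*-identityʳ z ⟨
    z * 1ℚ                         ≡⟨ cong (z *_) (frac-cancel 1 g) ⟨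
    z * (frac 1 g * frac (suc g) 0)  ≡⟨ rearrange z (frac 1 g) (frac (suc g) 0) ⟩
    z * frac (suc g) 0 * frac 1 g  ≤⟨ *-monoʳ-≤ (frac-nonNeg 1 g) zg≤1 ⟩
    1ℚ * frac 1 g                  ≡⟨ ℚ.*-identityˡ (frac 1 g) ⟩
    frac 1 g                       ∎
    where
    open ℚ.≤-Reasoning
    rearrange : ∀ a b c → a * (b * c) ≡ a * c * b
    rearrange = solve-∀ ℚ-ring
    N≤N^K : N ≤ N ^ K
    N≤N^K = a≤a*b 0≤N (^-≥1 k 1≤N)
    zg≤1 : z * frac (suc g) 0 ≤ 1ℚ
    zg≤1 = ^-cancel-≤1 e (begin
      (z * frac (suc g) 0) ^ E        ≡⟨ ^-distrib-* z (frac (suc g) 0) E ⟩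
      z ^ E * frac (suc g) 0 ^ E      ≡⟨ cong (z ^ E *_) (frac-^ (suc g) E) ⟨
      z ^ E * frac (suc g ℕ.^ E) 0    ≤⟨ *-monoˡ-≤ (^-nonNeg E 0≤z) (ℚ.≤-trans (frac-mono 0 g^E≤n) N≤N^K) ⟩
      z ^ E * N ^ K                   ≡⟨ ℚ.*-comm (z ^ E) (N ^ K) ⟩
      N ^ K * z ^ E                   ≤⟨ z^E-bound ⟩
      1ℚ                              ∎)

  collapsible-likely : ∀ g C → suc g ℕ.^ E ℕ.≤ n →
    frac (suc (K ℕ.+ suc E)) 0 * pairChoices (K ℕ.+ suc E) ≤ C →
    1ℚ ≤ sum (graphWeight y) (filter (λ G → collapsible? K (cliqueComplex G)) (graphs n)) + C * frac 1 g
  collapsible-likely g C g^E≤n ≤C = begin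
    1ℚ                                ≤⟨ collapsible-probability 0≤y edge-probability≤1 k E n ⟩
    good + _                          ≤⟨ ℚ.+-monoʳ-≤ good (union-bound 0≤y edge-probability≤1 k E n refl z≤1 z^E-bound) ⟩
    good + (a * (b * z))              ≡⟨ cong (λ z → good + z) (ℚ.*-assoc a b z) ⟨
    good + (a * b * z)                ≤⟨ ℚ.+-monoʳ-≤ good (*-mono-≤-nonNeg 0≤z
                                           (ℚ.≤-trans (*-nonNeg (frac-nonNeg (suc (K ℕ.+ suc E)) 0) (pairChoices-nonNeg (K ℕ.+ suc E))) ≤C)
                                           ≤C (z-small g g^E≤n)) ⟩
    good + C * frac 1 g               ∎
    where
    open ℚ.≤-Reasoning
    good a b : ℚ
    good = sum (graphWeight y) (filter (λ G → collapsible? K (cliqueComplex G)) (graphs n))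
    a = frac (suc (K ℕ.+ suc E)) 0
    b = pairChoices (K ℕ.+ suc E)

-- Convergence of the probability to 1.

Eventually : (ℕ → Set) → Set
Eventually P = ∃[ I ] (∀ i → I ℕ.≤ i → P i)

module _ (k e : ℕ) where

  private
    M : ℕ
    M = suc k ℕ.+ suc (suc e)

  badSets : ℚ
  badSets = frac (suc M) 0 * pairChoices M

  -- The constant will be divided by, so it has to be positive; after adding 1, nonnegativity of
  -- `badSets` is enough.
  badSets+1>0 : 0ℚ < badSets + 1ℚ
  badSets+1>0 = ℚ.+-mono-≤-< (*-nonNeg (frac-nonNeg (suc M) 0) (pairChoices-nonNeg M)) (ℚ.positive⁻¹ 1ℚ)

  -- The terms of `p` may leave the range where weights are nonnegative, so `p` is first clamped
  -- between 0 and the terms of `n ^ʳ r`. This costs one `η` in each direction; the failure bound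
  -- costs the second `η` in the lower estimate.
  Pr-near-1 : ∀ n .{{_ : NonZero n}} (p r : ℝ) → 0ʳ ≤ʳ p → p ≤ʳ n ^ʳ r →
    Eventually (λ i → seq r i ≤ - frac 1 k - frac 1 e) →
    ∀ g η → 0ℚ < η → suc g ℕ.^ suc e ℕ.≤ n → (badSets + 1ℚ) * frac 1 g ≤ η →
    Eventually (λ i → 1ℚ ≤ seq Pr[X⟨ n , p ⟩∈ collapsible? (suc k) ] i + (η + η)
                    × seq Pr[X⟨ n , p ⟩∈ collapsible? (suc k) ] i ≤ 1ℚ + η)
  Pr-near-1 n p r 0≤p p≤ (I , r≤) g η 0<η g^E≤n small = go (Σʳ-weight-cong p p′ p≈p′ Gs η 0<η)
    where
    Gs : List (Graph n)
    Gs = filter (λ G → collapsible? (suc k) (cliqueComplex G)) (graphs n)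
    0≤x : ∀ i → 0ℚ ≤ seq (n ^ʳ r) i
    0≤x i = frac-nonNeg (rootNumerator n (seq r i) (suc i)) i
    p′ : ℝ
    p′ = clamp p (n ^ʳ r) 0≤p p≤ 0≤x
    p≈p′ : p ≈ʳ p′
    p≈p′ = clamp-≈ p (n ^ʳ r) 0≤p p≤ 0≤x
    Pr Pr′ : ℕ → ℚ
    Pr i = seq (Σʳ (List.map (weight p) Gs)) i
    Pr′ i = sum (graphWeight (seq p′ i)) Gs
    go : Eventually (λ i → ℚ.∣ Pr i - seq (Σʳ (List.map (weight p′) Gs)) i ∣ ≤ η) →
         Eventually (λ i → 1ℚ ≤ Pr i + (η + η) × Pr i ≤ 1ℚ + η)
    go (J , close) = I ⊔ J , λ i i≥ → lower i i≥ , upper i i≥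
      where
      open ℚ.≤-Reasoning
      close′ : ∀ i → I ⊔ J ℕ.≤ i → ℚ.∣ Pr i - Pr′ i ∣ ≤ η
      close′ i i≥ = subst (λ z → ℚ.∣ Pr i - z ∣ ≤ η) (seq-Σʳ-weight p′ i Gs)
                      (close i (ℕ.m⊔n≤o⇒n≤o I J i≥))
      0≤y : ∀ i → 0ℚ ≤ seq p′ i
      0≤y = clamp-nonNeg p (n ^ʳ r) 0≤p p≤ 0≤x
      y≤x : ∀ i → seq p′ i ≤ approxPow n (seq r i) i
      y≤x = clamp-≤ p (n ^ʳ r) 0≤p p≤ 0≤x
      x-bound : ∀ i → I ⊔ J ℕ.≤ i →
                approxPow n (seq r i) i ^ (suc k ℕ.* suc e) * frac n 0 ^ (suc k ℕ.+ suc e) ≤ 1ℚ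
      x-bound i i≥ = approxPow-bound n k e (seq r i) i (r≤ i (ℕ.m⊔n≤o⇒m≤o I J i≥))
      y≤1 : ∀ i → I ⊔ J ℕ.≤ i → seq p′ i ≤ 1ℚ
      y≤1 i i≥ = edge-probability≤1 n k e (x-bound i i≥) (0≤y i) (y≤x i)
      lower : ∀ i → I ⊔ J ℕ.≤ i → 1ℚ ≤ Pr i + (η + η)
      lower i i≥ = begin
        1ℚ                                      ≤⟨ collapsible-likely n k e (x-bound i i≥) (0≤y i) (y≤x i)
                                                     g (badSets + 1ℚ) g^E≤n (≤-+ʳ 0≤1) ⟩
        Pr′ i + (badSets + 1ℚ) * frac 1 g       ≤⟨ ℚ.+-mono-≤ (abs-upper (Pr′ i) (Pr i) η
                                                     (subst (_≤ η) (flip (Pr i) (Pr′ i)) (close′ i i≥))) small ⟩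
        (Pr i + η) + η                          ≡⟨ ℚ.+-assoc (Pr i) η η ⟩
        Pr i + (η + η)                          ∎
        where
        flip : ∀ a b → ℚ.∣ a - b ∣ ≡ ℚ.∣ b - a ∣
        flip a b = trans (sym (ℚ.∣-p∣≡∣p∣ (a - b))) (cong ℚ.∣_∣ (neg-sub a b))
          where
          neg-sub : ∀ a b → - (a - b) ≡ b - a
          neg-sub = solve-∀ ℚ-ring
      upper : ∀ i → I ⊔ J ℕ.≤ i → Pr i ≤ 1ℚ + η
      upper i i≥ = begin
        Pr i                                    ≤⟨ abs-upper (Pr i) (Pr′ i) η (close′ i i≥) ⟩
        Pr′ i + η                               ≤⟨ ℚ.+-monoˡ-≤ η (sum-filter-mono _ (graphs n)
                                                     (graphWeight-nonNeg (0≤y i) (y≤1 i i≥))) ⟩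
        sum (graphWeight (seq p′ i)) (graphs n) + η  ≡⟨ cong (λ z → z + η) (sum-graphWeight n (seq p′ i)) ⟩
        1ℚ + η                                  ∎

theorem1p1 : (k : ℕ) (ε : ℝ) → 0ʳ <ʳ ε →
    (p : ℕ → ℝ) →
    (∀ n → (0ʳ ≤ʳ p n) × (p n ≤ʳ 1ʳ)) →
    (∀ n .{{_ : NonZero n}} → p n ≤ʳ n ^ʳ (-ʳ fromℚ (+ 1 / suc k) -ʳ ε)) →
    (λ n → Pr[X⟨ n , p n ⟩∈ collapsible? (suc k) ]) ⟶ 1ʳ
theorem1p1 k ε (a , 0<a , I , a≤ε) p p-range p≤ δ (d , 0<d , J , d≤δ) =
  choose (scaled (badSets k e + 1ℚ) (badSets+1>0 k e) η 0<η)
  where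
  -- The denominator of `a` is `suc e`, so `1 / suc e ≤ a`, and `a` eventually lies below the terms
  -- of `ε`.
  e : ℕ
  e = ℚ.denominator-1 a
  -- A quarter of `d`: the error `η + η` is half of `d`, and the other half is the margin of the
  -- strict inequalities.
  η : ℚ
  η = ½ * (½ * d)
  0<η : 0ℚ < η
  0<η = half>0 (half>0 0<d)
  r : ℝ
  r = -ʳ fromℚ (+ 1 / suc k) -ʳ ε

  r≤ : Eventually (λ i → seq r i ≤ - frac 1 k - frac 1 e)
  r≤ = I , λ i i≥ → ℚ.+-monoʳ-≤ (- frac 1 k) (ℚ.neg-antimono-≤
    (ℚ.≤-trans (unit-small a 0<a e ℕ.≤-refl)
      (subst (_≤ seq ε i) (ℚ.+-identityˡ a) (a≤ε i i≥))))

  Near1 : (ℕ → ℚ) → Set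
  Near1 s = Eventually (λ i → 1ℚ ≤ s i + (η + η) × s i ≤ 1ℚ + η)

  conclude : ∀ x → Near1 (seq x) → (1ʳ -ʳ δ <ʳ x) × (x <ʳ 1ʳ +ʳ δ)
  conclude x (L , near) =
    (½ * d , half>0 0<d , J ⊔ L , λ i i≥ → lower i (d≤δ′ i i≥) (proj₁ (near i (ℕ.m⊔n≤o⇒n≤o J L i≥)))) ,
    (½ * d , half>0 0<d , J ⊔ L , λ i i≥ → upper i (d≤δ′ i i≥) (proj₂ (near i (ℕ.m⊔n≤o⇒n≤o J L i≥))))
    where
    open ℚ.≤-Reasoning
    d≤δ′ : ∀ i → J ⊔ L ℕ.≤ i → d ≤ seq δ i
    d≤δ′ i i≥ = subst (_≤ seq δ i) (ℚ.+-identityˡ d) (d≤δ i (ℕ.m⊔n≤o⇒m≤o J L i≥))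
    lower : ∀ i → d ≤ seq δ i → 1ℚ ≤ seq x i + (η + η) → (1ℚ - seq δ i) + ½ * d ≤ seq x i
    lower i d≤ 1≤ = begin
      (1ℚ - seq δ i) + ½ * d               ≤⟨ ℚ.+-monoˡ-≤ (½ * d) (ℚ.+-mono-≤ 1≤ (ℚ.neg-antimono-≤ d≤)) ⟩
      (seq x i + (η + η) - d) + ½ * d      ≡⟨ cong (λ z → (seq x i + z - d) + ½ * d) (half+half (½ * d)) ⟩
      (seq x i + ½ * d - d) + ½ * d        ≡⟨ rearrange (seq x i) (½ * d) d ⟩
      seq x i + (½ * d + ½ * d - d)        ≡⟨ cong (λ z → seq x i + (z - d)) (half+half d) ⟩
      seq x i + (d - d)                    ≡⟨ cong (λ z → seq x i + z) (ℚ.+-inverseʳ d) ⟩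
      seq x i + 0ℚ                         ≡⟨ ℚ.+-identityʳ (seq x i) ⟩
      seq x i                              ∎
      where
      rearrange : ∀ x h d → (x + h - d) + h ≡ x + (h + h - d)
      rearrange = solve-∀ ℚ-ring
    upper : ∀ i → d ≤ seq δ i → seq x i ≤ 1ℚ + η → seq x i + ½ * d ≤ 1ℚ + seq δ i
    upper i d≤ ≤1 = begin
      seq x i + ½ * d                      ≤⟨ ℚ.+-monoˡ-≤ (½ * d) (ℚ.≤-trans ≤1 (ℚ.+-monoʳ-≤ 1ℚ (≤-+ʳ {η} (ℚ.<⇒≤ 0<η)))) ⟩
      1ℚ + (η + η) + ½ * d                 ≡⟨ cong (λ z → 1ℚ + z + ½ * d) (half+half (½ * d)) ⟩
      1ℚ + ½ * d + ½ * d                   ≡⟨ ℚ.+-assoc 1ℚ (½ * d) (½ * d) ⟩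
      1ℚ + (½ * d + ½ * d)                 ≡⟨ cong (λ z → 1ℚ + z) (half+half d) ⟩
      1ℚ + d                               ≤⟨ ℚ.+-monoʳ-≤ 1ℚ d≤ ⟩
      1ℚ + seq δ i                         ∎

  choose : ∃[ γ ] (0ℚ < γ × (badSets k e + 1ℚ) * γ ≡ η) →
           ∃[ N ] (∀ n → N ℕ.≤ n → (1ʳ -ʳ δ <ʳ Pr[X⟨ n , p n ⟩∈ collapsible? (suc k) ])
                                 × (Pr[X⟨ n , p n ⟩∈ collapsible? (suc k) ] <ʳ 1ʳ +ʳ δ))
  -- From this threshold on `z` is at most `frac 1 g ≤ γ`, and `γ` is chosen so that the failure
  -- bound is at most `η`.
  choose (γ , 0<γ , Cγ) = suc g ℕ.^ suc e , λ n g^E≤n →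
      conclude Pr[X⟨ n , p n ⟩∈ collapsible? (suc k) ] (near n g^E≤n)
    where
    g : ℕ
    g = ℚ.denominator-1 γ
    near : ∀ n → suc g ℕ.^ suc e ℕ.≤ n → Near1 (seq Pr[X⟨ n , p n ⟩∈ collapsible? (suc k) ])
    near n g^E≤n = Pr-near-1 k e n (p n) r (proj₁ (p-range n)) (p≤ n) r≤ g η 0<η g^E≤n
      (subst ((badSets k e + 1ℚ) * frac 1 g ≤_) Cγ
        (*-monoˡ-≤ (ℚ.<⇒≤ (badSets+1>0 k e)) (unit-small γ 0<γ g ℕ.≤-refl)))
      where
      instance
        n≢0 : NonZero n
        n≢0 = ℕ.>-nonZero (ℕ.<-≤-trans (ℕ.m^n>0 (suc g) (suc e)) g^E≤n)
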